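{- The $1$-ancilla-integrity of an $n$-vertex graph $G$ can be computed in time $\mathcal{O}(n^6)$. That is, there is a (classical) algorithm which takes as input a graph $G$ with $n$ vertices and outputs the $1$-ancilla-integrity of $G$ in time $\mathcal{O}(n^6)$.
   Context: Graphs are finite, simple and undirected; the size of a component is its number of vertices. For a graph $G$ on vertex set $V$, the graph state on the qubit set $V$ is (up to normalization) $|G\rangle=\sum_{X\subseteq V}(-1)^{e_X}|1\rangle_X|0\rangle_{V\setminus X}$, where $e_X$ is the number of edges of $G$ induced by $X$. For graphs $G,G'$ on the same vertex set $V$, $d(|G\rangle,|G'\rangle)$ is the minimum of $|A|$ over all graph states $|\widehat G\rangle$ on a disjoint union $V\cup A$ from which each of $|G\rangle$ and $|G'\rangle$ can be prepared deterministically using only one-qubit Clifford gates, (destructive) one-qubit Pauli measurements, and classical communication. It is known that a graph $H$ is a vertex-minor of a graph $\widehat G$ if and only if $|\widehat G\rangle$ can be transformed deterministically into $|H\rangle$ by such operations; here locally complementing at a vertex $v$ replaces the induced subgraph on the neighborhood of $v$ by its complement, and the vertex-minors of a graph are the graphs obtained from it by vertex deletions and local complementations. So, equivalently, $d(|G\rangle,|G'\rangle)$ is the minimum $k$ such that some graph with vertex set consisting of $V$ and $k$ additional vertices contains both $G$ and $G'$ as vertex-minors. The $k$-ancilla-integrity of $G$ (or of $|G\rangle$) is the minimum, over all graphs $G'$ on $V(G)$ with $d(|G\rangle,|G'\rangle)\le k$, of the maximum component size of $G'$. -}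

module Defs where

open import Algebra.Properties.Monoid.Sum using (sum)
open import Data.Bool using (Bool; true; false; T; _∧_; if_then_else_)
open import Data.Fin using (Fin; zero; suc; toℕ; fromℕ<; remQuot; _↑ˡ_)
open import Data.Fin.Subset using (Subset; _∈_; ∣_∣)
open import Data.Integer as ℤ using (ℤ; 0ℤ; 1ℤ; -1ℤ)
open import Data.List using (List; head; drop)
open import Data.Maybe using (Maybe; just; nothing)
open import Data.Nat using (ℕ; zero; suc; _+_; _*_; _∸_; _^_; _≤_; _<_; _<ᵇ_; _≡ᵇ_; _<?_)
open import Data.Nat.Properties using (+-0-monoid)
open import Data.Product using (_×_; _,_; ∃-syntax; uncurry)
open import Data.Vec using (Vec; lookup; insertAt; _[_]≔_)
open import Function using (_⇔_)
open import Relation.Binary.Construct.Closure.ReflexiveTransitive using (Star)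
open import Relation.Binary.PropositionalEquality using (_≡_; _≢_)
open import Relation.Nullary using (yes; no)

IsMinimum : (ℕ → Set) → ℕ → Set
IsMinimum P m = P m × (∀ j → P j → m ≤ j)

------------------------------------------------------------------------
-- Graphs

record Graph (n : ℕ) : Set where
  field
    adj         : Fin n → Fin n → Bool
    symmetric   : ∀ u v → adj u v ≡ adj v u
    irreflexive : ∀ v → adj v v ≡ false

open Graph public

Edge : ∀ {n} → Graph n → Fin n → Fin n → Set
Edge G u v = T (adj G u v)

IsComponent : ∀ {n} → Graph n → Subset n → Set
IsComponent G C = ∃[ v ] (∀ w → w ∈ C ⇔ Star (Edge G) v w)

-- The maximum is taken as a least upper bound, so that it is 0 for the
-- graph with no vertices.
MaxComponentSize : ∀ {n} → Graph n → ℕ → Set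
MaxComponentSize G = IsMinimum (λ s → ∀ C → IsComponent G C → ∣ C ∣ ≤ s)

------------------------------------------------------------------------
-- Gaussian integers

record ℤ[i] : Set where
  constructor _+i_
  field
    re im : ℤ

infix  4 _+i_
infixl 6 _⊕_
infixl 7 _⊛_

_⊕_ _⊛_ : ℤ[i] → ℤ[i] → ℤ[i]
(a +i b) ⊕ (c +i d) = (a ℤ.+ c) +i (b ℤ.+ d)
(a +i b) ⊛ (c +i d) = (a ℤ.* c ℤ.- b ℤ.* d) +i (a ℤ.* d ℤ.+ b ℤ.* c)

0# 1# -1# 𝕚 -𝕚 : ℤ[i]
0#  = 0ℤ +i 0ℤ
1#  = 1ℤ +i 0ℤ
-1# = -1ℤ +i 0ℤ
𝕚   = 0ℤ +i 1ℤ
-𝕚  = 0ℤ +i -1ℤ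

------------------------------------------------------------------------
-- Unnormalized pure states.  A set X of qubits indexes the basis vector
-- |1⟩_X |0⟩_{V∖X}.  Graph states, Clifford gates and projections onto Pauli
-- eigenvectors all have amplitudes in ℤ[i] after scaling by powers of √2.

State : ℕ → Set
State m = Subset m → ℤ[i]

inducedEdges : ∀ {n} → Graph n → Subset n → ℕ
inducedEdges G X =
  sum +-0-monoid λ u → sum +-0-monoid λ v →
    if (toℕ u <ᵇ toℕ v) ∧ lookup X u ∧ lookup X v ∧ adj G u v then 1 else 0

graphState : ∀ {n} → Graph n → State n
graphState G X = (-1ℤ ℤ.^ inducedEdges G X) +i 0ℤ

Nonzero : ∀ {m} → State m → Set
Nonzero ψ = ∃[ X ] ψ X ≢ 0#

-- Equality of the physical states, when φ is a graph state: φ ∅ = 1, so a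
-- complex factor relating ψ to φ is ψ ∅ and hence lies in ℤ[i].
infix 4 _∝_
_∝_ : ∀ {m} → State m → State m → Set
ψ ∝ φ = ∃[ c ] (c ≢ 0# × (∀ X → ψ X ≡ c ⊛ φ X))

-- The Hadamard and phase gates generate the one-qubit Clifford group, up to
-- global phases.
data Gate : Set where
  H S : Gate

apply : ∀ {m} → Gate → Fin m → State m → State m
apply H q ψ X =
  ψ (X [ q ]≔ false) ⊕ (if lookup X q then -1# else 1#) ⊛ ψ (X [ q ]≔ true)
apply S q ψ X = (if lookup X q then 𝕚 else 1#) ⊛ ψ X

data Pauli : Set where
  σx σy σz : Pauli

-- collapse P s q ψ = (⟨p| on qubit q) ψ, where p is the eigenvector of P with
-- eigenvalue -1 if s is true and 1 otherwise.  Qubit q is destroyed.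
collapse : ∀ {m} → Pauli → Bool → Fin (suc m) → State (suc m) → State m
collapse σx s q ψ X =
  ψ (insertAt X q false) ⊕ (if s then -1# else 1#) ⊛ ψ (insertAt X q true)
collapse σy s q ψ X =
  ψ (insertAt X q false) ⊕ (if s then 𝕚 else -𝕚) ⊛ ψ (insertAt X q true)
collapse σz s q ψ X = ψ (insertAt X q s)

-- Preparable K k ψ: from the state ψ on k ancillas (the first k qubits)
-- followed by the qubits of V, an adaptive protocol always ends with |K⟩ on V.
-- Later operations may depend on earlier outcomes (classical communication);
-- outcomes of probability zero impose nothing.  Measurements are destructive,
-- so qubits of V are never measured and every ancilla has to be.
data Preparable {n} (K : Graph n) : (k : ℕ) → State (k + n) → Set where
  done    : ∀ {ψ} → ψ ∝ graphState K → Preparable K 0 ψ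
  gate    : ∀ {k ψ} (U : Gate) (q : Fin (k + n)) →
            Preparable K k (apply U q ψ) → Preparable K k ψ
  measure : ∀ {k ψ} (P : Pauli) (a : Fin (suc k)) →
            (∀ s → Nonzero (collapse P s (a ↑ˡ n) ψ) →
                   Preparable K k (collapse P s (a ↑ˡ n) ψ)) →
            Preparable K (suc k) ψ

CommonSource : ∀ {n} → ℕ → Graph n → Graph n → Set
CommonSource {n} k G G′ = ∃[ Ĝ ]
  (Preparable G k (graphState {k + n} Ĝ) × Preparable G′ k (graphState {k + n} Ĝ))

-- d(|G⟩,|G′⟩) ≤ k, where d is the least number of ancillas of a common source.
Distance≤ : ∀ {n} → ℕ → Graph n → Graph n → Set
Distance≤ k G G′ = ∃[ j ] (j ≤ k × CommonSource j G G′)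

IsAncillaIntegrity : ℕ → ∀ {n} → Graph n → ℕ → Set
IsAncillaIntegrity k {n} G =
  IsMinimum (λ s → ∃[ G′ ] (Distance≤ {n} k G G′ × MaxComponentSize G′ s))

------------------------------------------------------------------------
-- Word RAM with unit-cost instructions

-- Operands are register numbers.
data Instr : Set where
  const       : (d value : ℕ) → Instr
  add sub mul : (d a b : ℕ) → Instr
  load        : (d a : ℕ) → Instr              -- r_d := mem[r_a]
  store       : (a s : ℕ) → Instr              -- mem[r_a] := r_s
  jump        : (target : ℕ) → Instr
  jumpLess    : (a b target : ℕ) → Instr       -- if r_a < r_b

Program : Set
Program = List Instr

record Config : Set where
  constructor ⟨_,_,_⟩
  field
    pc  : ℕ
    reg : ℕ → ℕ
    mem : ℕ → ℕ

open Config public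

_[_↦_] : (ℕ → ℕ) → ℕ → ℕ → ℕ → ℕ
(f [ k ↦ v ]) x = if x ≡ᵇ k then v else f x

exec : Instr → Config → Config
exec (const d v)      ⟨ l , r , m ⟩ = ⟨ suc l , r [ d ↦ v ] , m ⟩
exec (add d a b)      ⟨ l , r , m ⟩ = ⟨ suc l , r [ d ↦ r a + r b ] , m ⟩
exec (sub d a b)      ⟨ l , r , m ⟩ = ⟨ suc l , r [ d ↦ r a ∸ r b ] , m ⟩
exec (mul d a b)      ⟨ l , r , m ⟩ = ⟨ suc l , r [ d ↦ r a * r b ] , m ⟩
exec (load d a)       ⟨ l , r , m ⟩ = ⟨ suc l , r [ d ↦ m (r a) ] , m ⟩
exec (store a s)      ⟨ l , r , m ⟩ = ⟨ suc l , r , m [ r a ↦ r s ] ⟩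
exec (jump t)         ⟨ l , r , m ⟩ = ⟨ t , r , m ⟩
exec (jumpLess a b t) ⟨ l , r , m ⟩ = ⟨ (if r a <ᵇ r b then t else suc l) , r , m ⟩

fetch : Program → ℕ → Maybe Instr
fetch p l = head (drop l p)

FitsWord : ℕ → Config → Set
FitsWord W c = (∀ k → reg c k < W) × (∀ a → mem c a < W)

-- Run p W t c c′: started at c, the program halts at c′ after t instructions,
-- and all register and memory contents on the way are below W.  The program
-- halts when the program counter leaves it.
data Run (p : Program) (W : ℕ) : ℕ → Config → Config → Set where
  halt : ∀ {c} → FitsWord W c → fetch p (pc c) ≡ nothing → Run p W 0 c c
  step : ∀ {t c c′ i} → FitsWord W c → fetch p (pc c) ≡ just i →
         Run p W t (exec i c) c′ → Run p W (suc t) c c′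

-- Row-major adjacency matrix: remQuot inverts (u , v) ↦ n * u + v.
adjacencyMatrix : ∀ {n} → Graph n → ℕ → ℕ
adjacencyMatrix {n} G a with a <? n * n
... | yes a<n² = if uncurry (adj G) (remQuot n (fromℕ< a<n²)) then 1 else 0
... | no  _    = 0

input : ∀ {n} → Graph n → Config
input {n} G = ⟨ 0 , (λ _ → 0) [ 0 ↦ n ] , adjacencyMatrix G ⟩

output : Config → ℕ
output c = reg c 0

-- Contents below (2 + n)^w amount to words of O(log n) bits.
ComputesInTime : Program → (∀ {n} → Graph n → ℕ → Set) → (ℕ → ℕ) → Set
ComputesInTime p R time =
  ∃[ w ] (∀ n (G : Graph n) → ∃[ t ] ∃[ c ]
    (t ≤ time n × Run p ((2 + n) ^ w) t (input G) c × R G (output c)))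

infix 4 _∈𝒪_
_∈𝒪_ : (ℕ → ℕ) → (ℕ → ℕ) → Set
f ∈𝒪 g = ∃[ C ] ∃[ N ] (∀ n → N ≤ n → f n ≤ C * g n)

{-# OPTIONS --safe #-}

-- An ancilla joined to a vertex set X turns into a complementation inside X when it is measured
-- in the basis σy, and is deleted when it is measured in the basis σz; so G and every graph obtained
-- from G, or from a local complement of G, by complementing inside a set X are within distance 1 of G.
-- Conversely, if G′ is within distance 1 of G and A is a union of components of G′, then |G′⟩ is a
-- product across A, hence the common source has Schmidt rank at most 2 and so has |G⟩: the cut-rank
-- of A in G is at most 1.  Thus G has a partition into parts of size at most the largest component
-- of G′ such that every union of parts has cut-rank at most 1.
--
-- For such a partition one of polynomially many sets X does as well.  If three parts are joined by
-- edges, then three vertices a, b, c in them form a triangle, after a local complementation at one of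
-- them if necessary, and X consists of the vertices adjacent to at least two of a, b, c.  Otherwise an
-- edge a b joins the only two parts that are joined at all.  The sets U with a ∈ U ∌ b of cut-rank 1
-- are the closed sets of a digraph, hence closed under unions.  Either one generated by a and a
-- single vertex x is balanced enough, or two of them cross and give a partition of the first kind.
--
-- With Warshall's algorithm each of the O(n³) triples costs O(n³).
module Submission where

open import Defs
open import Algebra.Bundles using (CommutativeRing)
open import Algebra.Properties.Monoid.Sum using (sum)
open import Algebra.Structures using (IsCommutativeRing)
open import Data.Bool using (Bool; true; false; T; not; _∧_; _∨_; _xor_; if_then_else_)
open import Data.Bool.Properties as Boolₚ using (∧-comm; ∧-identityʳ; ∧-zeroʳ; ∨-zeroʳ; ¬-not; xor-same)
open import Data.Empty using (⊥; ⊥-elim)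
open import Data.Fin using (Fin; zero; suc; toℕ; fromℕ<; remQuot; combine)
open import Data.Fin.Properties as Finₚ
  using (any?; toℕ-fromℕ<; fromℕ<-toℕ; toℕ<n; toℕ-injective; toℕ-combine; remQuot-combine)
open import Data.Fin.Subset using (Subset; ∣_∣)
open import Data.Fin.Subset.Properties using (anySubset?)
open import Data.Integer as ℤ using (ℤ; 0ℤ; 1ℤ; -1ℤ; -[1+_])
  renaming (+_ to pos; _+_ to _+ℤ_; _*_ to _*ℤ_; _-_ to _-ℤ_)
open import Data.Integer.Properties as ℤₚ using ()
open import Data.Integer.Tactic.RingSolver as ℤ-Solver using ()
open import Data.List as List using (List; []; _∷_; _++_; allFin; length)
open import Data.List.Membership.Propositional using () renaming (_∈_ to _∈ₗ_)
open import Data.List.Membership.Propositional.Properties using (∈-allFin)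
open import Data.List.Properties using (++-assoc; ++-identityʳ; length-++)
open import Data.List.Relation.Unary.Any using (here; there)
open import Data.Maybe using (just; nothing)
open import Data.Nat
  using (ℕ; zero; suc; _+_; _*_; _∸_; _^_; _≤_; _<_; _⊔_; _⊓_; _<ᵇ_; _≡ᵇ_; _<?_; _≤?_; z≤n; s≤s)
open import Data.Nat.Properties hiding (_≟_)
open import Data.Nat.Tactic.RingSolver as ℕ-Solver using ()
open import Data.Product using (_×_; _,_; ∃-syntax; proj₁; proj₂; uncurry)
open import Data.Product.Properties as ×ₚ using ()
open import Data.Sum using (_⊎_; inj₁; inj₂)
open import Data.Sum.Properties as ⊎ₚ using (inj₁-injective; inj₂-injective)
open import Data.Unit using (tt)
open import Data.Vec using (Vec; []; _∷_; lookup; tabulate; replicate; _[_]≔_)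
open import Data.Vec.Properties
  using ([]≔-idempotent; []≔-lookup; lookup∘update; lookup∘update′; lookup-replicate; []=⇒lookup; lookup⇒[]=;
         lookup∘tabulate; tabulate∘lookup; tabulate-cong; ≡-dec)
open import Function using (_∘_; mk⇔; Equivalence)
open import Level using (0ℓ)
open import Relation.Binary.Construct.Closure.ReflexiveTransitive using (Star; ε; _◅_; _◅◅_)
open import Relation.Binary.Definitions using (DecidableEquality; tri<; tri≈; tri>)
open import Relation.Binary.PropositionalEquality
open import Relation.Nullary using (¬_; Dec; does; yes; no; contradiction; recompute)
open import Relation.Nullary.Decidable
  using (_×-dec_; _→-dec_; _⊎-dec_; ¬?; from-yes; map′; dec-true; dec-false; decidable-stable)
open import Tactic.RingSolver using (solve-∀)
open import Tactic.RingSolver.Core.AlmostCommutativeRing using (AlmostCommutativeRing; fromCommutativeRing)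

-- The candidates must achieve the bound of a partition that is only known to exist. With three
-- joined classes, vanishing minors force any two triangle vertices outside the class of a vertex
-- `z` to look alike from `z`, so a majority vote recovers the vector that factors all crossing
-- edges without knowing the partition. With two joined classes the whole class of `a` would be a
-- balanced side, but a single vertex need not generate it. Principal sides united one after another
-- fill that class. If none of them is balanced, the union becomes balanced at some step although
-- neither of the two sets united there is; each of their differences then contains a neighbour of
-- `a` or `b`, which supplies the third joined class. No crossing edge lies outside the component of
-- `a`, so balance is measured inside it only. Ranks are sums of product terms up to a nonzero
-- factor, which avoids division in ℤ[i]. Since cut-rank is a notion over GF(2) and Schmidt rank one
-- over the Gaussian rationals, the two are compared through a single 3 × 3 determinant of signs.

Matrix : ℕ → Set
Matrix n = Fin n → Fin n → Bool

true? : (b : Bool) → b ≡ true ⊎ b ≡ false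
true? true  = inj₁ refl
true? false = inj₂ refl

∧-true : ∀ {x y} → x ∧ y ≡ true → x ≡ true × y ≡ true
∧-true {true} {true} _ = refl , refl

∨-true : ∀ {x y} → x ∨ y ≡ true → x ≡ true ⊎ y ≡ true
∨-true {true}  _ = inj₁ refl
∨-true {false} e = inj₂ e

not-true : ∀ {x} → not x ≡ true → x ≡ false
not-true {false} _ = refl

∨-introˡ : ∀ {x} y → x ≡ true → x ∨ y ≡ true
∨-introˡ y refl = refl

∨-introʳ : ∀ x {y} → y ≡ true → x ∨ y ≡ true
∨-introʳ x refl = ∨-zeroʳ x

-- Warshall's algorithm

pivotAt : ∀ {n} → Fin n → Matrix n → Matrix n
pivotAt k M i j = M i j ∨ (M i k ∧ M k j)

-- The bound on `k` is irrelevant, so the matrix does not depend on its proof.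
closureTo : ∀ {n} (k : ℕ) → .(k ≤ n) → Matrix n → Matrix n
closureTo zero    _   M = M
closureTo (suc k) k<n M = pivotAt (fromℕ< k<n) (closureTo k (<⇒≤ k<n) M)

closure : ∀ {n} → Matrix n → Matrix n
closure {n} = closureTo n ≤-refl

-- That row and column `k` survive the pivot serves twice: for transitivity at `k`, and later to let
-- the program overwrite the table in place.
pivotAt-column : ∀ {n} (k : Fin n) M i → pivotAt k M i k ≡ M i k
pivotAt-column k M i with M i k | M k k
... | true  | _ = refl
... | false | _ = refl

pivotAt-row : ∀ {n} (k : Fin n) M j → pivotAt k M k j ≡ M k j
pivotAt-row k M j with M k j | M k k
... | true  | _     = refl
... | false | true  = refl
... | false | false = refl

module _ {n : ℕ} where

  TransitiveAt : Fin n → Matrix n → Set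
  TransitiveAt m M = ∀ i j → M i m ≡ true → M m j ≡ true → M i j ≡ true

  -- A new entry at `m` is a detour through `k` whose half at `m` is an old entry; the old
  -- transitivity is applied to that half and the detour is closed again.
  pivotAt-keeps : ∀ k m M → TransitiveAt m M → TransitiveAt m (pivotAt k M)
  pivotAt-keeps k m M tr i j im mj with ∨-true im | ∨-true mj
  ... | inj₁ im₀ | inj₁ mj₀ = ∨-introˡ _ (tr i j im₀ mj₀)
  ... | inj₁ im₀ | inj₂ mkj with ∧-true mkj
  ...   | mk , kj = ∨-introʳ (M i j) (cong₂ _∧_ (tr i k im₀ mk) kj)
  pivotAt-keeps k m M tr i j im mj | inj₂ ikm | inj₁ mj₀ with ∧-true ikm
  ...   | ik , km = ∨-introʳ (M i j) (cong₂ _∧_ ik (tr k j km mj₀))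
  pivotAt-keeps k m M tr i j im mj | inj₂ ikm | inj₂ mkj with ∧-true {M i k} ikm | ∧-true {M m k} mkj
  ...   | ik , _ | _ , kj = ∨-introʳ (M i j) (cong₂ _∧_ ik kj)

  pivotAt-transitive : ∀ k M → TransitiveAt k (pivotAt k M)
  pivotAt-transitive k M i j ik kj = ∨-introʳ (M i j)
    (cong₂ _∧_ (trans (sym (pivotAt-column k M i)) ik) (trans (sym (pivotAt-row k M j)) kj))

  closureTo-transitive : ∀ k .(k≤n : k ≤ n) M (m : Fin n) → toℕ m < k →
                         TransitiveAt m (closureTo k k≤n M)
  closureTo-transitive (suc k) k<n M m (s≤s m≤k) with m≤n⇒m<n∨m≡n m≤k
  ... | inj₁ m<k  = pivotAt-keeps (fromℕ< k<n) m _ (closureTo-transitive k _ M m m<k)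
  ... | inj₂ refl = subst (λ v → TransitiveAt v (pivotAt (fromℕ< k<n) (closureTo k (<⇒≤ k<n) M)))
                          (fromℕ<-toℕ m k<n) (pivotAt-transitive (fromℕ< k<n) (closureTo k (<⇒≤ k<n) M))

  closureTo-⊇ : ∀ k .(k≤n : k ≤ n) M {i j} → M i j ≡ true → closureTo k k≤n M i j ≡ true
  closureTo-⊇ zero    _   M e = e
  closureTo-⊇ (suc k) k<n M e = ∨-introˡ _ (closureTo-⊇ k _ M e)

  -- Soundness is stated for predicates preserved along the entries of `M`, so that no paths have to
  -- be handled: being connected, lying in a class or lying in a closed set are all instances of
  -- `Q`.
  closureTo-sound : ∀ k .(k≤n : k ≤ n) M (Q : Fin n → Set) →
                    (∀ z w → Q z → M z w ≡ true → Q w) →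
                    ∀ z w → Q z → closureTo k k≤n M z w ≡ true → Q w
  closureTo-sound zero    _   M Q cl = cl
  closureTo-sound (suc k) k<n M Q cl z w Qz e with ∨-true e
  ... | inj₁ zw = closureTo-sound k _ M Q cl z w Qz zw
  ... | inj₂ zkw with ∧-true zkw
  ...   | zk , kw = closureTo-sound k _ M Q cl _ w (closureTo-sound k _ M Q cl z _ Qz zk) kw

  closure-⊇ : ∀ M {i j} → M i j ≡ true → closure M i j ≡ true
  closure-⊇ = closureTo-⊇ n ≤-refl

  closure-transitive : ∀ M i j k → closure M i j ≡ true → closure M j k ≡ true →
                       closure M i k ≡ true
  closure-transitive M i j k = closureTo-transitive n ≤-refl M j (toℕ<n j) i k

  closure-sound : ∀ M (Q : Fin n → Set) → (∀ z w → Q z → M z w ≡ true → Q w) →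
                  ∀ z w → Q z → closure M z w ≡ true → Q w
  closure-sound = closureTo-sound n ≤-refl

  -- Warshall's algorithm yields walks of positive length; the empty walk is added here.
  reachable : Matrix n → Matrix n
  reachable M i j = closure M i j ∨ does (i Finₚ.≟ j)

-- Iterated operations over Fin n

-- The last index is combined last, as in a program loop, so that the value at `k` is the loop
-- invariant after `k` rounds.
foldTo : ∀ {n} → (ℕ → ℕ → ℕ) → ℕ → (k : ℕ) → .(k ≤ n) → (Fin n → ℕ) → ℕ
foldTo _∙_ z zero    _   f = z
foldTo _∙_ z (suc k) k<n f = foldTo _∙_ z k (<⇒≤ k<n) f ∙ f (fromℕ< k<n)

bit : Bool → ℕ
bit b = if b then 1 else 0

-- The minimum starts from `n`, which bounds every component size and so plays the role of infinity.
maximum minimum : ∀ {n} → (Fin n → ℕ) → ℕ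
maximum {n} = foldTo _⊔_ 0 n ≤-refl
minimum {n} = foldTo _⊓_ n n ≤-refl

count : ∀ {n} → (Fin n → Bool) → ℕ
count {n} f = foldTo _+_ 0 n ≤-refl (bit ∘ f)

module _ {n : ℕ} where

  -- `foldTo` grows at the last index while the size of a subset grows at the first one; this
  -- recursion reconciles the two.
  foldTo-suc : ∀ k .(k≤n : k ≤ n) (f : Fin (suc n) → ℕ) →
               foldTo _+_ 0 (suc k) (s≤s k≤n) f ≡ f zero + foldTo _+_ 0 k k≤n (f ∘ suc)
  foldTo-suc zero    _   f = sym (+-identityʳ _)
  foldTo-suc (suc k) k<n f = trans (cong (_+ f (suc (fromℕ< k<n))) (foldTo-suc k (<⇒≤ k<n) f))
                                   (+-assoc (f zero) _ _)

  ⊔-foldTo-upper : ∀ k .(k≤n : k ≤ n) f (i : Fin n) → toℕ i < k → f i ≤ foldTo _⊔_ 0 k k≤n f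
  ⊔-foldTo-upper (suc k) k<n f i (s≤s i≤k) with m≤n⇒m<n∨m≡n i≤k
  ... | inj₁ i<k  = ≤-trans (⊔-foldTo-upper k _ f i i<k) (m≤m⊔n _ _)
  ... | inj₂ refl = ≤-trans (≤-reflexive (cong f (sym (fromℕ<-toℕ i k<n)))) (m≤n⊔m _ _)

  ⊔-foldTo-least : ∀ k .(k≤n : k ≤ n) f {s} → (∀ i → f i ≤ s) → foldTo _⊔_ 0 k k≤n f ≤ s
  ⊔-foldTo-least zero    _   f le = z≤n
  ⊔-foldTo-least (suc k) k<n f le = ⊔-lub (⊔-foldTo-least k _ f le) (le _)

  ⊓-foldTo-lower : ∀ k .(k≤n : k ≤ n) f (i : Fin n) → toℕ i < k → foldTo _⊓_ n k k≤n f ≤ f i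
  ⊓-foldTo-lower (suc k) k<n f i (s≤s i≤k) with m≤n⇒m<n∨m≡n i≤k
  ... | inj₁ i<k  = ≤-trans (m⊓n≤m _ _) (⊓-foldTo-lower k _ f i i<k)
  ... | inj₂ refl = ≤-trans (m⊓n≤n (foldTo _⊓_ n (toℕ i) _ f) _) (≤-reflexive (cong f (fromℕ<-toℕ i k<n)))

  ⊓-foldTo-attained : ∀ k .(k≤n : k ≤ n) (f : Fin n → ℕ) (P : ℕ → Set) →
                      P n → (∀ i → P (f i)) → P (foldTo _⊓_ n k k≤n f)
  ⊓-foldTo-attained zero    _   f P Pn Pf = Pn
  ⊓-foldTo-attained (suc k) k<n f P Pn Pf
    with ⊓-sel (foldTo _⊓_ n k (<⇒≤ k<n) f) (f (fromℕ< k<n))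
  ... | inj₁ e = subst P (sym e) (⊓-foldTo-attained k _ f P Pn Pf)
  ... | inj₂ e = subst P (sym e) (Pf _)

  maximum-upper : ∀ f (i : Fin n) → f i ≤ maximum f
  maximum-upper f i = ⊔-foldTo-upper n ≤-refl f i (toℕ<n i)

  maximum-least : ∀ (f : Fin n → ℕ) {s} → (∀ i → f i ≤ s) → maximum f ≤ s
  maximum-least = ⊔-foldTo-least n ≤-refl

  minimum-lower : ∀ f (i : Fin n) → minimum f ≤ f i
  minimum-lower f i = ⊓-foldTo-lower n ≤-refl f i (toℕ<n i)

  minimum-attained : ∀ (f : Fin n → ℕ) (P : ℕ → Set) → P n → (∀ i → P (f i)) → P (minimum f)
  minimum-attained = ⊓-foldTo-attained n ≤-refl

count≡∣tabulate∣ : ∀ {n} (f : Fin n → Bool) → count f ≡ ∣ tabulate f ∣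
count≡∣tabulate∣ {zero}  f = refl
count≡∣tabulate∣ {suc n} f with trans (foldTo-suc n ≤-refl (bit ∘ f))
                                      (cong (bit (f zero) +_) (count≡∣tabulate∣ (f ∘ suc)))
... | e with f zero
...   | true  = e
...   | false = e

∀-Bool? : {P : Bool → Set} → (∀ b → Dec (P b)) → Dec (∀ b → P b)
∀-Bool? P? with P? true | P? false
... | yes t | yes f = yes λ { true → t ; false → f }
... | no ¬t | _     = no λ h → ¬t (h true)
... | yes _ | no ¬f = no λ h → ¬f (h false)

infix 4 _≟ᵇ_
_≟ᵇ_ : DecidableEquality Bool
_≟ᵇ_ = Boolₚ._≟_

false≢true : ∀ {x} → x ≡ false → x ≢ true
false≢true refl ()

does-true : ∀ {A : Set} (d : Dec A) → does d ≡ true → A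
does-true (yes a) _ = a

count-mono : ∀ {n} (f g : Fin n → Bool) → (∀ i → f i ≡ true → g i ≡ true) → count f ≤ count g
count-mono {n} f g f⊆g = go n ≤-refl
  where
  bits : ∀ {x y} → (x ≡ true → y ≡ true) → bit x ≤ bit y
  bits {false} _ = z≤n
  bits {true}  h rewrite h refl = ≤-refl
  go : ∀ k .(k≤n : k ≤ n) → foldTo _+_ 0 k k≤n (bit ∘ f) ≤ foldTo _+_ 0 k k≤n (bit ∘ g)
  go zero    _   = z≤n
  go (suc k) k<n = +-mono-≤ (go k _) (bits (f⊆g _))

reachable-sound : ∀ {n} M (Q : Fin n → Set) → (∀ z w → Q z → M z w ≡ true → Q w) →
                  ∀ z w → Q z → reachable M z w ≡ true → Q w
reachable-sound M Q cl z w Qz e with ∨-true e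
... | inj₁ zw = closure-sound M Q cl z w Qz zw
... | inj₂ z≡w = subst Q (does-true (z Finₚ.≟ w) z≡w) Qz

reachable-refl : ∀ {n} M (z : Fin n) → reachable M z z ≡ true
reachable-refl M z = ∨-introʳ (closure M z z) (dec-true (z Finₚ.≟ z) refl)

reachable-step : ∀ {n} M (x z w : Fin n) → reachable M x z ≡ true → M z w ≡ true →
                 reachable M x w ≡ true
reachable-step M x z w xz zw with ∨-true xz
... | inj₁ cl  = ∨-introˡ _ (closure-transitive M x z w cl (closure-⊇ M zw))
... | inj₂ x≡z rewrite does-true (x Finₚ.≟ z) x≡z = ∨-introˡ _ (closure-⊇ M zw)

-- Graphs obtained by complementing inside a vertex set

-- The diagonal is cleared, because `f u ∧ f u` would put a loop at every vertex of `f`.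
toggledMatrix : ∀ {n} → Matrix n → (Fin n → Bool) → Matrix n
toggledMatrix M f u v = not (does (u Finₚ.≟ v)) ∧ (M u v xor (f u ∧ f v))

toggledMatrix-≢ : ∀ {n} (M : Matrix n) f {u v} → u ≢ v → toggledMatrix M f u v ≡ M u v xor (f u ∧ f v)
toggledMatrix-≢ M f {u} {v} u≢v rewrite dec-false (u Finₚ.≟ v) u≢v = refl

toggle : ∀ {n} → Graph n → (Fin n → Bool) → Graph n
toggle G f .adj = toggledMatrix (adj G) f
toggle G f .symmetric u v with u Finₚ.≟ v
... | yes refl rewrite dec-true (u Finₚ.≟ u) refl = refl
... | no u≢v rewrite dec-false (v Finₚ.≟ u) (u≢v ∘ sym) =
  cong₂ _xor_ (symmetric G u v) (∧-comm (f u) (f v))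
toggle G f .irreflexive v rewrite dec-true (v Finₚ.≟ v) refl = refl

localComplement : ∀ {n} → Graph n → Fin n → Graph n
localComplement G a = toggle G (adj G a)

-- The majority function as a polynomial over GF(2), the form in which the program evaluates it.
majority : Bool → Bool → Bool → Bool
majority x y z = (x ∧ y) xor ((y ∧ z) xor (x ∧ z))

majorityVector : ∀ {n} → Matrix n → Fin n → Fin n → Fin n → Fin n → Bool
majorityVector M a b c z = majority (M z a) (M z b) (M z c)

-- For adjacent a ∈ U and b ∉ U, the set U has cut-rank 1 iff no arc leaves it: every 2 × 2 minor
-- through the entry a b vanishes.
arc : ∀ {n} → Matrix n → Fin n → Fin n → Matrix n
arc M a b z w = M z w xor (M z b ∧ M a w)

-- If `a b` is an edge, no arc leaves `a`; so adding `a` to the vertices reachable from `x` gives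
-- the least closed set containing `a` and `x`.
side : ∀ {n} → Matrix n → Fin n → Fin n → Fin n → Fin n → Bool
side M a b x z = reachable (arc M a b) x z ∨ does (a Finₚ.≟ z)

-- If no arc leaves `U`, then an entry `z w` with `z` inside and `w` outside equals `M z b ∧ M a w`.
-- The vector is chosen to have this product on crossing pairs, so that toggling erases all crossing
-- edges.
cutVector : ∀ {n} → Matrix n → Fin n → Fin n → (Fin n → Bool) → Fin n → Bool
cutVector M a b U z = if U z then M z b else M z a

data Candidate {n} (G : Graph n) : Graph n → Set where
  unchanged  : Candidate G G
  clique     : ∀ a b c → Candidate G (toggle G (majorityVector (adj G) a b c))
  star       : ∀ a b c → let H = localComplement G a in
               Candidate G (toggle H (majorityVector (adj H) a b c))
  separation : ∀ a b x → Candidate G (toggle G (cutVector (adj G) a b (side (adj G) a b x)))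

-- A closed set around `v` bounds the component of `v` without determining it.
Small : ∀ {n} → Graph n → ℕ → Set
Small {n} K s = ∀ v → ∃[ U ] (U v ≡ true × count U ≤ s ×
                              (∀ z w → U z ≡ true → adj K z w ≡ true → U w ≡ true))

GoodCandidate : ∀ {n} → Graph n → ℕ → Set
GoodCandidate G s = ∃[ K ] (Candidate G K × Small K s)

-- Every union of classes of p has cut-rank at most 1.
Good : ∀ {n} {L : Set} → Graph n → (Fin n → L) → Set
Good {n} G p = ∀ (x x′ y y′ : Fin n) → p x ≢ p y → p x ≢ p y′ → p x′ ≢ p y → p x′ ≢ p y′ →
               adj G x y ∧ adj G x′ y′ ≡ adj G x y′ ∧ adj G x′ y

-- A row operation: multiples of a row `u v` are added to the rows `p q` and `r s`. The minor stays
-- balanced because the minors formed with the row `u v` are balanced too.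
minor-invariant : ∀ α α′ p q r s u v → p ∧ s ≡ q ∧ r → p ∧ v ≡ q ∧ u → u ∧ s ≡ v ∧ r →
  (p xor (α ∧ u)) ∧ (s xor (α′ ∧ v)) ≡ (q xor (α ∧ v)) ∧ (r xor (α′ ∧ u))
minor-invariant = from-yes
  (∀-Bool? λ α → ∀-Bool? λ α′ → ∀-Bool? λ p → ∀-Bool? λ q →
   ∀-Bool? λ r → ∀-Bool? λ s → ∀-Bool? λ u → ∀-Bool? λ v →
   (p ∧ s ≟ᵇ q ∧ r) →-dec ((p ∧ v ≟ᵇ q ∧ u) →-dec ((u ∧ s ≟ᵇ v ∧ r) →-dec
   ((p xor (α ∧ u)) ∧ (s xor (α′ ∧ v)) ≟ᵇ (q xor (α ∧ v)) ∧ (r xor (α′ ∧ u))))))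

-- The same for a column `u`, `v` added to the two columns.
minor-invariantᵀ : ∀ α α′ p q r s u v → p ∧ s ≡ q ∧ r → p ∧ v ≡ u ∧ r → u ∧ s ≡ q ∧ v →
  (p xor (u ∧ α)) ∧ (s xor (v ∧ α′)) ≡ (q xor (u ∧ α′)) ∧ (r xor (v ∧ α))
minor-invariantᵀ = from-yes
  (∀-Bool? λ α → ∀-Bool? λ α′ → ∀-Bool? λ p → ∀-Bool? λ q →
   ∀-Bool? λ r → ∀-Bool? λ s → ∀-Bool? λ u → ∀-Bool? λ v →
   (p ∧ s ≟ᵇ q ∧ r) →-dec ((p ∧ v ≟ᵇ u ∧ r) →-dec ((u ∧ s ≟ᵇ q ∧ v) →-dec
   ((p xor (u ∧ α)) ∧ (s xor (v ∧ α′)) ≟ᵇ (q xor (u ∧ α′)) ∧ (r xor (v ∧ α))))))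

-- Good partitions with edges between three classes

module _ {n : ℕ} {L : Set} (_≟_ : DecidableEquality L) where

  ClassesBounded : (Fin n → L) → ℕ → Set
  ClassesBounded p s = ∀ v → count (λ z → does (p z ≟ p v)) ≤ s

  small-by-classes : ∀ (K : Graph n) (p : Fin n → L) {s} → ClassesBounded p s →
                     (∀ z w → adj K z w ≡ true → p z ≡ p w) → Small K s
  small-by-classes K p bounded mono v =
    (λ z → does (p z ≟ p v)) , dec-true (p v ≟ p v) refl , bounded v ,
    λ z w z~v zw → dec-true (p w ≟ p v) (trans (sym (mono z w zw)) (does-true (p z ≟ p v) z~v))

  -- Local complementation at `a` adds a multiple of row `a` to each row, or equally of column `a`
  -- to each column. If `a` shares its class with `x` or `x′`, its class differs from those of `y`
  -- and `y′` and `a` is admissible as a row; otherwise it is admissible as a column.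
  good-localComplement : ∀ (G : Graph n) (p : Fin n → L) a → Good G p → Good (localComplement G a) p
  good-localComplement G p a good x x′ y y′ xy xy′ x′y x′y′
    rewrite toggledMatrix-≢ (adj G) (adj G a) (xy ∘ cong p)
          | toggledMatrix-≢ (adj G) (adj G a) (xy′ ∘ cong p)
          | toggledMatrix-≢ (adj G) (adj G a) (x′y ∘ cong p)
          | toggledMatrix-≢ (adj G) (adj G a) (x′y′ ∘ cong p)
    with (p x ≟ p a) ⊎-dec (p x′ ≟ p a)
  ... | yes xa⊎x′a =
    minor-invariant (A a x) (A a x′) (A x y) (A x y′) (A x′ y) (A x′ y′) (A a y) (A a y′)
      (good x x′ y y′ xy xy′ x′y x′y′) (good x a y y′ xy xy′ (ay xa⊎x′a) (ay′ xa⊎x′a))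
      (good a x′ y y′ (ay xa⊎x′a) (ay′ xa⊎x′a) x′y x′y′)
    where
    A = adj G
    ay : p x ≡ p a ⊎ p x′ ≡ p a → p a ≢ p y
    ay (inj₁ e) = xy ∘ trans e
    ay (inj₂ e) = x′y ∘ trans e
    ay′ : p x ≡ p a ⊎ p x′ ≡ p a → p a ≢ p y′
    ay′ (inj₁ e) = xy′ ∘ trans e
    ay′ (inj₂ e) = x′y′ ∘ trans e
  ... | no ¬xa⊎x′a rewrite symmetric G a x | symmetric G a x′ =
    minor-invariantᵀ (A a y) (A a y′) (A x y) (A x y′) (A x′ y) (A x′ y′) (A x a) (A x′ a)
      (good x x′ y y′ xy xy′ x′y x′y′)
      (good x x′ y a xy (¬xa⊎x′a ∘ inj₁) x′y (¬xa⊎x′a ∘ inj₂))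
      (good x x′ a y′ (¬xa⊎x′a ∘ inj₁) xy′ (¬xa⊎x′a ∘ inj₂) x′y′)
    where
    A = adj G

  module Triangle (G : Graph n) (p : Fin n → L) (good : Good G p) (v : Fin 3 → Fin n)
                  (apart : ∀ i j → i ≢ j → p (v i) ≢ p (v j))
                  (adjacent : ∀ i j → i ≢ j → adj G (v i) (v j) ≡ true) where
    private
      A = adj G
      0₃ 1₃ 2₃ : Fin 3
      0₃ = zero
      1₃ = suc zero
      2₃ = suc (suc zero)

    f : Fin n → Bool
    f = majorityVector A (v 0₃) (v 1₃) (v 2₃)

    -- The row of `v k` has two ones in the columns `v i` and `v j`, so the vanishing minor makes
    -- the row of `z` constant there.
    two-agree : ∀ z i j k → i ≢ k → j ≢ k → p z ≢ p (v i) → p z ≢ p (v j) → A z (v i) ≡ A z (v j)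
    two-agree z i j k i≢k j≢k zi zj = begin
      A z (v i)                    ≡⟨ ∧-identityʳ _ ⟨
      A z (v i) ∧ true             ≡⟨ cong (A z (v i) ∧_) (adjacent k j (j≢k ∘ sym)) ⟨
      A z (v i) ∧ A (v k) (v j)    ≡⟨ good z (v k) (v i) (v j) zi zj
                                        (apart k i (i≢k ∘ sym)) (apart k j (j≢k ∘ sym)) ⟩
      A z (v j) ∧ A (v k) (v i)    ≡⟨ cong (A z (v j) ∧_) (adjacent k i (i≢k ∘ sym)) ⟩
      A z (v j) ∧ true             ≡⟨ ∧-identityʳ _ ⟩
      A z (v j)                    ∎
      where open ≡-Reasoning

    majority₀₁ : ∀ x y → majority x x y ≡ x
    majority₀₁ = from-yes (∀-Bool? λ x → ∀-Bool? λ y → majority x x y ≟ᵇ x)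

    majority₀₂ : ∀ x y → majority x y x ≡ x
    majority₀₂ = from-yes (∀-Bool? λ x → ∀-Bool? λ y → majority x y x ≟ᵇ x)

    majority₁₂ : ∀ x y → majority y x x ≡ x
    majority₁₂ = from-yes (∀-Bool? λ x → ∀-Bool? λ y → majority y x x ≟ᵇ x)

    -- At most one of the three vertices shares the class of `z`. So a second one besides `v i` lies
    -- outside it, agrees with `v i` as seen from `z`, and these two decide the majority.
    f-value : ∀ z i → p z ≢ p (v i) → f z ≡ A z (v i)
    f-value z zero z0 with p z ≟ p (v 1₃)
    ... | no z1  rewrite two-agree z 1₃ 0₃ 2₃ (λ ()) (λ ()) z1 z0 = majority₀₁ _ _
    ... | yes z1 rewrite two-agree z 2₃ 0₃ 1₃ (λ ()) (λ ()) (λ z2 → apart 1₃ 2₃ (λ ()) (trans (sym z1) z2)) z0 =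
      majority₀₂ _ _
    f-value z (suc zero) z1 with p z ≟ p (v 0₃)
    ... | no z0  rewrite two-agree z 0₃ 1₃ 2₃ (λ ()) (λ ()) z0 z1 = majority₀₁ _ _
    ... | yes z0 rewrite two-agree z 2₃ 1₃ 0₃ (λ ()) (λ ()) (λ z2 → apart 0₃ 2₃ (λ ()) (trans (sym z0) z2)) z1 =
      majority₁₂ _ (A z (v 0₃))
    f-value z (suc (suc zero)) z2 with p z ≟ p (v 0₃)
    ... | no z0  rewrite two-agree z 0₃ 2₃ 1₃ (λ ()) (λ ()) z0 z2 = majority₀₂ _ _
    ... | yes z0 rewrite two-agree z 1₃ 2₃ 0₃ (λ ()) (λ ()) (λ z1 → apart 0₃ 1₃ (λ ()) (trans (sym z0) z1)) z2 =
      majority₁₂ _ (A z (v 0₃))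

    nearest : ∀ z → ∃[ i ] (∀ j → j ≢ i → p z ≢ p (v j))
    nearest z with any? (λ i → p z ≟ p (v i))
    ... | yes (i , zi) = i , λ j j≢i zj → apart j i j≢i (trans (sym zj) zi)
    ... | no ¬zi       = zero , λ j _ zj → ¬zi (j , zj)

    others : (i : Fin 3) → ∃[ j ] ∃[ k ] (j ≢ i × k ≢ i × j ≢ k)
    others zero             = 1₃ , 2₃ , (λ ()) , (λ ()) , λ ()
    others (suc zero)       = 0₃ , 2₃ , (λ ()) , (λ ()) , λ ()
    others (suc (suc zero)) = 0₃ , 1₃ , (λ ()) , (λ ()) , λ ()

    -- These are the conditions under which the minor with rows `x`, `v j` and columns `y`, `v k` is
    -- admissible; it writes the entry `x y` as a product of values of `f`.
    separators : ∀ x y → ∃[ j ] ∃[ k ] (p y ≢ p (v j) × p x ≢ p (v k) × j ≢ k)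
    separators x y with nearest x | nearest y
    ... | i , x≁ | i′ , y≁ with i Finₚ.≟ i′
    ...   | no i≢i′  = i , i′ , y≁ i i≢i′ , x≁ i′ (i≢i′ ∘ sym) , i≢i′
    ...   | yes refl with others i
    ...     | j , k , j≢i , k≢i , j≢k = j , k , y≁ j j≢i , x≁ k k≢i , j≢k

    factors : ∀ x y → p x ≢ p y → A x y ≡ f x ∧ f y
    factors x y xy with separators x y
    ... | j , k , yj , xk , j≢k = begin
      A x y                       ≡⟨ ∧-identityʳ _ ⟨
      A x y ∧ true                ≡⟨ cong (A x y ∧_) (adjacent j k j≢k) ⟨
      A x y ∧ A (v j) (v k)       ≡⟨ good x (v j) y (v k) xy xk (yj ∘ sym) (apart j k j≢k) ⟩
      A x (v k) ∧ A (v j) y       ≡⟨ cong (A x (v k) ∧_) (symmetric G (v j) y) ⟩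
      A x (v k) ∧ A y (v j)       ≡⟨ cong₂ _∧_ (f-value x k xk) (f-value y j yj) ⟨
      f x ∧ f y                   ∎
      where open ≡-Reasoning

    separated : ∀ x y → adj (toggle G f) x y ≡ true → p x ≡ p y
    separated x y e with p x ≟ p y
    ... | yes xy = xy
    ... | no xy  = contradiction e (false≢true (begin
      toggledMatrix A f x y          ≡⟨ toggledMatrix-≢ A f (xy ∘ cong p) ⟩
      A x y xor (f x ∧ f y)          ≡⟨ cong (_xor (f x ∧ f y)) (factors x y xy) ⟩
      (f x ∧ f y) xor (f x ∧ f y)    ≡⟨ xor-same (f x ∧ f y) ⟩
      false                          ∎))
      where open ≡-Reasoning

  triangle-small : ∀ (G : Graph n) (p : Fin n → L) {s} → Good G p → ClassesBounded p s → ∀ a b c →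
                   p a ≢ p b → p a ≢ p c → p b ≢ p c →
                   adj G a b ≡ true → adj G a c ≡ true → adj G b c ≡ true →
                   Small (toggle G (majorityVector (adj G) a b c)) s
  triangle-small G p good bounded a b c ab ac bc Aab Aac Abc =
    small-by-classes (toggle G (majorityVector (adj G) a b c)) p bounded (Triangle.separated G p good v apart adjacent)
    where
    v : Fin 3 → Fin n
    v = lookup (a ∷ b ∷ c ∷ [])
    apart : ∀ i j → i ≢ j → p (v i) ≢ p (v j)
    apart zero             zero             i≢j = contradiction refl i≢j
    apart zero             (suc zero)       _   = ab
    apart zero             (suc (suc zero)) _   = ac
    apart (suc zero)       zero             _   = ab ∘ sym
    apart (suc zero)       (suc zero)       i≢j = contradiction refl i≢j
    apart (suc zero)       (suc (suc zero)) _   = bc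
    apart (suc (suc zero)) zero             _   = ac ∘ sym
    apart (suc (suc zero)) (suc zero)       _   = bc ∘ sym
    apart (suc (suc zero)) (suc (suc zero)) i≢j = contradiction refl i≢j
    adjacent : ∀ i j → i ≢ j → adj G (v i) (v j) ≡ true
    adjacent zero             zero             i≢j = contradiction refl i≢j
    adjacent zero             (suc zero)       _   = Aab
    adjacent zero             (suc (suc zero)) _   = Aac
    adjacent (suc zero)       zero             _   = trans (symmetric G b a) Aab
    adjacent (suc zero)       (suc zero)       i≢j = contradiction refl i≢j
    adjacent (suc zero)       (suc (suc zero)) _   = Abc
    adjacent (suc (suc zero)) zero             _   = trans (symmetric G c a) Aac
    adjacent (suc (suc zero)) (suc zero)       _   = trans (symmetric G c b) Abc
    adjacent (suc (suc zero)) (suc (suc zero)) i≢j = contradiction refl i≢j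

  -- Complementing at the middle vertex `a` of the path creates the edge `b c`, and it keeps the
  -- edges at `a` because `a` is not its own neighbour.
  star-small : ∀ (G : Graph n) (p : Fin n → L) {s} → Good G p → ClassesBounded p s → ∀ a b c →
               p a ≢ p b → p a ≢ p c → p b ≢ p c →
               adj G a b ≡ true → adj G a c ≡ true → adj G b c ≡ false →
               GoodCandidate G s
  star-small G p good bounded a b c ab ac bc Aab Aac Abc =
    _ , star a b c ,
    triangle-small (localComplement G a) p (good-localComplement G p a good) bounded a b c ab ac bc
      (edge ab (cong₂ (λ x y → x xor (y ∧ A a b)) Aab (irreflexive G a)))
      (edge ac (cong₂ (λ x y → x xor (y ∧ A a c)) Aac (irreflexive G a)))
      (edge bc (cong₂ _xor_ Abc (cong₂ _∧_ Aab Aac)))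
    where
    A = adj G
    edge : ∀ {x y} → p x ≢ p y → A x y xor (A a x ∧ A a y) ≡ true →
           toggledMatrix A (A a) x y ≡ true
    edge xy = trans (toggledMatrix-≢ A (A a) (xy ∘ cong p))

  three-classes : ∀ (G : Graph n) (p : Fin n → L) {s} → Good G p → ClassesBounded p s → ∀ a b c →
                  p a ≢ p b → p a ≢ p c → p b ≢ p c → adj G a b ≡ true →
                  adj G a c ≡ true ⊎ adj G b c ≡ true → GoodCandidate G s
  three-classes G p good bounded a b c ab ac bc Aab e
    with adj G a c in Aac | adj G b c in Abc
  ... | true  | true  = _ , clique a b c , triangle-small G p good bounded a b c ab ac bc Aab Aac Abc
  ... | true  | false = star-small G p good bounded a b c ab ac bc Aab Aac Abc
  ... | false | true  = star-small G p good bounded b a c (ab ∘ sym) bc ac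
                          (trans (symmetric G b a) Aab) Abc Aac
  three-classes G p good bounded a b c ab ac bc Aab (inj₁ ()) | false | false
  three-classes G p good bounded a b c ab ac bc Aab (inj₂ ()) | false | false

xor-≡false : ∀ x y → x xor y ≡ false → x ≡ y
xor-≡false = from-yes (∀-Bool? λ x → ∀-Bool? λ y → (x xor y ≟ᵇ false) →-dec (x ≟ᵇ y))

∧-exchange : ∀ p q r s → (p ∧ q) ∧ (r ∧ s) ≡ (p ∧ s) ∧ (r ∧ q)
∧-exchange = from-yes
  (∀-Bool? λ p → ∀-Bool? λ q → ∀-Bool? λ r → ∀-Bool? λ s → (p ∧ q) ∧ (r ∧ s) ≟ᵇ (p ∧ s) ∧ (r ∧ q))

∧-proportional : ∀ α β p q r s → p ∧ s ≡ q ∧ r → (α ∧ r) ∧ (β ∧ q) ≡ (α ∧ s) ∧ (β ∧ p)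
∧-proportional = from-yes
  (∀-Bool? λ α → ∀-Bool? λ β → ∀-Bool? λ p → ∀-Bool? λ q → ∀-Bool? λ r → ∀-Bool? λ s →
   (p ∧ s ≟ᵇ q ∧ r) →-dec ((α ∧ r) ∧ (β ∧ q) ≟ᵇ (α ∧ s) ∧ (β ∧ p)))

-- A criterion for good partitions in terms of one crossing edge

module _ {n : ℕ} {L : Set} (_≟_ : DecidableEquality L) where

  -- Relative to an edge a b across two classes, a vertex z has the type
  -- (adj a z , adj b z).
  good-by-types : ∀ (G : Graph n) (p : Fin n → L) a b → p a ≢ p b →
    (∀ x y → p x ≢ p y → p x ≢ p b → p y ≢ p a → adj G x y ≡ adj G x b ∧ adj G a y) →
    (∀ x x′ → p x ≢ p a → p x ≢ p b → p x′ ≢ p a → p x′ ≢ p b →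
      adj G a x ∧ adj G x′ b ≡ adj G a x′ ∧ adj G x b) →
    Good G p
  good-by-types G p a b ab forward proportional x x′ y y′ xy xy′ x′y x′y′ = cases
    where
    A = adj G

    backward : ∀ u v → p u ≢ p v → p u ≢ p a → p v ≢ p b → A u v ≡ A a u ∧ A v b
    backward u v uv ua vb = trans (symmetric G u v) (trans (forward v u (uv ∘ sym) vb ua)
                                                           (∧-comm (A v b) (A a u)))

    rewrite₄ : ∀ {p q r s p′ q′ r′ s′ : Bool} → p ≡ p′ → s ≡ s′ → q ≡ q′ → r ≡ r′ →
               p′ ∧ s′ ≡ q′ ∧ r′ → p ∧ s ≡ q ∧ r
    rewrite₄ refl refl refl refl e = e

    -- When one row lies in the class of `b` and the other in that of `a`, both columns lie in
    -- neither class. One row is expanded by `backward`, the other by `forward`, and the minor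
    -- reduces to the proportionality of the types of the columns.
    rows : ∀ u u′ → p u ≢ p y → p u ≢ p y′ → p u′ ≢ p y → p u′ ≢ p y′ → p u ≡ p b → p u′ ≡ p a →
           A u y ∧ A u′ y′ ≡ A u y′ ∧ A u′ y
    rows u u′ uy uy′ u′y u′y′ ub u′a = rewrite₄
      (backward u y uy ua yb) (forward u′ y′ u′y′ u′b y′a) (backward u y′ uy′ ua y′b) (forward u′ y u′y u′b ya)
      (∧-proportional (A a u) (A u′ b) (A a y) (A a y′) (A y b) (A y′ b) (proportional y y′ ya yb y′a y′b))
      where
      ua = λ e → ab (trans (sym e) ub)
      u′b = λ e → ab (trans (sym u′a) e)
      ya = λ e → u′y (trans u′a (sym e))
      y′a = λ e → u′y′ (trans u′a (sym e))
      yb = λ e → uy (trans ub (sym e))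
      y′b = λ e → uy′ (trans ub (sym e))

    columns : ∀ v v′ → p x ≢ p v → p x ≢ p v′ → p x′ ≢ p v → p x′ ≢ p v′ → p v ≡ p a → p v′ ≡ p b →
              A x v ∧ A x′ v′ ≡ A x v′ ∧ A x′ v
    columns v v′ xv xv′ x′v x′v′ va v′b = rewrite₄
      (backward x v xv xa vb) (forward x′ v′ x′v′ x′b v′a) (forward x v′ xv′ xb v′a) (backward x′ v x′v x′a vb)
      (begin
        (A a x ∧ A v b) ∧ (A x′ b ∧ A a v′)  ≡⟨ transpose (A a x) (A v b) (A x′ b) (A a v′) ⟩
        (A a v′ ∧ A v b) ∧ (A a x ∧ A x′ b)  ≡⟨ cong ((A a v′ ∧ A v b) ∧_)
                                                (proportional x x′ xa xb x′a x′b) ⟩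
        (A a v′ ∧ A v b) ∧ (A a x′ ∧ A x b)  ≡⟨ transpose′ (A a v′) (A v b) (A a x′) (A x b) ⟩
        (A x b ∧ A a v′) ∧ (A a x′ ∧ A v b)  ∎)
      where
      open ≡-Reasoning
      transpose : ∀ p q r s → (p ∧ q) ∧ (r ∧ s) ≡ (s ∧ q) ∧ (p ∧ r)
      transpose = from-yes (∀-Bool? λ p → ∀-Bool? λ q → ∀-Bool? λ r → ∀-Bool? λ s →
                            (p ∧ q) ∧ (r ∧ s) ≟ᵇ (s ∧ q) ∧ (p ∧ r))
      transpose′ : ∀ p q r s → (p ∧ q) ∧ (r ∧ s) ≡ (s ∧ p) ∧ (r ∧ q)
      transpose′ = from-yes (∀-Bool? λ p → ∀-Bool? λ q → ∀-Bool? λ r → ∀-Bool? λ s →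
                             (p ∧ q) ∧ (r ∧ s) ≟ᵇ (s ∧ p) ∧ (r ∧ q))
      xa = λ e → xv (trans e (sym va))
      x′a = λ e → x′v (trans e (sym va))
      xb = λ e → xv′ (trans e (sym v′b))
      x′b = λ e → x′v′ (trans e (sym v′b))
      vb = λ e → ab (trans (sym va) e)
      v′a = λ e → ab (trans (sym e) v′b)

    swap : ∀ {p q r s : Bool} → r ∧ q ≡ s ∧ p → p ∧ s ≡ q ∧ r
    swap {p} {q} {r} {s} e = trans (∧-comm p s) (trans (sym e) (∧-comm r q))

    cases : A x y ∧ A x′ y′ ≡ A x y′ ∧ A x′ y
    -- Either `forward` factors all four entries, or `backward` does, or the rows or the columns are
    -- split between the classes of `a` and `b`; the remaining combinations contradict the
    -- separation of rows from columns.
    cases with p x ≟ p b | p x′ ≟ p b | p y ≟ p a | p y′ ≟ p a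
             | p x ≟ p a | p x′ ≟ p a | p y ≟ p b | p y′ ≟ p b
    ... | no xb | no x′b | no ya | no y′a | _ | _ | _ | _ = rewrite₄
      (forward x y xy xb ya) (forward x′ y′ x′y′ x′b y′a) (forward x y′ xy′ xb y′a) (forward x′ y x′y x′b ya)
      (∧-exchange (A x b) (A a y) (A x′ b) (A a y′))
    ... | _ | _ | _ | _ | no xa | no x′a | no yb | no y′b = rewrite₄
      (backward x y xy xa yb) (backward x′ y′ x′y′ x′a y′b) (backward x y′ xy′ xa y′b) (backward x′ y x′y x′a yb)
      (∧-exchange (A a x) (A y b) (A a x′) (A y′ b))
    ... | yes xb | _ | _ | _ | _ | yes x′a | _ | _ = rows x x′ xy xy′ x′y x′y′ xb x′a
    ... | _ | yes x′b | _ | _ | yes xa | _ | _ | _ =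
      trans (∧-comm (A x y) (A x′ y′)) (trans (sym (rows x′ x x′y x′y′ xy xy′ x′b xa)) (∧-comm (A x′ y) (A x y′)))
    ... | _ | _ | yes ya | _ | _ | _ | _ | yes y′b = columns y y′ xy xy′ x′y x′y′ ya y′b
    ... | _ | _ | _ | yes y′a | _ | _ | yes yb | _ = sym (columns y′ y xy′ xy x′y′ x′y y′a yb)
    ... | yes xb | _ | _ | _ | yes xa | _ | _ | _ = contradiction (trans (sym xa) xb) ab
    ... | yes xb | _ | _ | _ | _ | _ | yes yb | _ = contradiction (trans xb (sym yb)) xy
    ... | yes xb | _ | _ | _ | _ | _ | _ | yes y′b = contradiction (trans xb (sym y′b)) xy′
    ... | _ | yes x′b | _ | _ | _ | yes x′a | _ | _ = contradiction (trans (sym x′a) x′b) ab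
    ... | _ | yes x′b | _ | _ | _ | _ | yes yb | _ = contradiction (trans x′b (sym yb)) x′y
    ... | _ | yes x′b | _ | _ | _ | _ | _ | yes y′b = contradiction (trans x′b (sym y′b)) x′y′
    ... | _ | _ | yes ya | _ | yes xa | _ | _ | _ = contradiction (trans xa (sym ya)) xy
    ... | _ | _ | yes ya | _ | _ | yes x′a | _ | _ = contradiction (trans x′a (sym ya)) x′y
    ... | _ | _ | yes ya | _ | _ | _ | yes yb | _ = contradiction (trans (sym ya) yb) ab
    ... | _ | _ | _ | yes y′a | yes xa | _ | _ | _ = contradiction (trans xa (sym y′a)) xy′
    ... | _ | _ | _ | yes y′a | _ | yes x′a | _ | _ = contradiction (trans x′a (sym y′a)) x′y′
    ... | _ | _ | _ | yes y′a | _ | _ | _ | yes y′b = contradiction (trans (sym y′a) y′b) ab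

-- Good partitions in which only two classes are joined

module TwoSided {n : ℕ} {L : Set} (_≟_ : DecidableEquality L) (G : Graph n) (p : Fin n → L) {s : ℕ}
  (good : Good G p) (bounded : ClassesBounded _≟_ p s) (a b : Fin n) (ab : p a ≢ p b)
  (Aab : adj G a b ≡ true)
  (untyped : ∀ z → p z ≢ p a → p z ≢ p b → adj G a z ≡ false × adj G b z ≡ false) where

  private
    A = adj G

    A-sym : ∀ {u v c} → A u v ≡ c → A v u ≡ c
    A-sym {u} {v} = trans (symmetric G v u)

  -- The component of `a`. It contains all edges between different classes, so the graph needs no
  -- change outside it.
  W : Fin n → Bool
  W = reachable A a

  Wa : W a ≡ true
  Wa = reachable-refl A a

  Wb : W b ≡ true
  Wb = reachable-step A a a b Wa Aab

  W-step : ∀ {z w} → W z ≡ true → A z w ≡ true → W w ≡ true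
  W-step {z} {w} = reachable-step A a z w

  W-types : ∀ {z} → W z ≡ false → A a z ≡ false × A b z ≡ false
  W-types ¬Wz = ¬-not (λ e → false≢true ¬Wz (W-step Wa e)) ,
                ¬-not (λ e → false≢true ¬Wz (W-step Wb e))

  -- A minor with the edge `a b` as the entry opposite to `x y`: the entry of `x` at `a` or at `b`
  -- vanishes because `x` is untyped, hence so does the entry `x y`.
  isolated : ∀ x y → p x ≢ p a → p x ≢ p b → p x ≢ p y → A x y ≡ false
  isolated x y xa xb xy with p y ≟ p b
  ... | no yb = begin
    A x y                ≡⟨ ∧-identityʳ _ ⟨
    A x y ∧ true         ≡⟨ cong (A x y ∧_) (A-sym Aab) ⟨
    A x y ∧ A b a        ≡⟨ good x b y a xy xa (yb ∘ sym) (ab ∘ sym) ⟩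
    A x a ∧ A b y        ≡⟨ cong (_∧ A b y) (A-sym (proj₁ (untyped x xa xb))) ⟩
    false                ∎
    where open ≡-Reasoning
  ... | yes yb = begin
    A x y                ≡⟨ ∧-identityʳ _ ⟨
    A x y ∧ true         ≡⟨ cong (A x y ∧_) Aab ⟨
    A x y ∧ A a b        ≡⟨ good x a y b xy xb (λ e → ab (trans e yb)) ab ⟩
    A x b ∧ A a y        ≡⟨ cong (_∧ A a y) (A-sym (proj₂ (untyped x xa xb))) ⟩
    false                ∎
    where open ≡-Reasoning

  across : ∀ z w → p z ≡ p a → p w ≡ p b → A z w ≡ A z b ∧ A a w
  across z w za wb = begin
    A z w                ≡⟨ ∧-identityʳ _ ⟨
    A z w ∧ true         ≡⟨ cong (A z w ∧_) Aab ⟨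
    A z w ∧ A a b        ≡⟨ good z a w b (λ e → ab (trans (sym za) (trans e wb)))
                              (λ e → ab (trans (sym za) e)) (λ e → ab (trans e wb)) ab ⟩
    A z b ∧ A a w        ∎
    where open ≡-Reasoning

  -- By `isolated` the edge joins the classes of `a` and `b`; by `across` its end in the class of
  -- `a` is adjacent to `b`, and its other end to `a`.
  crossing-in-W : ∀ z w → p z ≢ p w → A z w ≡ true → W z ≡ true
  crossing-in-W z w zw e with p z ≟ p a | p z ≟ p b | p w ≟ p a | p w ≟ p b
  ... | yes za | _ | _ | yes wb =
    W-step Wb (A-sym (proj₁ (∧-true (trans (sym (across z w za wb)) e))))
  ... | _ | yes zb | yes wa | _ =
    W-step Wa (proj₂ (∧-true {A w b} (trans (sym (across w z wa zb)) (A-sym e))))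
  ... | no za | no zb | _ | _ = contradiction e (false≢true (isolated z w za zb zw))
  ... | _ | _ | no wa | no wb =
    contradiction (A-sym e) (false≢true (isolated w z wa wb (zw ∘ sym)))
  ... | yes za | _ | yes wa | _ = contradiction (trans za (sym wa)) zw
  ... | _ | yes zb | _ | yes wb = contradiction (trans zb (sym wb)) zw

  W-classes : ∀ z → W z ≡ true → p z ≡ p a ⊎ p z ≡ p b
  W-classes z = reachable-sound A (λ z → p z ≡ p a ⊎ p z ≡ p b) stays a z (inj₁ refl)
    where
    stays : ∀ z w → p z ≡ p a ⊎ p z ≡ p b → A z w ≡ true → p w ≡ p a ⊎ p w ≡ p b
    stays z w z∈ e with p w ≟ p a | p w ≟ p b
    ... | yes wa | _      = inj₁ wa
    ... | no _   | yes wb = inj₂ wb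
    ... | no wa  | no wb  = contradiction (A-sym e) (false≢true (isolated w z wa wb (apart z∈)))
      where
      apart : p z ≡ p a ⊎ p z ≡ p b → p w ≢ p z
      apart (inj₁ za) wz = wa (trans wz za)
      apart (inj₂ zb) wz = wb (trans wz zb)

  Closed : (Fin n → Bool) → Set
  Closed U = ∀ z w → U z ≡ true → arc A a b z w ≡ true → U w ≡ true

  no-arc : ∀ {U} → Closed U → ∀ z w → U z ≡ true → U w ≡ false → A z w ≡ A z b ∧ A a w
  no-arc closed z w Uz ¬Uw =
    xor-≡false _ _ (¬-not (λ e → false≢true ¬Uw (closed z w Uz e)))

  -- Containment in the class of `a` both bounds the size of the set by `s` and keeps `b` out of it.
  record Side (U : Fin n → Bool) : Set where
    field
      closed : Closed U
      a∈     : U a ≡ true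
      inA    : ∀ z → U z ≡ true → p z ≡ p a

    b∉ : U b ≡ false
    b∉ = ¬-not (λ Ub → ab (sym (inA b Ub)))

  open Side

  -- The class of `a` is closed: towards the class of `b` the entries factor by `across`, and
  -- towards other classes both terms of `arc` vanish. Hence a side generated inside the class stays
  -- inside it.
  class-closed : ∀ z w → p z ≡ p a → arc A a b z w ≡ true → p w ≡ p a
  class-closed z w za e with p w ≟ p a
  ... | yes wa = wa
  ... | no wa  = contradiction e (false≢true no-arc′)
    where
    no-arc′ : arc A a b z w ≡ false
    no-arc′ with p w ≟ p b
    ... | yes wb = trans (cong (_xor (A z b ∧ A a w)) (across z w za wb)) (xor-same (A z b ∧ A a w))
    ... | no wb  = cong₂ _xor_ (A-sym (isolated w z wa wb (λ e → wa (trans e za))))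
                     (trans (cong (A z b ∧_) (proj₁ (untyped w wa wb))) (∧-zeroʳ (A z b)))

  side-side : ∀ x → p x ≡ p a → Side (side A a b x)
  side-side x xa .a∈ = ∨-introʳ (reachable (arc A a b) x a) (dec-true (a Finₚ.≟ a) refl)
  side-side x xa .closed z w z∈ e with ∨-true z∈
  ... | inj₁ xz  = ∨-introˡ _ (reachable-step (arc A a b) x z w xz e)
  ... | inj₂ a≡z with does-true (a Finₚ.≟ z) a≡z
  ...   | refl = contradiction e (false≢true (trans (cong (λ t → A a w xor (t ∧ A a w)) Aab) (xor-same (A a w))))
  side-side x xa .inA z z∈ with ∨-true z∈
  ... | inj₁ xz  = reachable-sound (arc A a b) (λ z → p z ≡ p a) class-closed x z xa xz
  ... | inj₂ a≡z = cong p (sym (does-true (a Finₚ.≟ z) a≡z))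

  rest : (Fin n → Bool) → Fin n → Bool
  rest U z = W z ∧ not (U z)

  -- A side is small anyway, being part of a class; only the remainder of the component of `a` has
  -- to be bounded.
  Balanced : (Fin n → Bool) → Set
  Balanced U = count (rest U) ≤ s

  count-class : ∀ U v → (∀ z → U z ≡ true → p z ≡ p v) → count U ≤ s
  count-class U v U⊆ =
    ≤-trans (count-mono U _ (λ z Uz → dec-true (p z ≟ p v) (U⊆ z Uz))) (bounded v)

  -- If C ∖ U had no neighbour of a or b, no edge would leave it, so it would miss W.
  typed-difference : ∀ U C → Side U → Side C → ∀ (V : Fin n → Bool) →
    (∀ z → V z ≡ true → U z ≡ true ⊎ C z ≡ true) → ¬ Balanced U → Balanced V →
    ∃[ z ] (C z ≡ true × U z ≡ false × (A a z ≡ true ⊎ A b z ≡ true))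
  typed-difference U C sU sC V V⊆ ¬balU balV
    with any? (λ z → (C z ≟ᵇ true) ×-dec ((U z ≟ᵇ false) ×-dec ((A a z ≟ᵇ true) ⊎-dec (A b z ≟ᵇ true))))
  ... | yes found = found
  ... | no ¬found = contradiction (≤-trans (count-mono (rest U) (rest V) rest⊆) balV) ¬balU
    where
    zero-type : ∀ z → C z ≡ true → U z ≡ false → A a z ≡ false × A b z ≡ false
    zero-type z Cz ¬Uz = ¬-not (λ e → ¬found (z , Cz , ¬Uz , inj₁ e)) ,
                         ¬-not (λ e → ¬found (z , Cz , ¬Uz , inj₂ e))

    Outside : Fin n → Set
    Outside z = ¬ (C z ≡ true × U z ≡ false)

    -- An edge between `z` and a vertex `w` of `C` minus `U` is an arc since `w` has type zero. If
    -- `z` is not in `U`, the arc goes from `w` to `z` and puts `z` in `C`; if `z` is in `U`, it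
    -- goes from `z` to `w` and puts `w` in `U`. Both are contradictions.
    outside-step : ∀ z w → Outside z → A z w ≡ true → Outside w
    outside-step z w out e (Cw , ¬Uw) with zero-type w Cw ¬Uw | true? (U z)
    ... | aw , bw | inj₂ ¬Uz = out (closed sC w z Cw (arc-true (A-sym bw)) , ¬Uz)
      where
      arc-true : A w b ≡ false → arc A a b w z ≡ true
      arc-true wb rewrite wb | A-sym e = refl
    ... | aw , bw | inj₁ Uz = false≢true ¬Uw (closed sU z w Uz arc-true)
      where
      arc-true : arc A a b z w ≡ true
      arc-true rewrite e | aw | ∧-zeroʳ (A z b) = refl

    W-outside : ∀ z → W z ≡ true → Outside z
    W-outside z = reachable-sound A Outside outside-step a z λ (_ , ¬Ua) → false≢true ¬Ua (a∈ sU)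

    rest⊆ : ∀ z → rest U z ≡ true → rest V z ≡ true
    rest⊆ z e with ∧-true {W z} e | true? (V z)
    ... | Wz , ¬Uz | inj₂ ¬Vz = cong₂ _∧_ Wz (cong not ¬Vz)
    ... | Wz , ¬Uz | inj₁ Vz with V⊆ z Vz
    ...   | inj₁ Uz = contradiction (trans (sym ¬Uz) (cong not Uz)) λ ()
    ...   | inj₂ Cz = ⊥-elim (W-outside z Wz (Cz , ¬-not λ Uz → contradiction (trans (sym ¬Uz) (cong not Uz)) λ ()))

  -- The vector erases the edges leaving `U` and vanishes off `W`, where no vertex is adjacent to
  -- `a` or `b`. So `U`, the rest of `W`, and each old class outside `W` are closed in the toggled
  -- graph.
  side-small : ∀ U → Side U → Balanced U → Small (toggle G (cutVector A a b U)) s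
  side-small U sU balanced v = cases
    where
    f = cutVector A a b U
    K = toggle G f

    f-in : ∀ {z} → U z ≡ true → f z ≡ A z b
    f-in e rewrite e = refl

    f-out : ∀ {z} → U z ≡ false → f z ≡ A z a
    f-out e rewrite e = refl

    K-edge : ∀ z w → adj K z w ≡ true → A z w xor (f z ∧ f w) ≡ true
    K-edge z w e = proj₂ (∧-true {not (does (z Finₚ.≟ w))} e)

    K-sym : ∀ z w → adj K z w ≡ true → adj K w z ≡ true
    K-sym z w = trans (symmetric K w z)

    U-closed : ∀ z w → U z ≡ true → adj K z w ≡ true → U w ≡ true
    U-closed z w Uz e with true? (U w)
    ... | inj₁ Uw  = Uw
    ... | inj₂ ¬Uw = contradiction (K-edge z w e) (false≢true (begin
      A z w xor (f z ∧ f w)                  ≡⟨ cong₂ _xor_ (no-arc (closed sU) z w Uz ¬Uw)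
                                                 (cong₂ _∧_ (f-in Uz) (trans (f-out ¬Uw) (symmetric G w a))) ⟩
      (A z b ∧ A a w) xor (A z b ∧ A a w)    ≡⟨ xor-same (A z b ∧ A a w) ⟩
      false                                  ∎))
      where open ≡-Reasoning

    ¬U-closed : ∀ z w → U z ≡ false → adj K z w ≡ true → U w ≡ false
    ¬U-closed z w ¬Uz e = ¬-not λ Uw → false≢true ¬Uz (U-closed w z Uw (K-sym z w e))

    f-outside : ∀ {z} → W z ≡ false → f z ≡ false
    f-outside {z} ¬Wz with true? (U z)
    ... | inj₁ Uz  = trans (f-in Uz) (A-sym (proj₂ (W-types ¬Wz)))
    ... | inj₂ ¬Uz = trans (f-out ¬Uz) (A-sym (proj₁ (W-types ¬Wz)))

    A-edge : ∀ z w → W z ≡ false → adj K z w ≡ true → A z w ≡ true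
    A-edge z w ¬Wz e with K-edge z w e
    ... | e′ rewrite f-outside ¬Wz = trans (sym (Boolₚ.xor-identityʳ (A z w))) e′

    ¬W-closed : ∀ z w → W z ≡ false → adj K z w ≡ true → W w ≡ false
    ¬W-closed z w ¬Wz e = ¬-not λ Ww → false≢true ¬Wz (W-step Ww (A-sym (A-edge z w ¬Wz e)))

    cases : ∃[ C ] (C v ≡ true × count C ≤ s × (∀ z w → C z ≡ true → adj K z w ≡ true → C w ≡ true))
    cases with true? (U v) | true? (W v)
    ... | inj₁ Uv  | _       = U , Uv , count-class U a (inA sU) , U-closed
    ... | inj₂ ¬Uv | inj₁ Wv = rest U , cong₂ _∧_ Wv (cong not ¬Uv) , balanced , rest-closed
      where
      rest-closed : ∀ z w → rest U z ≡ true → adj K z w ≡ true → rest U w ≡ true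
      rest-closed z w e zw with ∧-true {W z} e
      ... | Wz , ¬Uz = cong₂ _∧_
        (¬¬-true λ ¬Ww → false≢true (¬W-closed w z ¬Ww (K-sym z w zw)) Wz)
        (cong not (¬U-closed z w (not-true ¬Uz) zw))
        where
        ¬¬-true : ∀ {x} → (x ≡ false → ⊥) → x ≡ true
        ¬¬-true {true}  _ = refl
        ¬¬-true {false} h = ⊥-elim (h refl)
    ... | inj₂ ¬Uv | inj₂ ¬Wv = C , cong₂ _∧_ (cong not ¬Wv) (dec-true (p v ≟ p v) refl) ,
                                count-class C v (λ z e → class-eq z (proj₂ (∧-true {not (W z)} e))) , C-closed
      where
      C : Fin n → Bool
      C z = not (W z) ∧ does (p z ≟ p v)
      class-eq : ∀ z → does (p z ≟ p v) ≡ true → p z ≡ p v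
      class-eq z = does-true (p z ≟ p v)
      C-closed : ∀ z w → C z ≡ true → adj K z w ≡ true → C w ≡ true
      C-closed z w e zw with ∧-true {not (W z)} e
      ... | ¬Wz , zv = cong₂ _∧_ (cong not (¬W-closed z w (not-true ¬Wz) zw))
                                 (dec-true (p w ≟ p v) (trans (sym zw-class) (class-eq z zv)))
        where
        zw-class : p z ≡ p w
        zw-class = decidable-stable (p z ≟ p w) λ z≁w →
          false≢true (not-true ¬Wz) (crossing-in-W z w z≁w (A-edge z w (not-true ¬Wz) zw))

  -- Two crossing sides whose union is balanced although neither of them is split the
  -- class of a into the parts U ∩ C, U ∖ C and C ∖ U, all of them small.
  crossing-sides : ∀ U C → Side U → Side C → ¬ Balanced U → ¬ Balanced C →
                   Balanced (λ z → U z ∨ C z) → GoodCandidate G s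
  crossing-sides U C sU sC ¬balU ¬balC balUC
    with typed-difference C U sC sU (λ z → U z ∨ C z) (λ z e → swap⊎ (∨-true e)) ¬balC balUC
       | typed-difference U C sU sC (λ z → U z ∨ C z) (λ z e → ∨-true e) ¬balU balUC
    where
    swap⊎ : ∀ {X Y : Set} → X ⊎ Y → Y ⊎ X
    swap⊎ (inj₁ x) = inj₂ x
    swap⊎ (inj₂ y) = inj₁ y
  ... | z₁ , Uz₁ , ¬Cz₁ , typed₁ | z₂ , Cz₂ , ¬Uz₂ , typed₂ =
    three-classes _≟′_ G q (good-by-types _≟′_ G q a b qab forward proportional) bounded′
      a b z₁ qab qaz₁ qbz₁ Aab typed₁
    where
    -- Inside `W` the class is given by membership in `U` and `C`. The vertices `a`, `b` and `z₁`
    -- lie in the intersection, outside both sets, and in `U` only. The parts inside `U` or `C` are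
    -- small as parts of the class of `a`, and the part outside both by the balance of the union.
    q : Fin n → (Bool × Bool) ⊎ L
    q z = if W z then inj₁ (U z , C z) else inj₂ (p z)

    _≟′_ : DecidableEquality ((Bool × Bool) ⊎ L)
    _≟′_ = ⊎ₚ.≡-dec (×ₚ.≡-dec _≟ᵇ_ _≟ᵇ_) _≟_

    q-in : ∀ {z} → W z ≡ true → q z ≡ inj₁ (U z , C z)
    q-in e rewrite e = refl

    q-out : ∀ {z} → W z ≡ false → q z ≡ inj₂ (p z)
    q-out e rewrite e = refl

    typed-in : ∀ {z} → A a z ≡ true ⊎ A b z ≡ true → W z ≡ true
    typed-in (inj₁ e) = W-step Wa e
    typed-in (inj₂ e) = W-step Wb e

    q-value : ∀ {z u c} → W z ≡ true → U z ≡ u → C z ≡ c → q z ≡ inj₁ (u , c)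
    q-value Wz Uz Cz = trans (q-in Wz) (cong inj₁ (cong₂ _,_ Uz Cz))

    qa : q a ≡ inj₁ (true , true)
    qa = q-value Wa (a∈ sU) (a∈ sC)

    qb : q b ≡ inj₁ (false , false)
    qb = q-value Wb (b∉ sU) (b∉ sC)

    qz₁ : q z₁ ≡ inj₁ (true , false)
    qz₁ = q-value (typed-in typed₁) Uz₁ ¬Cz₁

    qab : q a ≢ q b
    qab e with trans (sym qa) (trans e qb)
    ... | ()

    qaz₁ : q a ≢ q z₁
    qaz₁ e with trans (sym qa) (trans e qz₁)
    ... | ()

    qbz₁ : q b ≢ q z₁
    qbz₁ e with trans (sym qb) (trans e qz₁)
    ... | ()

    outside-edge : ∀ x y → W x ≡ false → q x ≢ q y → A x y ≡ false
    outside-edge x y ¬Wx xy = ¬-not λ e → false≢true ¬Wx (edge-in e)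
      where
      edge-in : A x y ≡ true → W x ≡ true
      edge-in e with true? (W y)
      ... | inj₁ Wy  = W-step Wy (A-sym e)
      ... | inj₂ ¬Wy = crossing-in-W x y (λ pxy → xy (trans (q-out ¬Wx) (trans (cong inj₂ pxy) (sym (q-out ¬Wy))))) e

    forward : ∀ x y → q x ≢ q y → q x ≢ q b → q y ≢ q a → A x y ≡ A x b ∧ A a y
    forward x y xy xb ya with true? (W x) | true? (W y)
    ... | inj₂ ¬Wx | _ = trans (outside-edge x y ¬Wx xy) (cong (_∧ A a y) (sym (A-sym (proj₂ (W-types ¬Wx)))))
    ... | inj₁ _   | inj₂ ¬Wy = trans (A-sym (outside-edge y x ¬Wy (xy ∘ sym)))
      (sym (trans (cong (A x b ∧_) (proj₁ (W-types ¬Wy))) (∧-zeroʳ (A x b))))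
    ... | inj₁ Wx  | inj₁ Wy with true? (U x) | true? (C x) | true? (U y) | true? (C y)
    ...   | inj₁ Ux  | _        | inj₂ ¬Uy | _        = no-arc (closed sU) x y Ux ¬Uy
    ...   | _        | inj₁ Cx  | _        | inj₂ ¬Cy = no-arc (closed sC) x y Cx ¬Cy
    ...   | inj₂ ¬Ux | inj₂ ¬Cx | _        | _        = contradiction (trans (q-value Wx ¬Ux ¬Cx) (sym qb)) xb
    ...   | _        | _        | inj₁ Uy  | inj₁ Cy  = contradiction (trans (q-value Wy Uy Cy) (sym qa)) ya
    ...   | inj₁ Ux  | inj₂ ¬Cx | inj₁ Uy  | inj₂ ¬Cy =
      contradiction (trans (q-value Wx Ux ¬Cx) (sym (q-value Wy Uy ¬Cy))) xy
    ...   | inj₂ ¬Ux | inj₁ Cx  | inj₂ ¬Uy | inj₁ Cy  =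
      contradiction (trans (q-value Wx ¬Ux Cx) (sym (q-value Wy ¬Uy Cy))) xy

    OnlyU OnlyC : Fin n → Set
    OnlyU z = U z ≡ true × C z ≡ false
    OnlyC z = C z ≡ true × U z ≡ false

    -- The entry `x y` crosses both cuts: no arc of `x` leaves `U`, and no arc of `y` leaves `C`.
    -- Equating the two factorizations makes the types of `x` and `y` proportional.
    U-vs-C : ∀ x y → OnlyU x → OnlyC y → A a x ∧ A y b ≡ A a y ∧ A x b
    U-vs-C x y (Ux , ¬Cx) (Cy , ¬Uy) = begin
      A a x ∧ A y b    ≡⟨ ∧-comm (A a x) (A y b) ⟩
      A y b ∧ A a x    ≡⟨ no-arc (closed sC) y x Cy ¬Cx ⟨
      A y x            ≡⟨ symmetric G y x ⟩
      A x y            ≡⟨ no-arc (closed sU) x y Ux ¬Uy ⟩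
      A x b ∧ A a y    ≡⟨ ∧-comm (A x b) (A a y) ⟩
      A a y ∧ A x b    ∎
      where open ≡-Reasoning

    -- Two vectors proportional to the same nonzero vector are proportional to each other. For two
    -- vertices on the same side the nonzero vector is the type of `z₂` or `z₁`, the vertex on the
    -- opposite side; this is why the differences must contain typed vertices.
    via : ∀ α β α₀ β₀ α′ β′ → α₀ ≡ true ⊎ β₀ ≡ true → α ∧ β₀ ≡ α₀ ∧ β → α′ ∧ β₀ ≡ α₀ ∧ β′ →
          α ∧ β′ ≡ α′ ∧ β
    via = from-yes
      (∀-Bool? λ α → ∀-Bool? λ β → ∀-Bool? λ α₀ → ∀-Bool? λ β₀ → ∀-Bool? λ α′ → ∀-Bool? λ β′ →
       ((α₀ ≟ᵇ true) ⊎-dec (β₀ ≟ᵇ true)) →-dec ((α ∧ β₀ ≟ᵇ α₀ ∧ β) →-dec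
       ((α′ ∧ β₀ ≟ᵇ α₀ ∧ β′) →-dec (α ∧ β′ ≟ᵇ α′ ∧ β))))

    typedʳ : ∀ {z} → A a z ≡ true ⊎ A b z ≡ true → A a z ≡ true ⊎ A z b ≡ true
    typedʳ (inj₁ e) = inj₁ e
    typedʳ (inj₂ e) = inj₂ (A-sym e)

    middle : ∀ x → W x ≡ true → q x ≢ q a → q x ≢ q b → OnlyU x ⊎ OnlyC x
    middle x Wx xa xb with true? (U x) | true? (C x)
    ... | inj₁ Ux  | inj₁ Cx  = contradiction (trans (q-value Wx Ux Cx) (sym qa)) xa
    ... | inj₂ ¬Ux | inj₂ ¬Cx = contradiction (trans (q-value Wx ¬Ux ¬Cx) (sym qb)) xb
    ... | inj₁ Ux  | inj₂ ¬Cx = inj₁ (Ux , ¬Cx)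
    ... | inj₂ ¬Ux | inj₁ Cx  = inj₂ (Cx , ¬Ux)

    proportional : ∀ x x′ → q x ≢ q a → q x ≢ q b → q x′ ≢ q a → q x′ ≢ q b →
                   A a x ∧ A x′ b ≡ A a x′ ∧ A x b
    proportional x x′ xa xb x′a x′b with true? (W x) | true? (W x′)
    ... | inj₂ ¬Wx | _ rewrite proj₁ (W-types ¬Wx) | A-sym (proj₂ (W-types ¬Wx)) = sym (∧-zeroʳ (A a x′))
    ... | _ | inj₂ ¬Wx′ rewrite proj₁ (W-types ¬Wx′) | A-sym (proj₂ (W-types ¬Wx′)) = ∧-zeroʳ (A a x)
    ... | inj₁ Wx | inj₁ Wx′ with middle x Wx xa xb | middle x′ Wx′ x′a x′b
    ...   | inj₁ x∈ | inj₂ x′∈ = U-vs-C x x′ x∈ x′∈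
    ...   | inj₂ x∈ | inj₁ x′∈ = sym (U-vs-C x′ x x′∈ x∈)
    ...   | inj₁ x∈ | inj₁ x′∈ =
      via (A a x) (A x b) (A a z₂) (A z₂ b) (A a x′) (A x′ b) (typedʳ typed₂)
        (U-vs-C x z₂ x∈ (Cz₂ , ¬Uz₂)) (U-vs-C x′ z₂ x′∈ (Cz₂ , ¬Uz₂))
    ...   | inj₂ x∈ | inj₂ x′∈ =
      via (A a x) (A x b) (A a z₁) (A z₁ b) (A a x′) (A x′ b) (typedʳ typed₁)
        (sym (U-vs-C z₁ x (Uz₁ , ¬Cz₁) x∈)) (sym (U-vs-C z₁ x′ (Uz₁ , ¬Cz₁) x′∈))

    bounded′ : ClassesBounded _≟′_ q s
    bounded′ v with true? (W v)
    ... | inj₂ ¬Wv = count-class _ v λ z e → class z (does-true (q z ≟′ q v) e)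
      where
      class : ∀ z → q z ≡ q v → p z ≡ p v
      class z e with true? (W z)
      ... | inj₁ Wz  = contradiction (trans (sym (q-in Wz)) (trans e (q-out ¬Wv))) λ ()
      ... | inj₂ ¬Wz = inj₂-injective (trans (sym (q-out ¬Wz)) (trans e (q-out ¬Wv)))
    ... | inj₁ Wv with true? (U v ∨ C v)
    ...   | inj₁ UCv = count-class _ a λ z e → class z (does-true (q z ≟′ q v) e)
      where
      class : ∀ z → q z ≡ q v → p z ≡ p a
      class z e with true? (W z)
      ... | inj₂ ¬Wz = contradiction (trans (sym (q-out ¬Wz)) (trans e (q-in Wv))) λ ()
      ... | inj₁ Wz with inj₁-injective (trans (sym (q-in Wz)) (trans e (q-in Wv))) | ∨-true UCv
      ...   | eq | inj₁ Uv = inA sU z (trans (cong proj₁ eq) Uv)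
      ...   | eq | inj₂ Cv = inA sC z (trans (cong proj₂ eq) Cv)
    ...   | inj₂ ¬UCv = ≤-trans (count-mono _ _ λ z e → class z (does-true (q z ≟′ q v) e)) balUC
      where
      class : ∀ z → q z ≡ q v → rest (λ z → U z ∨ C z) z ≡ true
      class z e with true? (W z)
      ... | inj₂ ¬Wz = contradiction (trans (sym (q-out ¬Wz)) (trans e (q-in Wv))) λ ()
      ... | inj₁ Wz with inj₁-injective (trans (sym (q-in Wz)) (trans e (q-in Wv)))
      ...   | eq = cong₂ _∧_ Wz (cong not (trans (cong₂ _∨_ (cong proj₁ eq) (cong proj₂ eq)) ¬UCv))

  ∪-side : ∀ U C → Side U → Side C → Side (λ z → U z ∨ C z)
  ∪-side U C sU sC .a∈ = ∨-introˡ _ (a∈ sU)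
  ∪-side U C sU sC .inA z e with ∨-true e
  ... | inj₁ Uz = inA sU z Uz
  ... | inj₂ Cz = inA sC z Cz
  ∪-side U C sU sC .closed z w e zw with ∨-true e
  ... | inj₁ Uz = ∨-introˡ _ (closed sU z w Uz zw)
  ... | inj₂ Cz = ∨-introʳ (U w) (closed sC z w Cz zw)

  -- The principal sides are united one by one until the union becomes balanced.
  accumulate : ∀ (xs : List (Fin n)) U → Side U → ¬ Balanced U →
               (∀ x → p x ≡ p a → U x ≡ false → x ∈ₗ xs) → GoodCandidate G s
  -- With the list exhausted, `U` covers the class of `a`, so the rest of `W` lies in the class of
  -- `b` and `U` would be balanced.
  accumulate [] U sU ¬bal covers = contradiction (count-class (rest U) b in-B) ¬bal
    where
    in-B : ∀ z → rest U z ≡ true → p z ≡ p b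
    in-B z e with ∧-true {W z} e
    ... | Wz , ¬Uz with W-classes z Wz | true? (U z)
    ...   | inj₂ zb | _        = zb
    ...   | inj₁ za | inj₁ Uz  = contradiction (trans (sym ¬Uz) (cong not Uz)) λ ()
    ...   | inj₁ za | inj₂ ¬Uz = contradiction (covers z za ¬Uz) λ ()
  accumulate (x ∷ xs) U sU ¬bal covers with p x ≟ p a
  ... | no x≁a = accumulate xs U sU ¬bal λ y ya ¬Uy → tail (covers y ya ¬Uy) ya
    where
    tail : ∀ {y} → y ∈ₗ (x ∷ xs) → p y ≡ p a → y ∈ₗ xs
    tail (here refl) ya = contradiction ya x≁a
    tail (there y∈)  _  = y∈
  ... | yes xa with count (rest (side A a b x)) ≤? s
  ...   | yes balC = _ , separation a b x , side-small _ (side-side x xa) balC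
  ...   | no ¬balC with count (rest (λ z → U z ∨ side A a b x z)) ≤? s
  ...     | yes balUC = crossing-sides U _ sU (side-side x xa) ¬bal ¬balC balUC
  ...     | no ¬balUC = accumulate xs _ (∪-side U _ sU (side-side x xa)) ¬balUC
                          λ y ya e → tail (covers y ya (proj₁ (∨-false {U y} e))) (proj₂ (∨-false {U y} e))
    where
    ∨-false : ∀ {u v} → u ∨ v ≡ false → u ≡ false × v ≡ false
    ∨-false {false} {false} _ = refl , refl
    x∈side : side A a b x x ≡ true
    x∈side = ∨-introˡ _ (reachable-refl (arc A a b) x)
    tail : ∀ {y} → y ∈ₗ (x ∷ xs) → side A a b x y ≡ false → y ∈ₗ xs
    tail (here refl) e = contradiction x∈side (false≢true e)
    tail (there y∈)  _ = y∈

  two-classes : GoodCandidate G s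
  two-classes with count (rest (side A a b a)) ≤? s
  ... | yes bal = _ , separation a b a , side-small _ (side-side a refl) bal
  ... | no ¬bal = accumulate (allFin n) _ (side-side a refl) ¬bal λ x _ _ → ∈-allFin x

good-candidate : ∀ {n} {L : Set} (_≟_ : DecidableEquality L) (G : Graph n) (p : Fin n → L) {s} →
                 Good G p → ClassesBounded _≟_ p s → GoodCandidate G s
good-candidate _≟_ G p good bounded
  with any? (λ a → any? (λ b → (adj G a b ≟ᵇ true) ×-dec ¬? (p a ≟ p b)))
... | no ¬crossing = G , unchanged , small-by-classes _≟_ G p bounded λ z w e →
  decidable-stable (p z ≟ p w) λ zw → ¬crossing (z , w , e , zw)
... | yes (a , b , Aab , ab)
  with any? (λ c → ¬? (p c ≟ p a) ×-dec (¬? (p c ≟ p b) ×-dec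
                   ((adj G a c ≟ᵇ true) ⊎-dec (adj G b c ≟ᵇ true))))
...   | yes (c , ca , cb , e) = three-classes _≟_ G p good bounded a b c ab (ca ∘ sym) (cb ∘ sym) Aab e
...   | no ¬c = TwoSided.two-classes _≟_ G p good bounded a b ab Aab λ z za zb →
  ¬-not (λ e → ¬c (z , za , zb , inj₁ e)) , ¬-not (λ e → ¬c (z , za , zb , inj₂ e))

-- Gaussian integers

⊖_ : ℤ[i] → ℤ[i]
⊖ (a +i b) = (ℤ.- a) +i (ℤ.- b)

isCommutativeRing : IsCommutativeRing _≡_ _⊕_ _⊛_ ⊖_ 0# 1#
isCommutativeRing = record
  { isRing = record
    { +-isAbelianGroup = record
      { isGroup = record
        { isMonoid = record
          { isSemigroup = record
            { isMagma = record { isEquivalence = isEquivalence ; ∙-cong = cong₂ _⊕_ }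
            ; assoc = λ (a +i b) (c +i d) (e +i f) → cong₂ _+i_ (ℤₚ.+-assoc a c e) (ℤₚ.+-assoc b d f) }
          ; identity = (λ x → cong₂ _+i_ (ℤₚ.+-identityˡ _) (ℤₚ.+-identityˡ _)) ,
                       (λ x → cong₂ _+i_ (ℤₚ.+-identityʳ _) (ℤₚ.+-identityʳ _)) }
        ; inverse = (λ (a +i b) → cong₂ _+i_ (ℤₚ.+-inverseˡ a) (ℤₚ.+-inverseˡ b)) ,
                    (λ (a +i b) → cong₂ _+i_ (ℤₚ.+-inverseʳ a) (ℤₚ.+-inverseʳ b))
        ; ⁻¹-cong = cong ⊖_ }
      ; comm = λ (a +i b) (c +i d) → cong₂ _+i_ (ℤₚ.+-comm a c) (ℤₚ.+-comm b d) }
    ; *-cong = cong₂ _⊛_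
    ; *-assoc = λ (a +i b) (c +i d) (e +i f) → cong₂ _+i_ (assoc-re a b c d e f) (assoc-im a b c d e f)
    ; *-identity = (λ (a +i b) → cong₂ _+i_ (unit-re a b) (unit-im a b)) ,
                   (λ (a +i b) → cong₂ _+i_ (unit-re′ a b) (unit-im′ a b))
    ; distrib = (λ (a +i b) (c +i d) (e +i f) → cong₂ _+i_ (distrib-re a b c d e f) (distrib-im a b c d e f)) ,
                (λ (a +i b) (c +i d) (e +i f) → cong₂ _+i_ (distrib-re′ a b c d e f) (distrib-im′ a b c d e f))
    }
  ; *-comm = λ (a +i b) (c +i d) → cong₂ _+i_ (comm-re a b c d) (comm-im a b c d)
  }
  where
  assoc-re : ∀ a b c d e f → (a *ℤ c -ℤ b *ℤ d) *ℤ e -ℤ (a *ℤ d +ℤ b *ℤ c) *ℤ f ≡ a *ℤ (c *ℤ e -ℤ d *ℤ f) -ℤ b *ℤ (c *ℤ f +ℤ d *ℤ e)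
  assoc-re = ℤ-Solver.solve-∀
  assoc-im : ∀ a b c d e f → (a *ℤ c -ℤ b *ℤ d) *ℤ f +ℤ (a *ℤ d +ℤ b *ℤ c) *ℤ e ≡ a *ℤ (c *ℤ f +ℤ d *ℤ e) +ℤ b *ℤ (c *ℤ e -ℤ d *ℤ f)
  assoc-im = ℤ-Solver.solve-∀
  unit-re : ∀ a b → 1ℤ *ℤ a -ℤ 0ℤ *ℤ b ≡ a
  unit-re = ℤ-Solver.solve-∀
  unit-im : ∀ a b → 1ℤ *ℤ b +ℤ 0ℤ *ℤ a ≡ b
  unit-im = ℤ-Solver.solve-∀
  unit-re′ : ∀ a b → a *ℤ 1ℤ -ℤ b *ℤ 0ℤ ≡ a
  unit-re′ = ℤ-Solver.solve-∀
  unit-im′ : ∀ a b → a *ℤ 0ℤ +ℤ b *ℤ 1ℤ ≡ b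
  unit-im′ = ℤ-Solver.solve-∀
  distrib-re : ∀ a b c d e f → a *ℤ (c +ℤ e) -ℤ b *ℤ (d +ℤ f) ≡ (a *ℤ c -ℤ b *ℤ d) +ℤ (a *ℤ e -ℤ b *ℤ f)
  distrib-re = ℤ-Solver.solve-∀
  distrib-im : ∀ a b c d e f → a *ℤ (d +ℤ f) +ℤ b *ℤ (c +ℤ e) ≡ (a *ℤ d +ℤ b *ℤ c) +ℤ (a *ℤ f +ℤ b *ℤ e)
  distrib-im = ℤ-Solver.solve-∀
  distrib-re′ : ∀ a b c d e f → (c +ℤ e) *ℤ a -ℤ (d +ℤ f) *ℤ b ≡ (c *ℤ a -ℤ d *ℤ b) +ℤ (e *ℤ a -ℤ f *ℤ b)
  distrib-re′ = ℤ-Solver.solve-∀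
  distrib-im′ : ∀ a b c d e f → (c +ℤ e) *ℤ b +ℤ (d +ℤ f) *ℤ a ≡ (c *ℤ b +ℤ d *ℤ a) +ℤ (e *ℤ b +ℤ f *ℤ a)
  distrib-im′ = ℤ-Solver.solve-∀
  comm-re : ∀ a b c d → a *ℤ c -ℤ b *ℤ d ≡ c *ℤ a -ℤ d *ℤ b
  comm-re = ℤ-Solver.solve-∀
  comm-im : ∀ a b c d → a *ℤ d +ℤ b *ℤ c ≡ c *ℤ b +ℤ d *ℤ a
  comm-im = ℤ-Solver.solve-∀

ℤ[i]-commutativeRing : CommutativeRing 0ℓ 0ℓ
ℤ[i]-commutativeRing = record { isCommutativeRing = isCommutativeRing }

ℤ[i]-ring : AlmostCommutativeRing 0ℓ 0ℓ
ℤ[i]-ring = fromCommutativeRing ℤ[i]-commutativeRing λ where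
  (pos 0 +i pos 0) → just refl
  _            → nothing

open CommutativeRing ℤ[i]-commutativeRing using ()
  renaming (*-comm to ⊛-comm; *-assoc to ⊛-assoc; *-identityˡ to ⊛-identityˡ; *-identityʳ to ⊛-identityʳ;
            zeroˡ to ⊛-zeroˡ; zeroʳ to ⊛-zeroʳ; +-identityˡ to ⊕-identityˡ; +-identityʳ to ⊕-identityʳ)

infix 4 _≟ⁱ_
_≟ⁱ_ : DecidableEquality ℤ[i]
(a +i b) ≟ⁱ (c +i d) = map′ (λ (p , q) → cong₂ _+i_ p q) (λ { refl → refl , refl }) ((a ℤ.≟ c) ×-dec (b ℤ.≟ d))

square : ∀ a → a ℤ.* a ≡ pos (ℤ.∣ a ∣ * ℤ.∣ a ∣)
square (pos n)  = sym (ℤₚ.pos-* n n)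
square -[1+ n ] = refl

sum-of-squares : ∀ a b → a ℤ.* a ℤ.+ b ℤ.* b ≡ 0ℤ → a ≡ 0ℤ × b ≡ 0ℤ
sum-of-squares a b e = zero-square a (m+n≡0⇒m≡0 _ e′) , zero-square b (m+n≡0⇒n≡0 (ℤ.∣ a ∣ * ℤ.∣ a ∣) e′)
  where
  e′ : ℤ.∣ a ∣ * ℤ.∣ a ∣ + ℤ.∣ b ∣ * ℤ.∣ b ∣ ≡ 0
  e′ = ℤₚ.+-injective (trans (sym (cong₂ ℤ._+_ (square a) (square b))) e)
  zero-square : ∀ c → ℤ.∣ c ∣ * ℤ.∣ c ∣ ≡ 0 → c ≡ 0ℤ
  zero-square (pos zero) _ = refl

conj : ℤ[i] → ℤ[i]
conj (a +i b) = a +i (ℤ.- b)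

norm : ℤ[i] → ℤ
norm (a +i b) = a ℤ.* a ℤ.+ b ℤ.* b

conj-⊛ : ∀ x y → conj x ⊛ (x ⊛ y) ≡ ((norm x ℤ.* ℤ[i].re y) +i (norm x ℤ.* ℤ[i].im y))
conj-⊛ (a +i b) (c +i d) = cong₂ _+i_ (norm-re a b c d) (norm-im a b c d)
  where
  norm-re : ∀ a b c d → a ℤ.* (a ℤ.* c ℤ.- b ℤ.* d) ℤ.- (ℤ.- b) ℤ.* (a ℤ.* d ℤ.+ b ℤ.* c) ≡ (a ℤ.* a ℤ.+ b ℤ.* b) ℤ.* c
  norm-re = ℤ-Solver.solve-∀
  norm-im : ∀ a b c d → a ℤ.* (a ℤ.* d ℤ.+ b ℤ.* c) ℤ.+ (ℤ.- b) ℤ.* (a ℤ.* c ℤ.- b ℤ.* d) ≡ (a ℤ.* a ℤ.+ b ℤ.* b) ℤ.* d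
  norm-im = ℤ-Solver.solve-∀

-- Multiplying by the conjugate of `x` turns the claim into cancelling the norm, a sum of two
-- squares, in both integer coordinates of `y`.
⊛-cancel : ∀ {x y} → x ≢ 0# → x ⊛ y ≡ 0# → y ≡ 0#
⊛-cancel {x@(a +i b)} {y} x≢0 e =
  cong₂ _+i_ (scaled _ (cong ℤ[i].re e′)) (scaled _ (cong ℤ[i].im e′))
  where
  e′ : ((norm x ℤ.* ℤ[i].re y) +i (norm x ℤ.* ℤ[i].im y)) ≡ 0#
  e′ = trans (sym (conj-⊛ x y)) (trans (cong (conj x ⊛_) e) (⊛-zeroʳ (conj x)))
  scaled : ∀ z → norm x ℤ.* z ≡ 0ℤ → z ≡ 0ℤ
  scaled z Nz with ℤₚ.i*j≡0⇒i≡0∨j≡0 (norm x) Nz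
  ... | inj₂ z≡0 = z≡0
  ... | inj₁ N≡0 with sum-of-squares a b N≡0
  ...   | refl , refl = contradiction refl x≢0

⊛-nonzero : ∀ {x y} → x ≢ 0# → y ≢ 0# → x ⊛ y ≢ 0#
⊛-nonzero x≢0 y≢0 e = y≢0 (⊛-cancel x≢0 e)

-- Graph states through parities of quadratic forms

sgn : Bool → ℤ[i]
sgn b = if b then -1# else 1#

-- linear s X and quadratic M X are the parities of |s ∩ X| and of the number
-- of pairs u < v in X with M u v.
linear : ∀ {n} → (Fin n → Bool) → Subset n → Bool
linear s []      = false
linear s (x ∷ X) = (x ∧ s zero) xor linear (s ∘ suc) X

quadratic : ∀ {n} → Matrix n → Subset n → Bool
quadratic M []      = false
quadratic M (x ∷ X) = (x ∧ linear (M zero ∘ suc) X) xor quadratic (λ u v → M (suc u) (suc v)) X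

parity : ℕ → Bool
parity zero    = false
parity (suc k) = not (parity k)

parity-+ : ∀ k l → parity (k + l) ≡ parity k xor parity l
parity-+ zero    l = refl
parity-+ (suc k) l = trans (cong not (parity-+ k l)) (Boolₚ.not-distribˡ-xor (parity k) (parity l))

parity-bit : ∀ b → parity (if b then 1 else 0) ≡ b
parity-bit true  = refl
parity-bit false = refl

power-sgn : ∀ k → ((-1ℤ ℤ.^ k) +i 0ℤ) ≡ sgn (parity k)
power-sgn k = trans (cong (_+i 0ℤ) (go k)) (if-+i (parity k))
  where
  go : ∀ k → -1ℤ ℤ.^ k ≡ (if parity k then -1ℤ else 1ℤ)
  go zero = refl
  go (suc k) rewrite go k with parity k
  ... | true  = refl
  ... | false = refl
  if-+i : ∀ b → ((if b then -1ℤ else 1ℤ) +i 0ℤ) ≡ sgn b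
  if-+i true  = refl
  if-+i false = refl

parity-row : ∀ {n} x (X : Subset n) (s : Fin n → Bool) →
  parity (sum +-0-monoid λ v → if x ∧ lookup X v ∧ s v then 1 else 0) ≡ x ∧ linear s X
parity-row x []      s = sym (∧-zeroʳ x)
parity-row x (y ∷ X) s = begin
  parity ((if x ∧ y ∧ s zero then 1 else 0) + _)   ≡⟨ parity-+ (if x ∧ y ∧ s zero then 1 else 0) _ ⟩
  parity (if x ∧ y ∧ s zero then 1 else 0) xor _   ≡⟨ cong₂ _xor_ (parity-bit (x ∧ y ∧ s zero)) (parity-row x X (s ∘ suc)) ⟩
  (x ∧ y ∧ s zero) xor (x ∧ linear (s ∘ suc) X)    ≡⟨ Boolₚ.∧-distribˡ-xor x (y ∧ s zero) (linear (s ∘ suc) X) ⟨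
  x ∧ ((y ∧ s zero) xor linear (s ∘ suc) X)        ∎
  where open ≡-Reasoning

parity-edges : ∀ {n} (M : Matrix n) (X : Subset n) →
  parity (sum +-0-monoid λ u → sum +-0-monoid λ v →
    if (toℕ u <ᵇ toℕ v) ∧ lookup X u ∧ lookup X v ∧ M u v then 1 else 0) ≡ quadratic M X
parity-edges M []      = refl
parity-edges M (x ∷ X) =
  trans (parity-+ (sum +-0-monoid λ v → if x ∧ lookup X v ∧ M zero (suc v) then 1 else 0) _)
        (cong₂ _xor_ (parity-row x X (M zero ∘ suc)) (parity-edges (λ u v → M (suc u) (suc v)) X))

graphState-quadratic : ∀ {n} (G : Graph n) X → graphState G X ≡ sgn (quadratic (adj G) X)
graphState-quadratic G X = trans (power-sgn (inducedEdges G X)) (cong sgn (parity-edges (adj G) X))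

linear-update : ∀ {n} (s : Fin n → Bool) (X : Subset n) q →
  linear s (X [ q ]≔ true) ≡ linear s (X [ q ]≔ false) xor s q
linear-update s (x ∷ X) zero = Boolₚ.xor-comm (s zero) _
linear-update s (x ∷ X) (suc q) =
  trans (cong ((x ∧ s zero) xor_) (linear-update (s ∘ suc) X q))
        (sym (Boolₚ.xor-assoc (x ∧ s zero) _ _))

quadratic-update : ∀ {n} (M : Matrix n) → (∀ u v → M u v ≡ M v u) → (∀ v → M v v ≡ false) →
  ∀ (X : Subset n) q → quadratic M (X [ q ]≔ true) ≡ quadratic M (X [ q ]≔ false) xor linear (M q) X
quadratic-update M M-sym M-irr (x ∷ X) zero rewrite M-irr zero | ∧-zeroʳ x = Boolₚ.xor-comm (linear (M zero ∘ suc) X) _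
quadratic-update M M-sym M-irr (x ∷ X) (suc q)
  rewrite linear-update (M zero ∘ suc) X q
        | quadratic-update (λ u v → M (suc u) (suc v)) (λ u v → M-sym (suc u) (suc v)) (λ v → M-irr (suc v)) X q
        | M-sym (suc q) zero =
  shuffle x (linear (M zero ∘ suc) (X [ q ]≔ false)) (M zero (suc q)) _ _
  where
  shuffle : ∀ x l m k r → (x ∧ (l xor m)) xor (k xor r) ≡ ((x ∧ l) xor k) xor ((x ∧ m) xor r)
  shuffle = from-yes (∀-Bool? λ x → ∀-Bool? λ l → ∀-Bool? λ m → ∀-Bool? λ k → ∀-Bool? λ r →
    (x ∧ (l xor m)) xor (k xor r) ≟ᵇ ((x ∧ l) xor k) xor ((x ∧ m) xor r))

linear-∅ : ∀ {n} (s : Fin n → Bool) → linear s (replicate n false) ≡ false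
linear-∅ {zero}  s = refl
linear-∅ {suc n} s = linear-∅ (s ∘ suc)

quadratic-∅ : ∀ {n} (M : Matrix n) → quadratic M (replicate n false) ≡ false
quadratic-∅ {zero}  M = refl
quadratic-∅ {suc n} M = quadratic-∅ {n} _

linear-cong : ∀ {n} {s s′ : Fin n → Bool} → (∀ v → s v ≡ s′ v) → ∀ X → linear s X ≡ linear s′ X
linear-cong e []      = refl
linear-cong e (x ∷ X) = cong₂ _xor_ (cong (x ∧_) (e zero)) (linear-cong (e ∘ suc) X)

quadratic-cong : ∀ {n} {M M′ : Matrix n} → (∀ u v → u ≢ v → M u v ≡ M′ u v) →
                 ∀ X → quadratic M X ≡ quadratic M′ X
quadratic-cong e []      = refl
quadratic-cong e (x ∷ X) = cong₂ _xor_ (cong (x ∧_) (linear-cong (λ v → e zero (suc v) λ ()) X))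
  (quadratic-cong (λ u v u≢v → e (suc u) (suc v) (u≢v ∘ Finₚ.suc-injective)) X)

-- States of bounded Schmidt rank

-- A factor living on part of the qubits is kept as a function of all of them, so an arbitrary cut
-- requires no reindexing.
DependsOn : ∀ {m} → (Fin m → Bool) → State m → Set
DependsOn A u = ∀ X Y → (∀ q → A q ≡ true → lookup X q ≡ lookup Y q) → u X ≡ u Y

record ProductTerm {m} (A : Fin m → Bool) : Set where
  constructor _⊗_[_,_]
  field
    left right : State m
    left-local  : DependsOn A left
    right-local : DependsOn (not ∘ A) right

open ProductTerm

total : ∀ {m r} {A : Fin m → Bool} → Vec (ProductTerm A) r → State m
total []       X = 0#
total (t ∷ ts) X = (left t X ⊛ right t X) ⊕ total ts X

-- A bound on the Schmidt rank across the cut over the Gaussian rationals; the factor `c` clears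
-- denominators.
Rank≤ : ∀ {m} → ℕ → (Fin m → Bool) → State m → Set
Rank≤ r A ψ = ∃[ c ] (c ≢ 0# × ∃[ ts ] (∀ X → c ⊛ ψ X ≡ total {r = r} {A} ts X))

rank-resp : ∀ {m r} {A : Fin m → Bool} {ψ φ : State m} → (∀ X → ψ X ≡ φ X) → Rank≤ r A φ → Rank≤ r A ψ
rank-resp e (c , c≢0 , ts , f) = c , c≢0 , ts , λ X → trans (cong (c ⊛_) (e X)) (f X)

rank-unscale : ∀ {m r} {A : Fin m → Bool} {ψ φ : State m} d → d ≢ 0# → (∀ X → φ X ≡ d ⊛ ψ X) →
               Rank≤ r A φ → Rank≤ r A ψ
rank-unscale {ψ = ψ} d d≢0 e (c , c≢0 , ts , f) = c ⊛ d , ⊛-nonzero c≢0 d≢0 , ts ,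
  λ X → trans (⊛-assoc c d (ψ X)) (trans (cong (c ⊛_) (sym (e X))) (f X))

scaleTerm : ∀ {m} {A : Fin m → Bool} → ℤ[i] → ProductTerm A → ProductTerm A
scaleTerm d (u ⊗ v [ ul , vl ]) = (λ X → d ⊛ u X) ⊗ v [ (λ X Y e → cong (d ⊛_) (ul X Y e)) , vl ]

total-scale : ∀ {m r} {A : Fin m → Bool} d (ts : Vec (ProductTerm A) r) X →
              total (Data.Vec.map (scaleTerm d) ts) X ≡ d ⊛ total ts X
total-scale d [] X = sym (⊛-zeroʳ d)
total-scale d (t ∷ ts) X rewrite total-scale d ts X = law d (left t X) (right t X) (total ts X)
  where
  law : ∀ d u v w → ((d ⊛ u) ⊛ v) ⊕ (d ⊛ w) ≡ d ⊛ ((u ⊛ v) ⊕ w)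
  law = solve-∀ ℤ[i]-ring

rank-scale : ∀ {m r} {A : Fin m → Bool} {ψ φ : State m} d → (∀ X → φ X ≡ d ⊛ ψ X) →
             Rank≤ r A ψ → Rank≤ r A φ
rank-scale {ψ = ψ} {φ} d e (c , c≢0 , ts , f) = c , c≢0 , Data.Vec.map (scaleTerm d) ts , λ X → begin
  c ⊛ φ X                                 ≡⟨ cong (c ⊛_) (e X) ⟩
  c ⊛ (d ⊛ ψ X)                           ≡⟨ swap c d (ψ X) ⟩
  d ⊛ (c ⊛ ψ X)                             ≡⟨ cong (d ⊛_) (f X) ⟩
  d ⊛ total ts X                          ≡⟨ total-scale d ts X ⟨
  total (Data.Vec.map (scaleTerm d) ts) X ∎
  where
  open ≡-Reasoning
  swap : ∀ c d x → c ⊛ (d ⊛ x) ≡ d ⊛ (c ⊛ x)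
  swap = solve-∀ ℤ[i]-ring

module _ {m : ℕ} (A : Fin m → Bool) where

  agree-update : ∀ (X Y : Subset m) q b → (∀ p → A p ≡ true → lookup X p ≡ lookup Y p) →
                 ∀ p → A p ≡ true → lookup (X [ q ]≔ b) p ≡ lookup (Y [ q ]≔ b) p
  agree-update X Y q b e p Ap with p Finₚ.≟ q
  ... | yes refl = trans (lookup∘update p X b) (sym (lookup∘update p Y b))
  ... | no p≢q   = trans (lookup∘update′ p≢q X b) (trans (e p Ap) (sym (lookup∘update′ p≢q Y b)))

  local-apply : ∀ U q u → A q ≡ true → DependsOn A u → DependsOn A (apply U q u)
  local-apply H q u Aq ul X Y e = cong₂ _⊕_ (ul _ _ (agree-update X Y q false e))
    (cong₂ (λ b x → sgn b ⊛ x) (e q Aq) (ul _ _ (agree-update X Y q true e)))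
  local-apply S q u Aq ul X Y e = cong₂ (λ b x → (if b then 𝕚 else 1#) ⊛ x) (e q Aq) (ul _ _ e)

  local-ignores : ∀ q v b X → A q ≡ false → DependsOn A v → v (X [ q ]≔ b) ≡ v X
  local-ignores q v b X ¬Aq vl = vl _ _ λ p Ap → lookup∘update′ (λ { refl → false≢true ¬Aq Ap }) X b

apply-⊕ : ∀ {m} U q (ψ φ : State m) X → apply U q (λ Y → ψ Y ⊕ φ Y) X ≡ apply U q ψ X ⊕ apply U q φ X
apply-⊕ H q ψ φ X = law (ψ (X [ q ]≔ false)) (φ (X [ q ]≔ false)) (sgn (lookup X q)) (ψ (X [ q ]≔ true)) (φ (X [ q ]≔ true))
  where
  law : ∀ a b s c d → (a ⊕ b) ⊕ (s ⊛ (c ⊕ d)) ≡ (a ⊕ (s ⊛ c)) ⊕ (b ⊕ (s ⊛ d))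
  law = solve-∀ ℤ[i]-ring
apply-⊕ S q ψ φ X = law (if lookup X q then 𝕚 else 1#) (ψ X) (φ X)
  where
  law : ∀ s a b → s ⊛ (a ⊕ b) ≡ (s ⊛ a) ⊕ (s ⊛ b)
  law = solve-∀ ℤ[i]-ring

apply-scale : ∀ {m} U q c (ψ : State m) X → apply U q (λ Y → c ⊛ ψ Y) X ≡ c ⊛ apply U q ψ X
apply-scale H q c ψ X = law c (ψ (X [ q ]≔ false)) (sgn (lookup X q)) (ψ (X [ q ]≔ true))
  where
  law : ∀ c a s b → (c ⊛ a) ⊕ (s ⊛ (c ⊛ b)) ≡ c ⊛ (a ⊕ (s ⊛ b))
  law = solve-∀ ℤ[i]-ring
apply-scale S q c ψ X = law c (if lookup X q then 𝕚 else 1#) (ψ X)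
  where
  law : ∀ c s a → s ⊛ (c ⊛ a) ≡ c ⊛ (s ⊛ a)
  law = solve-∀ ℤ[i]-ring

apply-cong : ∀ {m} U q {ψ φ : State m} → (∀ X → ψ X ≡ φ X) → ∀ X → apply U q ψ X ≡ apply U q φ X
apply-cong H q e X = cong₂ (λ x y → x ⊕ sgn (lookup X q) ⊛ y) (e _) (e _)
apply-cong S q e X = cong ((if lookup X q then 𝕚 else 1#) ⊛_) (e X)

apply-0 : ∀ {m} U q X → apply {m} U q (λ _ → 0#) X ≡ 0#
apply-0 H q X = trans (⊕-identityˡ (sgn (lookup X q) ⊛ 0#)) (⊛-zeroʳ (sgn (lookup X q)))
apply-0 S q X = ⊛-zeroʳ (if lookup X q then 𝕚 else 1#)

apply-local : ∀ {m} U q (u v : State m) → (∀ b X → v (X [ q ]≔ b) ≡ v X) →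
              ∀ X → apply U q (λ Y → u Y ⊛ v Y) X ≡ apply U q u X ⊛ v X
apply-local H q u v e X rewrite e false X | e true X = law (u (X [ q ]≔ false)) (v X) (sgn (lookup X q)) (u (X [ q ]≔ true))
  where
  law : ∀ a v s b → (a ⊛ v) ⊕ (s ⊛ (b ⊛ v)) ≡ (a ⊕ (s ⊛ b)) ⊛ v
  law = solve-∀ ℤ[i]-ring
apply-local S q u v e X = sym (⊛-assoc (if lookup X q then 𝕚 else 1#) (u X) (v X))

module _ {m : ℕ} {A : Fin m → Bool} (U : Gate) (q : Fin m) where

  -- A one-qubit gate touches only the factor that owns its qubit, so the number of terms does not
  -- grow.
  applyTerm : ProductTerm A → ProductTerm A
  applyTerm (u ⊗ v [ ul , vl ]) with true? (A q)
  ... | inj₁ Aq  = apply U q u ⊗ v [ local-apply A U q u Aq ul , vl ]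
  ... | inj₂ ¬Aq = u ⊗ apply U q v [ ul , local-apply (not ∘ A) U q v (cong not ¬Aq) vl ]

  applyTerm-value : ∀ t X → left (applyTerm t) X ⊛ right (applyTerm t) X ≡ apply U q (λ Y → left t Y ⊛ right t Y) X
  applyTerm-value (u ⊗ v [ ul , vl ]) X with true? (A q)
  ... | inj₁ Aq  = sym (apply-local U q u v (λ b X → local-ignores (not ∘ A) q v b X (cong not Aq) vl) X)
  ... | inj₂ ¬Aq = begin
    u X ⊛ apply U q v X             ≡⟨ ⊛-comm (u X) (apply U q v X) ⟩
    apply U q v X ⊛ u X             ≡⟨ apply-local U q v u (λ b X → local-ignores A q u b X ¬Aq ul) X ⟨
    apply U q (λ Y → v Y ⊛ u Y) X   ≡⟨ apply-cong U q (λ Y → ⊛-comm (v Y) (u Y)) X ⟩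
    apply U q (λ Y → u Y ⊛ v Y) X   ∎
    where open ≡-Reasoning

  total-apply : ∀ {r} (ts : Vec (ProductTerm A) r) X →
                total (Data.Vec.map applyTerm ts) X ≡ apply U q (total ts) X
  total-apply []       X = sym (apply-0 U q X)
  total-apply (t ∷ ts) X = trans (cong₂ _⊕_ (applyTerm-value t X) (total-apply ts X))
                                 (sym (apply-⊕ U q (λ Y → left t Y ⊛ right t Y) (total ts) X))

  rank-apply : ∀ {r ψ} → Rank≤ r A ψ → Rank≤ r A (apply U q ψ)
  rank-apply {ψ = ψ} (c , c≢0 , ts , f) = c , c≢0 , Data.Vec.map applyTerm ts , λ X →
    trans (sym (apply-scale U q c ψ X)) (trans (apply-cong U q f X) (sym (total-apply ts X)))

2# : ℤ[i]
2# = 1# ⊕ 1#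

2#≢0 : 2# ≢ 0#
2#≢0 ()

1#≢0 : 1# ≢ 0#
1#≢0 ()

update-self : ∀ {m} (X : Subset m) q {b} → lookup X q ≡ b → X [ q ]≔ b ≡ X
update-self X q refl = []≔-lookup X q

apply-HH : ∀ {m} q (ψ : State m) X → apply H q (apply H q ψ) X ≡ 2# ⊛ ψ X
apply-HH q ψ X
  rewrite []≔-idempotent {x = false} {y = false} X q | []≔-idempotent {x = false} {y = true} X q
        | []≔-idempotent {x = true} {y = false} X q | []≔-idempotent {x = true} {y = true} X q
        | lookup∘update q X false | lookup∘update q X true
  with true? (lookup X q)
... | inj₁ e rewrite e = trans (law (ψ (X [ q ]≔ false)) (ψ (X [ q ]≔ true)))
                               (cong (λ Y → 2# ⊛ ψ Y) (update-self X q e))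
  where
  law : ∀ a b → (a ⊕ 1# ⊛ b) ⊕ -1# ⊛ (a ⊕ -1# ⊛ b) ≡ 2# ⊛ b
  law = solve-∀ ℤ[i]-ring
... | inj₂ e rewrite e = trans (law (ψ (X [ q ]≔ false)) (ψ (X [ q ]≔ true)))
                               (cong (λ Y → 2# ⊛ ψ Y) (update-self X q e))
  where
  law : ∀ a b → (a ⊕ 1# ⊛ b) ⊕ 1# ⊛ (a ⊕ -1# ⊛ b) ≡ 2# ⊛ a
  law = solve-∀ ℤ[i]-ring

apply-SSSS : ∀ {m} q (ψ : State m) X → apply S q (apply S q (apply S q (apply S q ψ))) X ≡ ψ X
apply-SSSS q ψ X with lookup X q
... | true  = fourth (ψ X)
  where
  fourth : ∀ a → 𝕚 ⊛ (𝕚 ⊛ (𝕚 ⊛ (𝕚 ⊛ a))) ≡ a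
  fourth = solve-∀ ℤ[i]-ring
... | false = fourth (ψ X)
  where
  fourth : ∀ a → 1# ⊛ (1# ⊛ (1# ⊛ (1# ⊛ a))) ≡ a
  fourth = solve-∀ ℤ[i]-ring

-- Gates are inverted by gates: `H` by itself up to the factor 2, and `S` by its cube.
rank-unapply : ∀ {m r} {A : Fin m → Bool} U q {ψ : State m} → Rank≤ r A (apply U q ψ) → Rank≤ r A ψ
rank-unapply H q {ψ} ρ = rank-unscale 2# 2#≢0 (apply-HH q ψ) (rank-apply H q ρ)
rank-unapply S q {ψ} ρ = rank-resp (λ X → sym (apply-SSSS q ψ X))
  (rank-apply S q (rank-apply S q (rank-apply S q ρ)))

nonzero? : ∀ {m} (ψ : State m) → Dec (Nonzero ψ)
nonzero? ψ = anySubset? (λ X → ¬? (ψ X ≟ⁱ 0#))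

vanishes : ∀ {m} {ψ : State m} → ¬ Nonzero ψ → ∀ X → ψ X ≡ 0#
vanishes {ψ = ψ} ¬nz X = decidable-stable (ψ X ≟ⁱ 0#) λ ≢0 → ¬nz (X , ≢0)

apply-vanishes : ∀ {m} U q {ψ : State m} → (∀ X → ψ X ≡ 0#) → ∀ X → apply U q ψ X ≡ 0#
apply-vanishes U q e X = trans (apply-cong U q e X) (apply-0 U q X)

nonzero-apply : ∀ {m} U q {ψ : State m} → Nonzero ψ → Nonzero (apply U q ψ)
nonzero-apply U q {ψ} (X , ψX≢0) with nonzero? (apply U q ψ)
... | yes nz = nz
... | no ¬nz = contradiction (ψ-vanishes U (vanishes ¬nz)) ψX≢0
  where
  ψ-vanishes : ∀ U → (∀ Y → apply U q ψ Y ≡ 0#) → ψ X ≡ 0#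
  ψ-vanishes H e = ⊛-cancel 2#≢0 (trans (sym (apply-HH q ψ X)) (apply-vanishes H q e X))
  ψ-vanishes S e = trans (sym (apply-SSSS q ψ X))
    (apply-vanishes S q (apply-vanishes S q (apply-vanishes S q e)) X)

rank-vanishing : ∀ {m} {A : Fin m → Bool} {ψ : State m} → (∀ X → ψ X ≡ 0#) → Rank≤ 1 A ψ
rank-vanishing e = 1# , 1#≢0 ,
  ((λ _ → 0#) ⊗ (λ _ → 0#) [ (λ _ _ _ → refl) , (λ _ _ _ → refl) ]) ∷ [] , λ X → cong (1# ⊛_) (e X)

rank-suc : ∀ {m r} {A : Fin m → Bool} {ψ : State m} → Rank≤ r A ψ → Rank≤ (suc r) A ψ
rank-suc (c , c≢0 , ts , e) = c , c≢0 ,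
  ((λ _ → 0#) ⊗ (λ _ → 0#) [ (λ _ _ _ → refl) , (λ _ _ _ → refl) ]) ∷ ts ,
  λ X → trans (e X) (sym (⊕-identityˡ (total ts X)))

-- Measuring the first qubit

-- The ancilla is placed on the side of `A`, so measuring it acts on left factors only.
extend : ∀ {m} → (Fin m → Bool) → Fin (suc m) → Bool
extend A zero    = true
extend A (suc q) = A q

collapseCoeff : Pauli → Bool → Bool → ℤ[i]
collapseCoeff σx s false = 1#
collapseCoeff σx s true  = if s then -1# else 1#
collapseCoeff σy s false = 1#
collapseCoeff σy s true  = if s then 𝕚 else -𝕚
collapseCoeff σz s b     = if s xor b then 0# else 1#

mix : ∀ {m} → ℤ[i] → ℤ[i] → State (suc m) → State m
mix α β ψ X = α ⊛ ψ (false ∷ X) ⊕ β ⊛ ψ (true ∷ X)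

collapse-mix : ∀ {m} P s (ψ : State (suc m)) X →
  collapse P s zero ψ X ≡ mix (collapseCoeff P s false) (collapseCoeff P s true) ψ X
collapse-mix σx s ψ X = cong (_⊕ collapseCoeff σx s true ⊛ ψ (true ∷ X)) (sym (⊛-identityˡ (ψ (false ∷ X))))
collapse-mix σy s ψ X = cong (_⊕ collapseCoeff σy s true ⊛ ψ (true ∷ X)) (sym (⊛-identityˡ (ψ (false ∷ X))))
collapse-mix σz false ψ X = law (ψ (false ∷ X)) (ψ (true ∷ X))
  where
  law : ∀ a b → a ≡ 1# ⊛ a ⊕ 0# ⊛ b
  law = solve-∀ ℤ[i]-ring
collapse-mix σz true ψ X = law (ψ (false ∷ X)) (ψ (true ∷ X))
  where
  law : ∀ a b → b ≡ 0# ⊛ a ⊕ 1# ⊛ b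
  law = solve-∀ ℤ[i]-ring

-- The eigenvectors of a Pauli operator are orthogonal, so the state before the measurement is
-- recovered with the conjugates of the coefficients in `collapseCoeff`. The squared norm is 2 for
-- `σx` and `σy` and 1 for `σz`, whence the entry 2 there.
recoverCoeff : Pauli → Bool → Bool → ℤ[i]
recoverCoeff σx s false = 1#
recoverCoeff σx s true  = if s then -1# else 1#
recoverCoeff σy s false = 1#
recoverCoeff σy s true  = if s then -𝕚 else 𝕚
recoverCoeff σz s b     = if s xor b then 0# else 2#

recover : ∀ {m} P b (ψ : State (suc m)) X →
  2# ⊛ ψ (b ∷ X) ≡ recoverCoeff P false b ⊛ collapse P false zero ψ X ⊕ recoverCoeff P true b ⊛ collapse P true zero ψ X
recover σx false ψ X = law (ψ (false ∷ X)) (ψ (true ∷ X))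
  where
  law : ∀ a b → 2# ⊛ a ≡ 1# ⊛ (a ⊕ 1# ⊛ b) ⊕ 1# ⊛ (a ⊕ -1# ⊛ b)
  law = solve-∀ ℤ[i]-ring
recover σx true ψ X = law (ψ (false ∷ X)) (ψ (true ∷ X))
  where
  law : ∀ a b → 2# ⊛ b ≡ 1# ⊛ (a ⊕ 1# ⊛ b) ⊕ -1# ⊛ (a ⊕ -1# ⊛ b)
  law = solve-∀ ℤ[i]-ring
recover σy false ψ X = law (ψ (false ∷ X)) (ψ (true ∷ X))
  where
  law : ∀ a b → 2# ⊛ a ≡ 1# ⊛ (a ⊕ -𝕚 ⊛ b) ⊕ 1# ⊛ (a ⊕ 𝕚 ⊛ b)
  law = solve-∀ ℤ[i]-ring
recover σy true ψ X = law (ψ (false ∷ X)) (ψ (true ∷ X))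
  where
  law : ∀ a b → 2# ⊛ b ≡ 𝕚 ⊛ (a ⊕ -𝕚 ⊛ b) ⊕ -𝕚 ⊛ (a ⊕ 𝕚 ⊛ b)
  law = solve-∀ ℤ[i]-ring
recover σz false ψ X = law (ψ (false ∷ X)) (ψ (true ∷ X))
  where
  law : ∀ a b → 2# ⊛ a ≡ 2# ⊛ a ⊕ 0# ⊛ b
  law = solve-∀ ℤ[i]-ring
recover σz true ψ X = law (ψ (false ∷ X)) (ψ (true ∷ X))
  where
  law : ∀ a b → 2# ⊛ b ≡ 0# ⊛ a ⊕ 2# ⊛ b
  law = solve-∀ ℤ[i]-ring

module _ {m : ℕ} {A : Fin m → Bool} where

  agree-∷ : ∀ b (X Y : Subset m) → (∀ q → A q ≡ true → lookup X q ≡ lookup Y q) →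
            ∀ q → extend A q ≡ true → lookup (b ∷ X) q ≡ lookup (b ∷ Y) q
  agree-∷ b X Y e zero    _  = refl
  agree-∷ b X Y e (suc q) Aq = e q Aq

  agree-∷ᶜ : ∀ b b′ (X Y : Subset m) → (∀ q → not (A q) ≡ true → lookup X q ≡ lookup Y q) →
             ∀ q → not (extend A q) ≡ true → lookup (b ∷ X) q ≡ lookup (b′ ∷ Y) q
  agree-∷ᶜ b b′ X Y e (suc q) Aq = e q Aq

  mixTerm : ℤ[i] → ℤ[i] → ProductTerm (extend A) → ProductTerm A
  mixTerm α β (u ⊗ v [ ul , vl ]) =
    mix α β u ⊗ (λ X → v (false ∷ X))
    [ (λ X Y e → cong₂ (λ x y → α ⊛ x ⊕ β ⊛ y) (ul _ _ (agree-∷ false X Y e)) (ul _ _ (agree-∷ true X Y e)))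
    , (λ X Y e → vl _ _ (agree-∷ᶜ false false X Y e)) ]

  total-mix : ∀ {r} α β (ts : Vec (ProductTerm (extend A)) r) X →
              total (Data.Vec.map (mixTerm α β) ts) X ≡ mix α β (total ts) X
  total-mix α β [] X = law α β
    where
    law : ∀ α β → 0# ≡ α ⊛ 0# ⊕ β ⊛ 0#
    law = solve-∀ ℤ[i]-ring
  total-mix α β (t@(u ⊗ v [ ul , vl ]) ∷ ts) X
    rewrite total-mix α β ts X
          | vl (true ∷ X) (false ∷ X) (agree-∷ᶜ true false X X λ _ _ → refl) =
    law α β (u (false ∷ X)) (u (true ∷ X)) (v (false ∷ X)) (total ts (false ∷ X)) (total ts (true ∷ X))
    where
    law : ∀ α β a b v c d →
          (α ⊛ a ⊕ β ⊛ b) ⊛ v ⊕ (α ⊛ c ⊕ β ⊛ d) ≡ α ⊛ (a ⊛ v ⊕ c) ⊕ β ⊛ (b ⊛ v ⊕ d)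
    law = solve-∀ ℤ[i]-ring

  rank-mix : ∀ {r ψ} α β → Rank≤ r (extend A) ψ → Rank≤ r A (mix α β ψ)
  rank-mix {ψ = ψ} α β (c , c≢0 , ts , e) = c , c≢0 , Data.Vec.map (mixTerm α β) ts , λ X → begin
    c ⊛ (α ⊛ ψ (false ∷ X) ⊕ β ⊛ ψ (true ∷ X))        ≡⟨ law c α β (ψ (false ∷ X)) (ψ (true ∷ X)) ⟩
    α ⊛ (c ⊛ ψ (false ∷ X)) ⊕ β ⊛ (c ⊛ ψ (true ∷ X))  ≡⟨ cong₂ (λ x y → α ⊛ x ⊕ β ⊛ y) (e (false ∷ X)) (e (true ∷ X)) ⟩
    mix α β (total ts) X                              ≡⟨ total-mix α β ts X ⟨
    total (Data.Vec.map (mixTerm α β) ts) X           ∎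
    where
    open ≡-Reasoning
    law : ∀ c α β a b → c ⊛ (α ⊛ a ⊕ β ⊛ b) ≡ α ⊛ (c ⊛ a) ⊕ β ⊛ (c ⊛ b)
    law = solve-∀ ℤ[i]-ring

  rank-collapse : ∀ {r ψ} P s → Rank≤ r (extend A) ψ → Rank≤ r A (collapse P s zero ψ)
  rank-collapse {ψ = ψ} P s ρ = rank-resp (collapse-mix P s ψ) (rank-mix (collapseCoeff P s false) (collapseCoeff P s true) ρ)

  unmixTerm : (Bool → ℤ[i]) → ProductTerm A → ProductTerm (extend A)
  unmixTerm γ (u ⊗ v [ ul , vl ]) =
    (λ { (b ∷ X) → γ b ⊛ u X }) ⊗ (λ { (b ∷ X) → v X })
    [ (λ { (b ∷ X) (b′ ∷ Y) e → cong₂ (λ c x → γ c ⊛ x) (e zero refl) (ul X Y (e ∘ suc)) })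
    , (λ { (b ∷ X) (b′ ∷ Y) e → vl X Y (e ∘ suc) }) ]

  -- By `recover`, twice the state is a combination of the two outcomes, and each of them
  -- contributes one product term. Crosswise multiplication by `c` and `c′` gives both a common
  -- factor.
  rank-unmeasure : ∀ {ψ} P → (∀ s → Rank≤ 1 A (collapse P s zero ψ)) → Rank≤ 2 (extend A) ψ
  rank-unmeasure {ψ} P ρ with ρ false | ρ true
  ... | c , c≢0 , t@(u ⊗ v [ _ , _ ]) ∷ [] , e | c′ , c′≢0 , t′@(u′ ⊗ v′ [ _ , _ ]) ∷ [] , e′ =
    (c ⊛ c′) ⊛ 2# , ⊛-nonzero (⊛-nonzero c≢0 c′≢0) 2#≢0 ,
    unmixTerm (λ b → recoverCoeff P false b ⊛ c′) t ∷ unmixTerm (λ b → recoverCoeff P true b ⊛ c) t′ ∷ [] ,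
    λ { (b ∷ X) → begin
      ((c ⊛ c′) ⊛ 2#) ⊛ ψ (b ∷ X)    ≡⟨ ⊛-assoc (c ⊛ c′) 2# (ψ (b ∷ X)) ⟩
      (c ⊛ c′) ⊛ (2# ⊛ ψ (b ∷ X))    ≡⟨ cong ((c ⊛ c′) ⊛_) (recover P b ψ X) ⟩
      (c ⊛ c′) ⊛ (γ b ⊛ φ X ⊕ γ′ b ⊛ φ′ X)
        ≡⟨ law c c′ (γ b) (γ′ b) (φ X) (φ′ X) ⟩
      (γ b ⊛ c′) ⊛ (c ⊛ φ X) ⊕ (γ′ b ⊛ c) ⊛ (c′ ⊛ φ′ X)
        ≡⟨ cong₂ (λ x y → (γ b ⊛ c′) ⊛ x ⊕ (γ′ b ⊛ c) ⊛ y) (e X) (e′ X) ⟩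
      (γ b ⊛ c′) ⊛ (u X ⊛ v X ⊕ 0#) ⊕ (γ′ b ⊛ c) ⊛ (u′ X ⊛ v′ X ⊕ 0#)
        ≡⟨ law′ (γ b ⊛ c′) (γ′ b ⊛ c) (u X) (v X) (u′ X) (v′ X) ⟩
      ((γ b ⊛ c′) ⊛ u X) ⊛ v X ⊕ (((γ′ b ⊛ c) ⊛ u′ X) ⊛ v′ X ⊕ 0#) ∎ }
    where
    open ≡-Reasoning
    γ γ′ : Bool → ℤ[i]
    γ  = recoverCoeff P false
    γ′ = recoverCoeff P true
    φ φ′ : State m
    φ  = collapse P false zero ψ
    φ′ = collapse P true zero ψ
    law : ∀ c d γ δ x y → (c ⊛ d) ⊛ (γ ⊛ x ⊕ δ ⊛ y) ≡ (γ ⊛ d) ⊛ (c ⊛ x) ⊕ (δ ⊛ c) ⊛ (d ⊛ y)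
    law = solve-∀ ℤ[i]-ring
    law′ : ∀ g h u v w z → g ⊛ (u ⊛ v ⊕ 0#) ⊕ h ⊛ (w ⊛ z ⊕ 0#) ≡ (g ⊛ u) ⊛ v ⊕ ((h ⊛ w) ⊛ z ⊕ 0#)
    law′ = solve-∀ ℤ[i]-ring

nonzero-collapse : ∀ {m} P {ψ : State (suc m)} → Nonzero ψ → ∃[ s ] Nonzero (collapse P s zero ψ)
nonzero-collapse P {ψ} (b ∷ X , ≢0) with nonzero? (collapse P false zero ψ) | nonzero? (collapse P true zero ψ)
... | yes nz | _      = false , nz
... | no _   | yes nz = true , nz
... | no z   | no z′  = contradiction (⊛-cancel 2#≢0 (begin
  2# ⊛ ψ (b ∷ X)     ≡⟨ recover P b ψ X ⟩
  γ ⊛ collapse P false zero ψ X ⊕ γ′ ⊛ collapse P true zero ψ X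
                     ≡⟨ cong₂ (λ x y → γ ⊛ x ⊕ γ′ ⊛ y) (vanishes z X) (vanishes z′ X) ⟩
  γ ⊛ 0# ⊕ γ′ ⊛ 0#   ≡⟨ cong₂ _⊕_ (⊛-zeroʳ γ) (⊛-zeroʳ γ′) ⟩
  0#                 ∎)) ≢0
  where
  open ≡-Reasoning
  γ γ′ : ℤ[i]
  γ  = recoverCoeff P false b
  γ′ = recoverCoeff P true b

module _ {n : ℕ} {K : Graph n} {A : Fin n → Bool} where

  rank-source₀ : ∀ {r ψ} → Preparable K 0 ψ → Rank≤ r A (graphState K) → Rank≤ r A ψ
  rank-source₀ (done (c , _ , e)) ρ = rank-scale c e ρ
  rank-source₀ (gate U q prep)    ρ = rank-unapply U q (rank-source₀ prep ρ)

  rank-result₀ : ∀ {r ψ} → Preparable K 0 ψ → Rank≤ r A ψ → Rank≤ r A (graphState K)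
  rank-result₀ (done (c , c≢0 , e)) ρ = rank-unscale c c≢0 e ρ
  rank-result₀ (gate U q prep)      ρ = rank-result₀ prep (rank-apply U q ρ)

  rank-source₁ : ∀ {ψ} → Preparable K 1 ψ → Rank≤ 1 A (graphState K) → Rank≤ 2 (extend A) ψ
  rank-source₁ (gate U q prep) ρ = rank-unapply U q (rank-source₁ prep ρ)
  rank-source₁ {ψ} (measure P zero prep) ρ = rank-unmeasure P outcome
    where
    outcome : ∀ s → Rank≤ 1 A (collapse P s zero ψ)
    outcome s with nonzero? (collapse P s zero ψ)
    ... | yes nz = rank-source₀ (prep s nz) ρ
    -- The protocol promises nothing about an outcome of probability zero, but the collapsed state
    -- is then zero.
    ... | no ¬nz = rank-vanishing (vanishes ¬nz)

  -- Following one outcome of positive probability suffices; nonzero states always have one, and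
  -- gates preserve being nonzero.
  rank-result₁ : ∀ {r ψ} → Preparable K 1 ψ → Nonzero ψ → Rank≤ r (extend A) ψ → Rank≤ r A (graphState K)
  rank-result₁ (gate U q prep) nz ρ = rank-result₁ prep (nonzero-apply U q nz) (rank-apply U q ρ)
  rank-result₁ (measure P zero prep) nz ρ with nonzero-collapse P nz
  ... | s , nzₛ = rank-result₀ (prep s nzₛ) (rank-collapse P s ρ)

-- Cut-rank of graph states

restrict : ∀ {n} → (Fin n → Bool) → Subset n → Subset n
restrict A []      = []
restrict A (x ∷ X) = (A zero ∧ x) ∷ restrict (A ∘ suc) X

restrict-local : ∀ {n} (A : Fin n → Bool) X Y → (∀ q → A q ≡ true → lookup X q ≡ lookup Y q) →
                 restrict A X ≡ restrict A Y
restrict-local A []      []      e = refl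
restrict-local A (x ∷ X) (y ∷ Y) e = cong₂ _∷_ (first (true? (A zero))) (restrict-local (A ∘ suc) X Y (e ∘ suc))
  where
  first : A zero ≡ true ⊎ A zero ≡ false → A zero ∧ x ≡ A zero ∧ y
  first (inj₁ A₀)  = cong (A zero ∧_) (e zero A₀)
  first (inj₂ ¬A₀) = trans (cong (_∧ x) ¬A₀) (sym (cong (_∧ y) ¬A₀))

linear-split : ∀ {n} (A s : Fin n → Bool) X →
               linear s X ≡ linear s (restrict A X) xor linear s (restrict (not ∘ A) X)
linear-split A s []      = refl
linear-split A s (x ∷ X) rewrite linear-split (A ∘ suc) (s ∘ suc) X = law (A zero) x (s zero) _ _
  where
  law : ∀ a x s l k → (x ∧ s) xor (l xor k) ≡ (((a ∧ x) ∧ s) xor l) xor (((not a ∧ x) ∧ s) xor k)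
  law = from-yes (∀-Bool? λ a → ∀-Bool? λ x → ∀-Bool? λ s → ∀-Bool? λ l → ∀-Bool? λ k →
    (x ∧ s) xor (l xor k) ≟ᵇ (((a ∧ x) ∧ s) xor l) xor (((not a ∧ x) ∧ s) xor k))

linear-vanishes : ∀ {n} (A s : Fin n → Bool) X → (∀ v → A v ≡ true → s v ≡ false) →
                  linear s (restrict A X) ≡ false
linear-vanishes A s []      e = refl
linear-vanishes A s (x ∷ X) e rewrite linear-vanishes (A ∘ suc) (s ∘ suc) X (e ∘ suc) = first (true? (A zero))
  where
  first : A zero ≡ true ⊎ A zero ≡ false → ((A zero ∧ x) ∧ s zero) xor false ≡ false
  first (inj₁ A₀)  rewrite e zero A₀ | ∧-zeroʳ (A zero ∧ x) = refl
  first (inj₂ ¬A₀) rewrite ¬A₀ = refl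

quadratic-split : ∀ {n} (A : Fin n → Bool) (M : Matrix n) → (∀ u v → A u ≢ A v → M u v ≡ false) →
  ∀ X → quadratic M X ≡ quadratic M (restrict A X) xor quadratic M (restrict (not ∘ A) X)
quadratic-split A M cut []      = refl
quadratic-split {suc n} A M cut (x ∷ X)
  rewrite quadratic-split (A ∘ suc) (λ u v → M (suc u) (suc v)) (λ u v → cut (suc u) (suc v)) X
        | linear-split (A ∘ suc) (M zero ∘ suc) X = first (true? (A zero))
  where
  l k q r : Bool
  l = linear (M zero ∘ suc) (restrict (A ∘ suc) X)
  k = linear (M zero ∘ suc) (restrict (not ∘ A ∘ suc) X)
  q = quadratic (λ u v → M (suc u) (suc v)) (restrict (A ∘ suc) X)
  r = quadratic (λ u v → M (suc u) (suc v)) (restrict (not ∘ A ∘ suc) X)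
  law₁ : ∀ x l q r → (x ∧ (l xor false)) xor (q xor r) ≡ ((x ∧ l) xor q) xor r
  law₁ = from-yes (∀-Bool? λ x → ∀-Bool? λ l → ∀-Bool? λ q → ∀-Bool? λ r →
    (x ∧ (l xor false)) xor (q xor r) ≟ᵇ ((x ∧ l) xor q) xor r)
  law₂ : ∀ x k q r → (x ∧ (false xor k)) xor (q xor r) ≡ q xor ((x ∧ k) xor r)
  law₂ = from-yes (∀-Bool? λ x → ∀-Bool? λ k → ∀-Bool? λ q → ∀-Bool? λ r →
    (x ∧ (false xor k)) xor (q xor r) ≟ᵇ q xor ((x ∧ k) xor r))
  first : A zero ≡ true ⊎ A zero ≡ false →
    (x ∧ (l xor k)) xor (q xor r) ≡ (((A zero ∧ x) ∧ l) xor q) xor (((not (A zero) ∧ x) ∧ k) xor r)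
  first (inj₁ A₀) rewrite A₀ | linear-vanishes (not ∘ A ∘ suc) (M zero ∘ suc) X
    (λ v ¬Av → cut zero (suc v) (λ e → false≢true (not-true ¬Av) (trans (sym e) A₀))) = law₁ x l q r
  first (inj₂ A₀) rewrite A₀ | linear-vanishes (A ∘ suc) (M zero ∘ suc) X
    (λ v Av → cut zero (suc v) (λ e → false≢true A₀ (trans e Av))) = law₂ x k q r

sgn-xor : ∀ x y → sgn (x xor y) ≡ sgn x ⊛ sgn y
sgn-xor true  true  = refl
sgn-xor true  false = refl
sgn-xor false true  = refl
sgn-xor false false = refl

rank-disconnected : ∀ {n} (G : Graph n) (A : Fin n → Bool) → (∀ u v → A u ≢ A v → adj G u v ≡ false) →
                    Rank≤ 1 A (graphState G)
rank-disconnected G A cut = 1# , 1#≢0 , part A ⊗ part (not ∘ A)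
  [ (λ X Y e → cong (sgn ∘ quadratic (adj G)) (restrict-local A X Y e))
  , (λ X Y e → cong (sgn ∘ quadratic (adj G)) (restrict-local (not ∘ A) X Y e)) ] ∷ [] ,
  λ X → begin
    1# ⊛ graphState G X                          ≡⟨ ⊛-identityˡ (graphState G X) ⟩
    graphState G X                               ≡⟨ graphState-quadratic G X ⟩
    sgn (quadratic (adj G) X)                    ≡⟨ cong sgn (quadratic-split A (adj G) cut X) ⟩
    sgn (quadratic (adj G) (restrict A X) xor quadratic (adj G) (restrict (not ∘ A) X))
                                                 ≡⟨ sgn-xor (quadratic (adj G) (restrict A X)) _ ⟩
    part A X ⊛ part (not ∘ A) X                  ≡⟨ ⊕-identityʳ (part A X ⊛ part (not ∘ A) X) ⟨
    part A X ⊛ part (not ∘ A) X ⊕ 0#             ∎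
  where
  open ≡-Reasoning
  part : (Fin _ → Bool) → State _
  part B X = sgn (quadratic (adj G) (restrict B X))

graphState-nonzero : ∀ {n} (G : Graph n) → Nonzero (graphState G)
graphState-nonzero {n} G = replicate n false , λ e → 1#≢0 (trans (sym empty) e)
  where
  empty : graphState G (replicate n false) ≡ 1#
  empty = trans (graphState-quadratic G (replicate n false)) (cong sgn (quadratic-∅ (adj G)))

det₃ : (a b c d e f g h i : ℤ[i]) → ℤ[i]
det₃ a b c d e f g h i =
  a ⊛ (e ⊛ i ⊕ ⊖ (f ⊛ h)) ⊕ (⊖ (b ⊛ (d ⊛ i ⊕ ⊖ (f ⊛ g))) ⊕ c ⊛ (d ⊛ h ⊕ ⊖ (e ⊛ g)))

-- The matrix is a sum of two matrices of rank one, so it has no nonzero 3 × 3 minor.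
det₃-rank₂ : ∀ u₀ u₁ u₂ v₀ v₁ v₂ w₀ w₁ w₂ z₀ z₁ z₂ →
  det₃ (u₀ ⊛ v₀ ⊕ w₀ ⊛ z₀) (u₀ ⊛ v₁ ⊕ w₀ ⊛ z₁) (u₀ ⊛ v₂ ⊕ w₀ ⊛ z₂)
       (u₁ ⊛ v₀ ⊕ w₁ ⊛ z₀) (u₁ ⊛ v₁ ⊕ w₁ ⊛ z₁) (u₁ ⊛ v₂ ⊕ w₁ ⊛ z₂)
       (u₂ ⊛ v₀ ⊕ w₂ ⊛ z₀) (u₂ ⊛ v₁ ⊕ w₂ ⊛ z₁) (u₂ ⊛ v₂ ⊕ w₂ ⊛ z₂) ≡ 0#
det₃-rank₂ = expanded
  where
  expanded : ∀ u₀ u₁ u₂ v₀ v₁ v₂ w₀ w₁ w₂ z₀ z₁ z₂ →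
    (u₀ ⊛ v₀ ⊕ w₀ ⊛ z₀) ⊛ ((u₁ ⊛ v₁ ⊕ w₁ ⊛ z₁) ⊛ (u₂ ⊛ v₂ ⊕ w₂ ⊛ z₂) ⊕ ⊖ ((u₁ ⊛ v₂ ⊕ w₁ ⊛ z₂) ⊛ (u₂ ⊛ v₁ ⊕ w₂ ⊛ z₁))) ⊕
    (⊖ ((u₀ ⊛ v₁ ⊕ w₀ ⊛ z₁) ⊛ ((u₁ ⊛ v₀ ⊕ w₁ ⊛ z₀) ⊛ (u₂ ⊛ v₂ ⊕ w₂ ⊛ z₂) ⊕ ⊖ ((u₁ ⊛ v₂ ⊕ w₁ ⊛ z₂) ⊛ (u₂ ⊛ v₀ ⊕ w₂ ⊛ z₀)))) ⊕
     (u₀ ⊛ v₂ ⊕ w₀ ⊛ z₂) ⊛ ((u₁ ⊛ v₀ ⊕ w₁ ⊛ z₀) ⊛ (u₂ ⊛ v₁ ⊕ w₂ ⊛ z₁) ⊕ ⊖ ((u₁ ⊛ v₁ ⊕ w₁ ⊛ z₁) ⊛ (u₂ ⊛ v₀ ⊕ w₂ ⊛ z₀))))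
    ≡ 0#
  expanded = solve-∀ ℤ[i]-ring

det₃-scale : ∀ c a₁ a₂ a₃ a₄ a₅ a₆ a₇ a₈ a₉ →
  det₃ (c ⊛ a₁) (c ⊛ a₂) (c ⊛ a₃) (c ⊛ a₄) (c ⊛ a₅) (c ⊛ a₆) (c ⊛ a₇) (c ⊛ a₈) (c ⊛ a₉) ≡
  c ⊛ (c ⊛ (c ⊛ det₃ a₁ a₂ a₃ a₄ a₅ a₆ a₇ a₈ a₉))
det₃-scale = expanded
  where
  expanded : ∀ c a₁ a₂ a₃ a₄ a₅ a₆ a₇ a₈ a₉ →
    (c ⊛ a₁) ⊛ ((c ⊛ a₅) ⊛ (c ⊛ a₉) ⊕ ⊖ ((c ⊛ a₆) ⊛ (c ⊛ a₈))) ⊕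
    (⊖ ((c ⊛ a₂) ⊛ ((c ⊛ a₄) ⊛ (c ⊛ a₉) ⊕ ⊖ ((c ⊛ a₆) ⊛ (c ⊛ a₇)))) ⊕
     (c ⊛ a₃) ⊛ ((c ⊛ a₄) ⊛ (c ⊛ a₈) ⊕ ⊖ ((c ⊛ a₅) ⊛ (c ⊛ a₇)))) ≡
    c ⊛ (c ⊛ (c ⊛ (a₁ ⊛ (a₅ ⊛ a₉ ⊕ ⊖ (a₆ ⊛ a₈)) ⊕
      (⊖ (a₂ ⊛ (a₄ ⊛ a₉ ⊕ ⊖ (a₆ ⊛ a₇))) ⊕ a₃ ⊛ (a₄ ⊛ a₈ ⊕ ⊖ (a₅ ⊛ a₇))))))
  expanded = solve-∀ ℤ[i]-ring

-- This determinant is 4 times the minor of the exponents.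
det₃-sgn : ∀ p q r s → det₃ 1# 1# 1# 1# (sgn p) (sgn q) 1# (sgn r) (sgn s) ≡ 0# → p ∧ s ≡ q ∧ r
det₃-sgn = from-yes (∀-Bool? λ p → ∀-Bool? λ q → ∀-Bool? λ r → ∀-Bool? λ s →
  (det₃ 1# 1# 1# 1# (sgn p) (sgn q) 1# (sgn r) (sgn s) ≟ⁱ 0#) →-dec (p ∧ s ≟ᵇ q ∧ r))

module _ {n : ℕ} (G : Graph n) where

  private
    ∅ : Subset n
    ∅ = replicate n false

  graphState-∅ : graphState G ∅ ≡ 1#
  graphState-∅ = trans (graphState-quadratic G ∅) (cong sgn (quadratic-∅ (adj G)))

  quadratic-point : ∀ x → quadratic (adj G) (∅ [ x ]≔ true) ≡ false
  quadratic-point x = begin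
    quadratic (adj G) (∅ [ x ]≔ true)                                  ≡⟨ quadratic-update (adj G) (symmetric G) (irreflexive G) ∅ x ⟩
    quadratic (adj G) (∅ [ x ]≔ false) xor linear (adj G x) ∅          ≡⟨ cong₂ _xor_ (cong (quadratic (adj G)) (update-self ∅ x (lookup-replicate x false)))
                                                                                     (linear-∅ (adj G x)) ⟩
    quadratic (adj G) ∅ xor false                                      ≡⟨ cong (_xor false) (quadratic-∅ (adj G)) ⟩
    false                                                              ∎
    where open ≡-Reasoning

  graphState-point : ∀ x → graphState G (∅ [ x ]≔ true) ≡ 1#
  graphState-point x = trans (graphState-quadratic G (∅ [ x ]≔ true)) (cong sgn (quadratic-point x))

  linear-point : ∀ (s : Fin n → Bool) x → linear s (∅ [ x ]≔ true) ≡ s x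
  linear-point s x = trans (linear-update s ∅ x) (cong (_xor s x)
    (trans (cong (linear s) (update-self ∅ x (lookup-replicate x false))) (linear-∅ s)))

  graphState-pair : ∀ x y → x ≢ y → graphState G ((∅ [ x ]≔ true) [ y ]≔ true) ≡ sgn (adj G x y)
  graphState-pair x y x≢y = trans (graphState-quadratic G ((∅ [ x ]≔ true) [ y ]≔ true)) (cong sgn (begin
    quadratic (adj G) ((∅ [ x ]≔ true) [ y ]≔ true)
      ≡⟨ quadratic-update (adj G) (symmetric G) (irreflexive G) (∅ [ x ]≔ true) y ⟩
    quadratic (adj G) ((∅ [ x ]≔ true) [ y ]≔ false) xor linear (adj G y) (∅ [ x ]≔ true)
      ≡⟨ cong₂ _xor_ (cong (quadratic (adj G)) (update-self (∅ [ x ]≔ true) y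
           (trans (lookup∘update′ (x≢y ∘ sym) ∅ true) (lookup-replicate y false))))
         (linear-point (adj G y) x) ⟩
    quadratic (adj G) (∅ [ x ]≔ true) xor adj G y x
      ≡⟨ cong₂ _xor_ (quadratic-point x) (symmetric G y x) ⟩
    adj G x y ∎))
    where open ≡-Reasoning

  -- The amplitudes at the unions of ∅, {x}, {x′} with ∅, {y}, {y′} form a 3 × 3 submatrix of the
  -- amplitude matrix across the cut. Its first row and column consist of ones and its other entries
  -- are the signs of the four adjacencies; rank 2 makes its determinant vanish.
  minor-of-rank₂ : ∀ {A : Fin n → Bool} → Rank≤ 2 A (graphState G) → ∀ x x′ y y′ →
    A x ≡ true → A x′ ≡ true → A y ≡ false → A y′ ≡ false →
    adj G x y ∧ adj G x′ y′ ≡ adj G x y′ ∧ adj G x′ y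
  minor-of-rank₂ {A} (c , c≢0 , t ∷ t′ ∷ [] , e) x x′ y y′ Ax Ax′ Ay Ay′ =
    det₃-sgn (adj G x y) (adj G x y′) (adj G x′ y) (adj G x′ y′)
      (⊛-cancel c≢0 (⊛-cancel c≢0 (⊛-cancel c≢0 (begin
        _                                ≡⟨ det₃-scale c 1# 1# 1# 1# (sgn (adj G x y)) (sgn (adj G x y′)) 1# (sgn (adj G x′ y)) (sgn (adj G x′ y′)) ⟨
        det₃ (c ⊛ 1#) (c ⊛ 1#) (c ⊛ 1#) (c ⊛ 1#) (c ⊛ sgn (adj G x y)) (c ⊛ sgn (adj G x y′))
             (c ⊛ 1#) (c ⊛ sgn (adj G x′ y)) (c ⊛ sgn (adj G x′ y′))
          ≡⟨ det₃-cong corner (column y Ay) (column y′ Ay′) (row x Ax) (entry x y Ax Ay) (entry x y′ Ax Ay′)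
               (row x′ Ax′) (entry x′ y Ax′ Ay) (entry x′ y′ Ax′ Ay′) ⟩
        _ ≡⟨ det₃-rank₂ (u ∅) (u (pt x)) (u (pt x′)) (v ∅) (v (pt y)) (v (pt y′))
                        (w ∅) (w (pt x)) (w (pt x′)) (z ∅) (z (pt y)) (z (pt y′)) ⟩
        0# ∎))))
    where
    open ≡-Reasoning
    open ProductTerm
    u v w z : State n
    u = left t
    v = right t
    w = left t′
    z = right t′
    pt : Fin n → Subset n
    pt q = ∅ [ q ]≔ true

    det₃-cong : ∀ {a b c d e f g h i a′ b′ c′ d′ e′ f′ g′ h′ i′} →
      a ≡ a′ → b ≡ b′ → c ≡ c′ → d ≡ d′ → e ≡ e′ → f ≡ f′ → g ≡ g′ → h ≡ h′ → i ≡ i′ →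
      det₃ a b c d e f g h i ≡ det₃ a′ b′ c′ d′ e′ f′ g′ h′ i′
    det₃-cong refl refl refl refl refl refl refl refl refl = refl

    value : ∀ X {g u₀ v₀ w₀ z₀} → graphState G X ≡ g → u X ≡ u₀ → v X ≡ v₀ → w X ≡ w₀ → z X ≡ z₀ →
            c ⊛ g ≡ u₀ ⊛ v₀ ⊕ w₀ ⊛ z₀
    value X refl refl refl refl refl =
      trans (e X) (cong (u X ⊛ v X ⊕_) (⊕-identityʳ (w X ⊛ z X)))

    left-col : ∀ (s : State n) → DependsOn A s → ∀ X q → A q ≡ false → s (X [ q ]≔ true) ≡ s X
    left-col s sl X q ¬Aq = local-ignores A q s true X ¬Aq sl

    right-row : ∀ (s : State n) → DependsOn (not ∘ A) s → ∀ X q → A q ≡ true → s (X [ q ]≔ true) ≡ s X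
    right-row s sl X q Aq = local-ignores (not ∘ A) q s true X (cong not Aq) sl

    right-pair : ∀ (s : State n) → DependsOn (not ∘ A) s → ∀ p q → A p ≡ true →
                 s (pt p [ q ]≔ true) ≡ s (pt q)
    right-pair s sl p q Ap = sl (pt p [ q ]≔ true) (pt q) (agree-update (not ∘ A) (pt p) ∅ q true
      λ r ¬Ar → lookup∘update′ (λ { refl → contradiction (trans (sym ¬Ar) (cong not Ap)) λ () }) ∅ true)

    corner : c ⊛ 1# ≡ u ∅ ⊛ v ∅ ⊕ w ∅ ⊛ z ∅
    corner = value ∅ graphState-∅ refl refl refl refl

    column : ∀ q → A q ≡ false → c ⊛ 1# ≡ u ∅ ⊛ v (pt q) ⊕ w ∅ ⊛ z (pt q)
    column q ¬Aq = value (pt q) (graphState-point q)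
      (left-col u (left-local t) ∅ q ¬Aq) refl (left-col w (left-local t′) ∅ q ¬Aq) refl

    row : ∀ p → A p ≡ true → c ⊛ 1# ≡ u (pt p) ⊛ v ∅ ⊕ w (pt p) ⊛ z ∅
    row p Ap = value (pt p) (graphState-point p)
      refl (right-row v (right-local t) ∅ p Ap) refl (right-row z (right-local t′) ∅ p Ap)

    entry : ∀ p q → A p ≡ true → A q ≡ false → c ⊛ sgn (adj G p q) ≡ u (pt p) ⊛ v (pt q) ⊕ w (pt p) ⊛ z (pt q)
    entry p q Ap ¬Aq = value (pt p [ q ]≔ true) (graphState-pair p q (λ { refl → false≢true ¬Aq Ap }))
      (left-col u (left-local t) (pt p) q ¬Aq) (right-pair v (right-local t) p q Ap)
      (left-col w (left-local t′) (pt p) q ¬Aq) (right-pair z (right-local t′) p q Ap)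

distance-rank : ∀ {n} {G G′ : Graph n} (A : Fin n → Bool) → Distance≤ 1 G G′ →
                Rank≤ 1 A (graphState G′) → Rank≤ 2 A (graphState G)
distance-rank {G = G} A (zero , _ , Ĝ , prep , prep′) ρ =
  rank-suc {ψ = graphState G} (rank-result₀ prep (rank-source₀ prep′ ρ))
distance-rank A (suc zero , _ , Ĝ , prep , prep′) ρ =
  rank-result₁ prep (graphState-nonzero Ĝ) (rank-source₁ prep′ ρ)
distance-rank A (suc (suc _) , s≤s () , _) ρ

distance-good : ∀ {n} {L : Set} (_≟_ : DecidableEquality L) {G G′ : Graph n} → Distance≤ 1 G G′ →
  (p : Fin n → L) → (∀ u v → adj G′ u v ≡ true → p u ≡ p v) → Good G p
distance-good {n} _≟_ {G} {G′} dist p mono x x′ y y′ xy xy′ x′y x′y′ =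
  minor-of-rank₂ G (distance-rank A dist (rank-disconnected G′ A cut)) x x′ y y′
    (∨-introˡ _ (dec-true (p x ≟ p x) refl))
    (∨-introʳ (does (p x′ ≟ p x)) (dec-true (p x′ ≟ p x′) refl))
    (cong₂ _∨_ (dec-false (p y ≟ p x) (xy ∘ sym)) (dec-false (p y ≟ p x′) (x′y ∘ sym)))
    (cong₂ _∨_ (dec-false (p y′ ≟ p x) (xy′ ∘ sym)) (dec-false (p y′ ≟ p x′) (x′y′ ∘ sym)))
  where
  -- The union of the classes of `x` and `x′` separates the rows of the minor from its columns, and
  -- no edge of `G′` leaves it.
  A : Fin n → Bool
  A z = does (p z ≟ p x) ∨ does (p z ≟ p x′)
  cut : ∀ u v → A u ≢ A v → adj G′ u v ≡ false
  cut u v Au≢Av = ¬-not λ e → Au≢Av (cong (λ l → does (l ≟ p x) ∨ does (l ≟ p x′)) (mono u v e))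

-- Protocols without ancillas

∝-scale : ∀ {m} {ψ χ φ : State m} c → c ≢ 0# → (∀ X → ψ X ≡ c ⊛ χ X) → χ ∝ φ → ψ ∝ φ
∝-scale {φ = φ} c c≢0 e (d , d≢0 , f) = c ⊛ d , ⊛-nonzero c≢0 d≢0 ,
  λ X → trans (e X) (trans (cong (c ⊛_) (f X)) (sym (⊛-assoc c d (φ X))))

prepare-scaled : ∀ {n} {K : Graph n} {ψ χ : State n} c → c ≢ 0# → (∀ X → ψ X ≡ c ⊛ χ X) →
                 Preparable K 0 χ → Preparable K 0 ψ
prepare-scaled {ψ = ψ} c c≢0 e (done χ∝) = done (∝-scale {ψ = ψ} c c≢0 e χ∝)
prepare-scaled {χ = χ} c c≢0 e (gate U q prep) = gate U q (prepare-scaled c c≢0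
  (λ X → trans (apply-cong U q e X) (apply-scale U q c χ X)) prep)

prepare-resp : ∀ {n} {K : Graph n} {ψ χ : State n} → (∀ X → ψ X ≡ χ X) →
               Preparable K 0 χ → Preparable K 0 ψ
prepare-resp {χ = χ} e = prepare-scaled 1# 1#≢0 λ X → trans (e X) (sym (⊛-identityˡ (χ X)))

phases : ∀ {n} → List (Fin n) → State n
phases []       X = 1#
phases (q ∷ qs) X = (if lookup X q then 𝕚 else 1#) ⊛ phases qs X

prepare-phases : ∀ {n} {K : Graph n} {ψ : State n} qs →
                 Preparable K 0 (λ X → phases qs X ⊛ ψ X) → Preparable K 0 ψ
prepare-phases {ψ = ψ} [] prep = prepare-resp (λ X → sym (⊛-identityˡ (ψ X))) prep
prepare-phases {ψ = ψ} (q ∷ qs) prep = gate S q (prepare-phases qs (prepare-resp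
  (λ X → law (phases qs X) (if lookup X q then 𝕚 else 1#) (ψ X)) prep))
  where
  law : ∀ p s a → p ⊛ (s ⊛ a) ≡ (s ⊛ p) ⊛ a
  law = solve-∀ ℤ[i]-ring

-- Applying `S` once per list entry gives, at every vertex of `f`, the gate `S`, the Pauli operator
-- Z or the inverse of `S` for `r` equal to 1, 2 or 3.
copies : ∀ {n} → ℕ → (Fin n → Bool) → List (Fin n)
copies {zero}  r f = []
copies {suc n} r f = (if f zero then List.replicate r zero else []) ++ List.map suc (copies r (f ∘ suc))

phases-suc : ∀ {n} (qs : List (Fin n)) x X → phases (List.map suc qs) (x ∷ X) ≡ phases qs X
phases-suc []       x X = refl
phases-suc (q ∷ qs) x X = cong ((if lookup X q then 𝕚 else 1#) ⊛_) (phases-suc qs x X)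

power : ℤ[i] → ℕ → ℤ[i]
power z zero    = 1#
power z (suc r) = z ⊛ power z r

phases-replicate : ∀ {n} r (qs : List (Fin (suc n))) x X →
  phases (List.replicate r zero ++ qs) (x ∷ X) ≡ power (if x then 𝕚 else 1#) r ⊛ phases qs (x ∷ X)
phases-replicate zero    qs x X = sym (⊛-identityˡ (phases qs (x ∷ X)))
phases-replicate (suc r) qs x X = trans (cong ((if x then 𝕚 else 1#) ⊛_) (phases-replicate r qs x X))
  (sym (⊛-assoc (if x then 𝕚 else 1#) (power (if x then 𝕚 else 1#) r) (phases qs (x ∷ X))))

phases-copies : ∀ {n} r (f : Fin (suc n) → Bool) x X → phases (copies r f) (x ∷ X) ≡
  (if f zero then power (if x then 𝕚 else 1#) r else 1#) ⊛ phases (copies r (f ∘ suc)) X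
phases-copies r f x X with f zero
... | true  = trans (phases-replicate r _ x X)
                    (cong (power (if x then 𝕚 else 1#) r ⊛_) (phases-suc (copies r (f ∘ suc)) x X))
... | false = trans (phases-suc (copies r (f ∘ suc)) x X) (sym (⊛-identityˡ (phases (copies r (f ∘ suc)) X)))

-- The clique on `f`; `quadratic` never reads the diagonal.
square-matrix : ∀ {n} → (Fin n → Bool) → Matrix n
square-matrix f u v = f u ∧ f v

linear-∧ : ∀ {n} c (f : Fin n → Bool) X → linear (λ v → c ∧ f v) X ≡ c ∧ linear f X
linear-∧ c f [] = sym (∧-zeroʳ c)
linear-∧ c f (x ∷ X) rewrite linear-∧ c (f ∘ suc) X = law c x (f zero) (linear (f ∘ suc) X)
  where
  law : ∀ c x a l → (x ∧ (c ∧ a)) xor (c ∧ l) ≡ c ∧ ((x ∧ a) xor l)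
  law = from-yes (∀-Bool? λ c → ∀-Bool? λ x → ∀-Bool? λ a → ∀-Bool? λ l →
    (x ∧ (c ∧ a)) xor (c ∧ l) ≟ᵇ c ∧ ((x ∧ a) xor l))

-- i^k = i^(k mod 2) (-1)^(k choose 2), and the pairs inside X ∩ f number (|X ∩ f| choose 2).
phases₁ : ∀ {n} (f : Fin n → Bool) X →
  phases (copies 1 f) X ≡ (if linear f X then 𝕚 else 1#) ⊛ sgn (quadratic (square-matrix f) X)
phases₁ f [] = refl
phases₁ f (x ∷ X) rewrite phases-copies 1 f x X | phases₁ (f ∘ suc) X | linear-∧ (f zero) (f ∘ suc) X =
  law (f zero) x (linear (f ∘ suc) X) (quadratic (square-matrix (f ∘ suc)) X)
  where
  law : ∀ a x l q →
    (if a then power (if x then 𝕚 else 1#) 1 else 1#) ⊛ ((if l then 𝕚 else 1#) ⊛ sgn q) ≡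
    (if (x ∧ a) xor l then 𝕚 else 1#) ⊛ sgn ((x ∧ (a ∧ l)) xor q)
  law = from-yes (∀-Bool? λ a → ∀-Bool? λ x → ∀-Bool? λ l → ∀-Bool? λ q →
    (if a then power (if x then 𝕚 else 1#) 1 else 1#) ⊛ ((if l then 𝕚 else 1#) ⊛ sgn q) ≟ⁱ
    (if (x ∧ a) xor l then 𝕚 else 1#) ⊛ sgn ((x ∧ (a ∧ l)) xor q))

phases₂ : ∀ {n} (f : Fin n → Bool) X → phases (copies 2 f) X ≡ sgn (linear f X)
phases₂ f [] = refl
phases₂ f (x ∷ X) rewrite phases-copies 2 f x X | phases₂ (f ∘ suc) X =
  law (f zero) x (linear (f ∘ suc) X)
  where
  law : ∀ a x l → (if a then power (if x then 𝕚 else 1#) 2 else 1#) ⊛ sgn l ≡ sgn ((x ∧ a) xor l)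
  law = from-yes (∀-Bool? λ a → ∀-Bool? λ x → ∀-Bool? λ l →
    (if a then power (if x then 𝕚 else 1#) 2 else 1#) ⊛ sgn l ≟ⁱ sgn ((x ∧ a) xor l))

phases₃ : ∀ {n} (f : Fin n → Bool) X →
  phases (copies 3 f) X ≡ (if linear f X then -𝕚 else 1#) ⊛ sgn (quadratic (square-matrix f) X)
phases₃ f [] = refl
phases₃ f (x ∷ X) rewrite phases-copies 3 f x X | phases₃ (f ∘ suc) X | linear-∧ (f zero) (f ∘ suc) X =
  law (f zero) x (linear (f ∘ suc) X) (quadratic (square-matrix (f ∘ suc)) X)
  where
  law : ∀ a x l q →
    (if a then power (if x then 𝕚 else 1#) 3 else 1#) ⊛ ((if l then -𝕚 else 1#) ⊛ sgn q) ≡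
    (if (x ∧ a) xor l then -𝕚 else 1#) ⊛ sgn ((x ∧ (a ∧ l)) xor q)
  law = from-yes (∀-Bool? λ a → ∀-Bool? λ x → ∀-Bool? λ l → ∀-Bool? λ q →
    (if a then power (if x then 𝕚 else 1#) 3 else 1#) ⊛ ((if l then -𝕚 else 1#) ⊛ sgn q) ≟ⁱ
    (if (x ∧ a) xor l then -𝕚 else 1#) ⊛ sgn ((x ∧ (a ∧ l)) xor q))

linear-xor : ∀ {n} (f g : Fin n → Bool) X → linear (λ v → f v xor g v) X ≡ linear f X xor linear g X
linear-xor f g [] = refl
linear-xor f g (x ∷ X) rewrite linear-xor (f ∘ suc) (g ∘ suc) X =
  law x (f zero) (g zero) (linear (f ∘ suc) X) (linear (g ∘ suc) X)
  where
  law : ∀ x a b l k → (x ∧ (a xor b)) xor (l xor k) ≡ ((x ∧ a) xor l) xor ((x ∧ b) xor k)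
  law = from-yes (∀-Bool? λ x → ∀-Bool? λ a → ∀-Bool? λ b → ∀-Bool? λ l → ∀-Bool? λ k →
    (x ∧ (a xor b)) xor (l xor k) ≟ᵇ ((x ∧ a) xor l) xor ((x ∧ b) xor k))

quadratic-xor : ∀ {n} (M N : Matrix n) X →
  quadratic (λ u v → M u v xor N u v) X ≡ quadratic M X xor quadratic N X
quadratic-xor M N [] = refl
quadratic-xor M N (x ∷ X)
  rewrite linear-xor (M zero ∘ suc) (N zero ∘ suc) X
        | quadratic-xor (λ u v → M (suc u) (suc v)) (λ u v → N (suc u) (suc v)) X =
  law x (linear (M zero ∘ suc) X) (linear (N zero ∘ suc) X) _ _
  where
  law : ∀ x l k q r → (x ∧ (l xor k)) xor (q xor r) ≡ ((x ∧ l) xor q) xor ((x ∧ k) xor r)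
  law = from-yes (∀-Bool? λ x → ∀-Bool? λ l → ∀-Bool? λ k → ∀-Bool? λ q → ∀-Bool? λ r →
    (x ∧ (l xor k)) xor (q xor r) ≟ᵇ ((x ∧ l) xor q) xor ((x ∧ k) xor r))

quadratic-toggle : ∀ {n} (G : Graph n) f X →
  quadratic (adj (toggle G f)) X ≡ quadratic (adj G) X xor quadratic (square-matrix f) X
quadratic-toggle G f X = trans (quadratic-cong (λ u v → toggledMatrix-≢ (adj G) f) X)
                               (quadratic-xor (adj G) (square-matrix f) X)

graphState-cong : ∀ {n} {G G′ : Graph n} → (∀ u v → u ≢ v → adj G u v ≡ adj G′ u v) →
                  ∀ X → graphState G X ≡ graphState G′ X
graphState-cong {G = G} {G′} e X = trans (graphState-quadratic G X)
  (trans (cong sgn (quadratic-cong e X)) (sym (graphState-quadratic G′ X)))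

-- Local complementation

apply-HSH : ∀ {n} a (ψ : State n) X → apply H a (apply S a (apply H a ψ)) X ≡
  1# ⊛ (ψ (X [ a ]≔ false) ⊕ 1# ⊛ ψ (X [ a ]≔ true)) ⊕
  (if lookup X a then -1# else 1#) ⊛ (𝕚 ⊛ (ψ (X [ a ]≔ false) ⊕ -1# ⊛ ψ (X [ a ]≔ true)))
apply-HSH a ψ X
  rewrite []≔-idempotent {x = false} {y = false} X a | []≔-idempotent {x = false} {y = true} X a
        | []≔-idempotent {x = true} {y = false} X a | []≔-idempotent {x = true} {y = true} X a
        | lookup∘update a X false | lookup∘update a X true = refl

module _ {n : ℕ} (G : Graph n) (a : Fin n) where
  private
    M = adj G
    ψ₁ ψ₂ ψ₃ : State n
    ψ₁ = apply H a (graphState G)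
    ψ₂ = apply S a ψ₁
    ψ₃ = apply H a ψ₂

  -- With the unnormalized `H`, the product H S H is (1 + i) + (1 - i) times the bit flip at `a`. On
  -- a graph state this flip acts as the sign given by the parity of `X` inside the neighbourhood of
  -- `a`, so the total factor is 2 or 2i.
  rotated-value : ∀ X → ψ₃ X ≡ (2# ⊛ (if linear (M a) X then 𝕚 else 1#)) ⊛ sgn (quadratic M X)
  rotated-value X = begin
    ψ₃ X
      ≡⟨ apply-HSH a (graphState G) X ⟩
    rotate (graphState G (X [ a ]≔ false)) (graphState G (X [ a ]≔ true))
      ≡⟨ cong₂ rotate (graphState-quadratic G (X [ a ]≔ false))
           (trans (graphState-quadratic G (X [ a ]≔ true))
                  (cong sgn (quadratic-update M (symmetric G) (irreflexive G) X a))) ⟩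
    rotate (sgn q₀) (sgn (q₀ xor linear (M a) X))
      ≡⟨ law (lookup X a) (linear (M a) X) q₀ ⟩
    (2# ⊛ (if linear (M a) X then 𝕚 else 1#)) ⊛ sgn (q₀ xor (lookup X a ∧ linear (M a) X))
      ≡⟨ cong (λ q → (2# ⊛ (if linear (M a) X then 𝕚 else 1#)) ⊛ sgn q) quadratic-value ⟨
    (2# ⊛ (if linear (M a) X then 𝕚 else 1#)) ⊛ sgn (quadratic M X) ∎
    where
    open ≡-Reasoning
    q₀ : Bool
    q₀ = quadratic M (X [ a ]≔ false)
    rotate : ℤ[i] → ℤ[i] → ℤ[i]
    rotate x y = 1# ⊛ (x ⊕ 1# ⊛ y) ⊕ (if lookup X a then -1# else 1#) ⊛ (𝕚 ⊛ (x ⊕ -1# ⊛ y))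
    law : ∀ b m q →
      1# ⊛ (sgn q ⊕ 1# ⊛ sgn (q xor m)) ⊕ (if b then -1# else 1#) ⊛ (𝕚 ⊛ (sgn q ⊕ -1# ⊛ sgn (q xor m))) ≡
      (2# ⊛ (if m then 𝕚 else 1#)) ⊛ sgn (q xor (b ∧ m))
    law = from-yes (∀-Bool? λ b → ∀-Bool? λ m → ∀-Bool? λ q →
      1# ⊛ (sgn q ⊕ 1# ⊛ sgn (q xor m)) ⊕ (if b then -1# else 1#) ⊛ (𝕚 ⊛ (sgn q ⊕ -1# ⊛ sgn (q xor m))) ≟ⁱ
      (2# ⊛ (if m then 𝕚 else 1#)) ⊛ sgn (q xor (b ∧ m)))
    quadratic-value : quadratic M X ≡ quadratic M (X [ a ]≔ false) xor (lookup X a ∧ linear (M a) X)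
    quadratic-value with true? (lookup X a)
    ... | inj₁ e = trans (cong (quadratic M) (sym (update-self X a e)))
                     (trans (quadratic-update M (symmetric G) (irreflexive G) X a)
                       (cong (λ b → quadratic M (X [ a ]≔ false) xor (b ∧ linear (M a) X)) (sym e)))
    ... | inj₂ e = trans (cong (quadratic M) (sym (update-self X a e)))
                     (trans (sym (Boolₚ.xor-identityʳ _))
                       (cong (λ b → quadratic M (X [ a ]≔ false) xor (b ∧ linear (M a) X)) (sym e)))

  -- Inverse phase gates on the neighbours of `a` cancel the factor i of `rotated-value` and leave
  -- the sign that counts pairs of neighbours, which is the complementation.
  prepare-localComplement : Preparable (localComplement G a) 0 (graphState G)
  prepare-localComplement = gate H a (gate S a (gate H a (prepare-phases (copies 3 (M a))
    (done (2# , 2#≢0 , λ X → begin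
      phases (copies 3 (M a)) X ⊛ ψ₃ X
        ≡⟨ cong₂ _⊛_ (phases₃ (M a) X) (rotated-value X) ⟩
      ((if linear (M a) X then -𝕚 else 1#) ⊛ sgn (quadratic (square-matrix (M a)) X)) ⊛
        ((2# ⊛ (if linear (M a) X then 𝕚 else 1#)) ⊛ sgn (quadratic M X))
        ≡⟨ law (linear (M a) X) (quadratic (square-matrix (M a)) X) (quadratic M X) ⟩
      2# ⊛ sgn (quadratic M X xor quadratic (square-matrix (M a)) X)
        ≡⟨ cong (λ q → 2# ⊛ sgn q) (quadratic-toggle G (M a) X) ⟨
      2# ⊛ sgn (quadratic (adj (localComplement G a)) X)
        ≡⟨ cong (2# ⊛_) (graphState-quadratic (localComplement G a) X) ⟨
      2# ⊛ graphState (localComplement G a) X ∎)))))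
    where
    open ≡-Reasoning
    law : ∀ l p q → ((if l then -𝕚 else 1#) ⊛ sgn p) ⊛ ((2# ⊛ (if l then 𝕚 else 1#)) ⊛ sgn q) ≡ 2# ⊛ sgn (q xor p)
    law = from-yes (∀-Bool? λ l → ∀-Bool? λ p → ∀-Bool? λ q →
      ((if l then -𝕚 else 1#) ⊛ sgn p) ⊛ ((2# ⊛ (if l then 𝕚 else 1#)) ⊛ sgn q) ≟ⁱ 2# ⊛ sgn (q xor p))

  localComplement-involutive : ∀ u v → u ≢ v → adj (localComplement (localComplement G a) a) u v ≡ M u v
  localComplement-involutive u v u≢v = begin
    adj (localComplement (localComplement G a) a) u v
      ≡⟨ toggledMatrix-≢ M′ (M′ a) u≢v ⟩
    M′ u v xor (M′ a u ∧ M′ a v)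
      ≡⟨ cong₂ _xor_ (toggledMatrix-≢ M (M a) u≢v) (cong₂ _∧_ (same u) (same v)) ⟩
    (M u v xor (M a u ∧ M a v)) xor (M a u ∧ M a v)
      ≡⟨ law (M u v) (M a u ∧ M a v) ⟩
    M u v ∎
    where
    open ≡-Reasoning
    M′ = adj (localComplement G a)
    law : ∀ x y → (x xor y) xor y ≡ x
    law = from-yes (∀-Bool? λ x → ∀-Bool? λ y → (x xor y) xor y ≟ᵇ x)
    same : ∀ w → M′ a w ≡ M a w
    same w with a Finₚ.≟ w
    ... | yes refl = sym (irreflexive G a)
    ... | no _ rewrite irreflexive G a = Boolₚ.xor-identityʳ (M a w)

-- Protocols with one ancilla

addVertex : ∀ {n} → Graph n → (Fin n → Bool) → Graph (suc n)
addVertex G f .adj zero    zero    = false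
addVertex G f .adj zero    (suc v) = f v
addVertex G f .adj (suc u) zero    = f u
addVertex G f .adj (suc u) (suc v) = adj G u v
addVertex G f .symmetric zero    zero    = refl
addVertex G f .symmetric zero    (suc v) = refl
addVertex G f .symmetric (suc u) zero    = refl
addVertex G f .symmetric (suc u) (suc v) = symmetric G u v
addVertex G f .irreflexive zero    = refl
addVertex G f .irreflexive (suc v) = irreflexive G v

module _ {n : ℕ} (G : Graph n) (f : Fin n → Bool) where
  private
    Ĝ = addVertex G f

    value : ∀ b X → graphState Ĝ (b ∷ X) ≡ sgn ((b ∧ linear f X) xor quadratic (adj G) X)
    value b X = graphState-quadratic Ĝ (b ∷ X)

  -- Outcome `true` leaves the parity sign of `X` inside `f`, which two phase gates at each vertex
  -- of `f` remove.
  prepare-deletion : ∀ {K} → Preparable K 0 (graphState G) → Preparable K 1 (graphState Ĝ)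
  prepare-deletion prep = measure σz zero outcome
    where
    law : ∀ l q → sgn l ⊛ sgn ((true ∧ l) xor q) ≡ sgn q
    law = from-yes (∀-Bool? λ l → ∀-Bool? λ q → sgn l ⊛ sgn ((true ∧ l) xor q) ≟ⁱ sgn q)
    outcome : ∀ s → Nonzero (collapse σz s zero (graphState Ĝ)) → Preparable _ 0 (collapse σz s zero (graphState Ĝ))
    outcome false _ = prepare-resp (λ X → trans (value false X) (sym (graphState-quadratic G X))) prep
    outcome true  _ = prepare-phases (copies 2 f) (prepare-resp (λ X → begin
      phases (copies 2 f) X ⊛ graphState Ĝ (true ∷ X)
        ≡⟨ cong₂ _⊛_ (phases₂ f X) (value true X) ⟩
      sgn (linear f X) ⊛ sgn ((true ∧ linear f X) xor quadratic (adj G) X)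
        ≡⟨ law (linear f X) (quadratic (adj G) X) ⟩
      sgn (quadratic (adj G) X)
        ≡⟨ graphState-quadratic G X ⟨
      graphState G X ∎) prep)
      where open ≡-Reasoning

  -- With l the parity of `X` inside `f`, outcome `true` contributes 1 + i(-1)^l, which is (1 +
  -- i)(-i)^l. Phase gates on `f` cancel (-i)^l and add the sign of the clique on `f`; outcome
  -- `false` is the complex conjugate.
  prepare-toggle : Preparable (toggle G f) 1 (graphState Ĝ)
  prepare-toggle = measure σy zero outcome
    where
    open ≡-Reasoning
    result : ∀ X → graphState (toggle G f) X ≡ sgn (quadratic (adj G) X xor quadratic (square-matrix f) X)
    result X = trans (graphState-quadratic (toggle G f) X) (cong sgn (quadratic-toggle G f X))
    law₁ : ∀ l p q → ((if l then 𝕚 else 1#) ⊛ sgn p) ⊛ (sgn q ⊕ 𝕚 ⊛ sgn (l xor q)) ≡ (1# ⊕ 𝕚) ⊛ sgn (q xor p)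
    law₁ = from-yes (∀-Bool? λ l → ∀-Bool? λ p → ∀-Bool? λ q →
      ((if l then 𝕚 else 1#) ⊛ sgn p) ⊛ (sgn q ⊕ 𝕚 ⊛ sgn (l xor q)) ≟ⁱ (1# ⊕ 𝕚) ⊛ sgn (q xor p))
    law₃ : ∀ l p q → ((if l then -𝕚 else 1#) ⊛ sgn p) ⊛ (sgn q ⊕ -𝕚 ⊛ sgn (l xor q)) ≡ (1# ⊕ -𝕚) ⊛ sgn (q xor p)
    law₃ = from-yes (∀-Bool? λ l → ∀-Bool? λ p → ∀-Bool? λ q →
      ((if l then -𝕚 else 1#) ⊛ sgn p) ⊛ (sgn q ⊕ -𝕚 ⊛ sgn (l xor q)) ≟ⁱ (1# ⊕ -𝕚) ⊛ sgn (q xor p))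
    outcome : ∀ s → Nonzero (collapse σy s zero (graphState Ĝ)) →
              Preparable (toggle G f) 0 (collapse σy s zero (graphState Ĝ))
    outcome true _ = prepare-phases (copies 1 f) (done (1# ⊕ 𝕚 , (λ ()) , λ X → begin
      phases (copies 1 f) X ⊛ (graphState Ĝ (false ∷ X) ⊕ 𝕚 ⊛ graphState Ĝ (true ∷ X))
        ≡⟨ cong₂ _⊛_ (phases₁ f X) (cong₂ (λ x y → x ⊕ 𝕚 ⊛ y) (value false X) (value true X)) ⟩
      ((if linear f X then 𝕚 else 1#) ⊛ sgn (quadratic (square-matrix f) X)) ⊛
        (sgn (quadratic (adj G) X) ⊕ 𝕚 ⊛ sgn (linear f X xor quadratic (adj G) X))
        ≡⟨ law₁ (linear f X) (quadratic (square-matrix f) X) (quadratic (adj G) X) ⟩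
      (1# ⊕ 𝕚) ⊛ sgn (quadratic (adj G) X xor quadratic (square-matrix f) X)
        ≡⟨ cong ((1# ⊕ 𝕚) ⊛_) (result X) ⟨
      (1# ⊕ 𝕚) ⊛ graphState (toggle G f) X ∎))
    outcome false _ = prepare-phases (copies 3 f) (done (1# ⊕ -𝕚 , (λ ()) , λ X → begin
      phases (copies 3 f) X ⊛ (graphState Ĝ (false ∷ X) ⊕ -𝕚 ⊛ graphState Ĝ (true ∷ X))
        ≡⟨ cong₂ _⊛_ (phases₃ f X) (cong₂ (λ x y → x ⊕ -𝕚 ⊛ y) (value false X) (value true X)) ⟩
      ((if linear f X then -𝕚 else 1#) ⊛ sgn (quadratic (square-matrix f) X)) ⊛
        (sgn (quadratic (adj G) X) ⊕ -𝕚 ⊛ sgn (linear f X xor quadratic (adj G) X))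
        ≡⟨ law₃ (linear f X) (quadratic (square-matrix f) X) (quadratic (adj G) X) ⟩
      (1# ⊕ -𝕚) ⊛ sgn (quadratic (adj G) X xor quadratic (square-matrix f) X)
        ≡⟨ cong ((1# ⊕ -𝕚) ⊛_) (result X) ⟨
      (1# ⊕ -𝕚) ⊛ graphState (toggle G f) X ∎))

prepare-own : ∀ {n} (G : Graph n) → Preparable G 0 (graphState G)
prepare-own G = done (1# , 1#≢0 , λ X → sym (⊛-identityˡ (graphState G X)))

prepare-≗ : ∀ {n} {G G′ : Graph n} {ψ} → (∀ u v → u ≢ v → adj G u v ≡ adj G′ u v) →
            Preparable G 0 ψ → Preparable G′ 0 ψ
prepare-≗ {G = G} {G′} e (done (c , c≢0 , f)) = done (c , c≢0 , λ X → trans (f X) (cong (c ⊛_) (graphState-cong {G = G} {G′} e X)))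
prepare-≗ {G = G} {G′} e (gate U q prep)      = gate U q (prepare-≗ {G = G} {G′} e prep)

distance-toggle : ∀ {n} (G : Graph n) f → Distance≤ 1 G (toggle G f)
distance-toggle G f = 1 , s≤s z≤n , addVertex G f , prepare-deletion G f (prepare-own G) , prepare-toggle G f

candidate-distance : ∀ {n} {G K : Graph n} → Candidate G K → Distance≤ 1 G K
candidate-distance {G = G} unchanged    = 0 , z≤n , G , prepare-own G , prepare-own G
candidate-distance {G = G} (clique a b c)     = distance-toggle G _
candidate-distance {G = G} (separation a b x) = distance-toggle G _
-- The source extends the local complement rather than `G`: after deleting the ancilla, a second
-- local complementation at `a` returns to `G`.
candidate-distance {G = G} (star a b c)       = 1 , s≤s z≤n , addVertex G′ f ,
  prepare-deletion G′ f (prepare-≗ {G = localComplement G′ a} (localComplement-involutive G a) (prepare-localComplement G′ a)) ,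
  prepare-toggle G′ f
  where
  G′ = localComplement G a
  f = majorityVector (adj G′) a b c

-- Program fragments and loops

T⇒≡true : ∀ {b} → T b → b ≡ true
T⇒≡true {true} _ = refl

<ᵇ-true : ∀ {k l} → k < l → (k <ᵇ l) ≡ true
<ᵇ-true k<l = T⇒≡true (<⇒<ᵇ k<l)

<ᵇ-false : ∀ {k l} → l ≤ k → (k <ᵇ l) ≡ false
<ᵇ-false {k} {l} l≤k with k <ᵇ l in e
... | false = refl
... | true  = contradiction (<ᵇ⇒< k l (subst T (sym e) tt)) (≤⇒≯ l≤k)

updated : ∀ f k v → (f [ k ↦ v ]) k ≡ v
updated f k v rewrite T⇒≡true (≡⇒≡ᵇ k k refl) = refl

not-updated : ∀ f k v {x} → x ≢ k → (f [ k ↦ v ]) x ≡ f x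
not-updated f k v {x} x≢k with x ≡ᵇ k in e
... | false = refl
... | true  = contradiction (≡ᵇ⇒≡ x k (subst T (sym e) tt)) x≢k

-- Jump targets are absolute, so a fragment is compiled for the address at which it occurs in the
-- whole program.
data Code (p : Program) : ℕ → List Instr → ℕ → Set where
  []  : ∀ {l} → Code p l [] l
  _∷_ : ∀ {l i c l′} → fetch p l ≡ just i → Code p (suc l) c l′ → Code p l (i ∷ c) l′

splitCode : ∀ {p l l′} c {d} → Code p l (c ++ d) l′ →
            Code p l c (length c + l) × Code p (length c + l) d l′
splitCode []      cd       = [] , cd
splitCode {l = l} (i ∷ c) (f ∷ cd) with splitCode c cd
... | c′ , d′ rewrite +-suc (length c) l = f ∷ c′ , d′

endCode : ∀ {p l l′} c → Code p l c l′ → l′ ≡ length c + l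
endCode []      []       = refl
endCode {l = l} (i ∷ c) (f ∷ cs) = trans (endCode c cs) (+-suc (length c) l)

fetch-++ : ∀ q i p → fetch (q ++ i ∷ p) (length q) ≡ just i
fetch-++ []      i p = refl
fetch-++ (_ ∷ q) i p = fetch-++ q i p

fetch-end : ∀ p → fetch p (length p) ≡ nothing
fetch-end []      = refl
fetch-end (_ ∷ p) = fetch-end p

wholeCode : ∀ p → Code p 0 p (length p)
wholeCode p = go [] p
  where
  go : ∀ q p → Code (q ++ p) (length q) p (length (q ++ p))
  go q [] rewrite ++-identityʳ q = []
  go q (i ∷ p) = fetch-++ q i p ∷ next
    where
    next : Code (q ++ i ∷ p) (suc (length q)) p (length (q ++ i ∷ p))
    next = subst₂ (λ o l → Code o l p (length o)) (++-assoc q (i ∷ []) p)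
      (trans (length-++ q) (+-comm (length q) 1)) (go (q ++ i ∷ []) p)

-- Register 0 permanently holds `n`. Register `suc i` receives the constant 1 only after the body,
-- which may use it freely. The body starts at `3 + l`.
forCode : ℕ → List Instr → ℕ → List Instr
forCode i B l = const i 0 ∷ jumpLess i 0 (3 + l) ∷ jump (3 + (length B + (3 + l))) ∷
  B ++ const (suc i) 1 ∷ add i i (suc i) ∷ jump (1 + l) ∷ []

-- One instruction sets the counter, each round needs four besides the body, and the failing test
-- and the exit jump are the final two.
loopCost : ℕ → ℕ → ℕ
loopCost n T = 1 + (n * (4 + T) + 2)

-- Executions on inputs with n vertices and words below W

module Machine (p : Program) (W n : ℕ) (W-large : 4 + 4 * n + 4 * n * n ≤ W) where

  data Steps : ℕ → Config → Config → Set where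
    stop : ∀ {c} → Steps 0 c c
    next : ∀ {t c c′ i} → FitsWord W c → fetch p (pc c) ≡ just i → Steps t (exec i c) c′ → Steps (suc t) c c′

  steps-run : ∀ {t c c′} → Steps t c c′ → FitsWord W c′ → fetch p (pc c′) ≡ nothing → Run p W t c c′
  steps-run stop           fits end = halt fits end
  steps-run (next fit f s) fits end = step fit f (steps-run s fits end)

  steps-++ : ∀ {t u c c′ c″} → Steps t c c′ → Steps u c′ c″ → Steps (t + u) c c″
  steps-++ stop           s′ = s′
  steps-++ (next fit f s) s′ = next fit f (steps-++ s s′)

  Registers Memory : Set
  Registers = ℕ → ℕ
  Memory    = ℕ → ℕ

  record Valid (r : Registers) (m : Memory) : Set where
    constructor valid
    field
      regs<W : ∀ k → r k < W
      mem<W  : ∀ a → m a < W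
      reg0   : r 0 ≡ n

  open Valid

  Post : Set₁
  Post = Registers → Memory → Set

  -- A total-correctness triple with a time bound; the exact time and the final state stay hidden,
  -- so that triples compose.
  record Exec (l : ℕ) (r : Registers) (m : Memory) (T l′ : ℕ) (Q : Post) : Set where
    constructor executed
    field
      {time}    : ℕ
      {r′}      : Registers
      {m′}      : Memory
      time≤     : time ≤ T
      steps     : Steps time ⟨ l , r , m ⟩ ⟨ l′ , r′ , m′ ⟩
      satisfies : Q r′ m′

  finish : ∀ {l r m} {Q : Post} → Q r m → Exec l r m 0 l Q
  finish q = executed z≤n stop q

  sequence : ∀ {l r m T l₁ Q U l₂ R} → Exec l r m T l₁ Q →
             (∀ {r₁ m₁} → Q r₁ m₁ → Exec l₁ r₁ m₁ U l₂ R) → Exec l r m (T + U) l₂ R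
  sequence (executed t≤ s q) k with k q
  ... | executed u≤ s′ q′ = executed (+-mono-≤ t≤ u≤) (steps-++ s s′) q′

  relax : ∀ {l r m T T′ l₁ Q} → T ≤ T′ → Exec l r m T l₁ Q → Exec l r m T′ l₁ Q
  relax T≤T′ (executed t≤ s q) = executed (≤-trans t≤ T≤T′) s q

  after : ∀ {l r m T l₁} {Q R : Post} → (∀ {r′ m′} → Q r′ m′ → R r′ m′) → Exec l r m T l₁ Q → Exec l r m T l₁ R
  after f (executed t≤ s q) = executed t≤ s (f q)

  perform : ∀ {l r m T l′ Q} i {l₁ r₁ m₁} → fetch p l ≡ just i → Valid r m →
            exec i ⟨ l , r , m ⟩ ≡ ⟨ l₁ , r₁ , m₁ ⟩ → Exec l₁ r₁ m₁ T l′ Q → Exec l r m (suc T) l′ Q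
  perform i f v refl (executed t≤ s q) = executed (s≤s t≤) (next (regs<W v , mem<W v) f s) q

  valid-set : ∀ {r m d v} → Valid r m → 0 < d → v < W → Valid (r [ d ↦ v ]) m
  valid-set {r} {m} {d} {v} (valid r< m< r0) 0<d v<W = valid regs′ m<
    (trans (not-updated r d v (<⇒≢ 0<d)) r0)
    where
    regs′ : ∀ k → (r [ d ↦ v ]) k < W
    regs′ k with k ≡ᵇ d
    ... | true  = v<W
    ... | false = r< k

  valid-store : ∀ {r m a v} → Valid r m → v < W → Valid r (m [ a ↦ v ])
  valid-store {r} {m} {a} {v} (valid r< m< r0) v<W = valid r< mem′ r0
    where
    mem′ : ∀ x → (m [ a ↦ v ]) x < W
    mem′ x with x ≡ᵇ a
    ... | true  = v<W
    ... | false = m< x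

  assign : ∀ {l r m T l′ Q c} i d v → Code p l (i ∷ c) l′ → Valid r m → 0 < d → v < W →
           exec i ⟨ l , r , m ⟩ ≡ ⟨ suc l , r [ d ↦ v ] , m ⟩ →
           (Code p (suc l) c l′ → Valid (r [ d ↦ v ]) m → Exec (suc l) (r [ d ↦ v ]) m T l′ Q) →
           Exec l r m (suc T) l′ Q
  assign i d v (f ∷ c) V 0<d v<W e k = perform i f V e (k c (valid-set V 0<d v<W))

  -- Registers form a stack: code compiled at level `s` writes only from `s` on, which protects the
  -- loop variables and partial results below.
  Frame : ℕ → Registers → Registers → Set
  Frame s r r′ = ∀ x → x < s → r′ x ≡ r x

  frame-refl : ∀ {s r} → Frame s r r
  frame-refl x _ = refl

  frame-trans : ∀ {s r r′ r″} → Frame s r r′ → Frame s r′ r″ → Frame s r r″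
  frame-trans F F′ x x<s = trans (F′ x x<s) (F x x<s)

  frame-weaken : ∀ {s s′ r r′} → s ≤ s′ → Frame s′ r r′ → Frame s r r′
  frame-weaken s≤s′ F x x<s = F x (<-≤-trans x<s s≤s′)

  frame-set : ∀ {s r r′ d v} → s ≤ d → Frame s r r′ → Frame s r (r′ [ d ↦ v ])
  frame-set {r′ = r′} {d} {v} s≤d F x x<s = trans (not-updated r′ d v (<⇒≢ (<-≤-trans x<s s≤d))) (F x x<s)

  -- The bound on `W` leaves room for region numbers below 4 and for all addresses in four tables of
  -- n² cells.
  4≤W : 4 ≤ W
  4≤W = ≤-trans (m≤m+n 4 (4 * n)) (≤-trans (m≤m+n (4 + 4 * n) (4 * n * n)) W-large)

  n<W : n < W
  n<W = ≤-trans (s≤s (m≤m+n n _)) (≤-trans (s≤s (≤-trans (m≤n+m (4 * n) 3) (m≤m+n (3 + 4 * n) (4 * n * n)))) W-large)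

  module _ {i : ℕ} (0<i : 0 < i) (B : List Instr) {l l′ : ℕ} {T : ℕ}
    (I : ℕ → Post)
    (stable : ∀ k {r r′ m} → Frame i r r′ → I k r m → I k r′ m)
    (body : ∀ k → k < n → ∀ {r m} → Valid r m → r i ≡ k → I k r m →
            Exec (3 + l) r m T (length B + (3 + l)) (λ r′ m′ → Valid r′ m′ × r′ i ≡ k × I (suc k) r′ m′))
    where

    -- The invariant rule. Stability says that the invariant reads only registers below the counter,
    -- since the loop itself writes to the counter and to the register after it.
    loop : Code p l (forCode i B l) l′ → ∀ {r m} → Valid r m → I 0 r m → Exec l r m (loopCost n T) l′ (λ r′ m′ → Valid r′ m′ × I n r′ m′)
    loop code@(f₀ ∷ f₁ ∷ f₂ ∷ rest) {r₀} V₀ I₀ with splitCode B rest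
    ... | _ , (f₃ ∷ f₄ ∷ f₅ ∷ []) =
      assign (const i 0) i 0 code V₀ 0<i (≤-trans (s≤s z≤n) 4≤W) refl λ _ V →
        iterate n 0 (+-identityʳ n) V (updated r₀ i 0) (stable 0 (frame-set {r′ = r₀} ≤-refl frame-refl) I₀)
      where
      end : ℕ
      end = 3 + (length B + (3 + l))

      iterate : ∀ j k → j + k ≡ n → ∀ {r m} → Valid r m → r i ≡ k → I k r m →
                Exec (1 + l) r m (j * (4 + T) + 2) end (λ r′ m′ → Valid r′ m′ × I n r′ m′)
      iterate zero k refl {r} {m} V ri Ik =
        perform (jumpLess i 0 (3 + l)) f₁ V (cong (λ b → ⟨ (if b then 3 + l else 2 + l) , r , m ⟩)
            (trans (cong₂ _<ᵇ_ ri (reg0 V)) (<ᵇ-false {k} {k} ≤-refl)))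
          (perform (jump end) f₂ V refl (finish (V , Ik)))
      iterate (suc j) k e {r} {m} V ri Ik = relax (≤-reflexive (shift j)) (
        perform (jumpLess i 0 (3 + l)) f₁ V (cong (λ b → ⟨ (if b then 3 + l else 2 + l) , r , m ⟩)
            (trans (cong₂ _<ᵇ_ ri (reg0 V)) (<ᵇ-true k<n)))
          (sequence (body k k<n V ri Ik) λ {r₁} {m₁} (V₁ , r₁i , Ik₁) →
            assign (const (suc i) 1) (suc i) 1 (f₃ ∷ f₄ ∷ f₅ ∷ []) V₁ (s≤s z≤n) (≤-trans (s≤s (s≤s z≤n)) 4≤W) refl λ c₁ V₂ →
            assign (add i i (suc i)) i (suc k) c₁ V₂ 0<i (≤-<-trans k<n n<W)
              (cong (λ v → ⟨ 2 + (length B + (3 + l)) , (r₁ [ suc i ↦ 1 ]) [ i ↦ v ] , m₁ ⟩) (incremented r₁ r₁i)) λ { (f₅ ∷ []) V₃ →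
            perform (jump (1 + l)) f₅ V₃ refl
              (iterate j (suc k) (trans (+-suc j k) e) V₃
                (updated (r₁ [ suc i ↦ 1 ]) i (suc k))
                (stable (suc k) (frame-set {r′ = r₁ [ suc i ↦ 1 ]} ≤-refl (frame-set {r′ = r₁} (n≤1+n i) frame-refl)) Ik₁)) }))
        where
        k<n : k < n
        k<n = subst (k <_) e (s≤s (m≤n+m k j))
        incremented : ∀ r₁ → r₁ i ≡ k → (r₁ [ suc i ↦ 1 ]) i + (r₁ [ suc i ↦ 1 ]) (suc i) ≡ suc k
        incremented r₁ e = trans (cong₂ _+_ (trans (not-updated r₁ (suc i) 1 (<⇒≢ (n<1+n i))) e) (updated r₁ (suc i) 1))
                                 (+-comm k 1)
        shift : ∀ j → suc (T + suc (suc (suc (j * (4 + T) + 2)))) ≡ suc j * (4 + T) + 2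
        shift j = cong suc (trans (+-suc T _) (cong suc (trans (+-suc T _) (cong suc (trans (+-suc T _)
                    (cong suc (sym (+-assoc T (j * (4 + T)) 2))))))))

-- Boolean expressions

data BExp (r t : ℕ) : Set where
  trueᵇ       : BExp r t
  _andᵇ_ _xorᵇ_ : BExp r t → BExp r t → BExp r t
  eqᵇ         : Fin r → Fin r → BExp r t
  getᵇ        : Fin t → Fin r → Fin r → BExp r t

⟦_⟧ᵇ : ∀ {n r t} → BExp r t → Vec (Fin n) r → Vec (Matrix n) t → Bool
⟦ trueᵇ ⟧ᵇ      ρ τ = true
⟦ x andᵇ y ⟧ᵇ   ρ τ = ⟦ x ⟧ᵇ ρ τ ∧ ⟦ y ⟧ᵇ ρ τ
⟦ x xorᵇ y ⟧ᵇ   ρ τ = ⟦ x ⟧ᵇ ρ τ xor ⟦ y ⟧ᵇ ρ τ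
⟦ eqᵇ i j ⟧ᵇ    ρ τ = does (lookup ρ i Finₚ.≟ lookup ρ j)
⟦ getᵇ k i j ⟧ᵇ ρ τ = lookup τ k (lookup ρ i) (lookup ρ j)

-- Tables are kept in consecutive regions of n² memory cells, innermost table last.
region : ∀ {t} → Fin t → ℕ
region {suc t} zero    = t
region {suc t} (suc k) = region k

-- Horner evaluation of (k n + i) n + j.
addressCode : (k i j s : ℕ) → List Instr
addressCode k i j s = const s k ∷ mul s s 0 ∷ add s s i ∷ mul s s 0 ∷ add s s j ∷ []

codeᵇ : ∀ {r t} → BExp r t → Vec ℕ r → ℕ → List Instr
codeᵇ trueᵇ        loc s = const s 1 ∷ []
codeᵇ (x andᵇ y)   loc s = codeᵇ x loc s ++ codeᵇ y loc (1 + s) ++ mul s s (1 + s) ∷ []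
codeᵇ (x xorᵇ y)   loc s = codeᵇ x loc s ++ codeᵇ y loc (1 + s) ++
  sub (2 + s) s (1 + s) ∷ sub s (1 + s) s ∷ add s s (2 + s) ∷ []
codeᵇ (eqᵇ i j)    loc s = sub s (lookup loc i) (lookup loc j) ∷ sub (1 + s) (lookup loc j) (lookup loc i) ∷
  add s s (1 + s) ∷ const (1 + s) 1 ∷ sub s (1 + s) s ∷ []
codeᵇ (getᵇ k i j) loc s = addressCode (region k) (lookup loc i) (lookup loc j) s ++ load s s ∷ []

sizeᵇ : ∀ {r t} → BExp r t → ℕ
sizeᵇ trueᵇ        = 1
sizeᵇ (x andᵇ y)   = sizeᵇ x + (sizeᵇ y + 1)
sizeᵇ (x xorᵇ y)   = sizeᵇ x + (sizeᵇ y + 3)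
sizeᵇ (eqᵇ i j)    = 5
sizeᵇ (getᵇ k i j) = 6

bit-∧ : ∀ x y → bit x * bit y ≡ bit (x ∧ y)
bit-∧ true  true  = refl
bit-∧ true  false = refl
bit-∧ false y     = refl

bit-xor : ∀ x y → (bit y ∸ bit x) + (bit x ∸ bit y) ≡ bit (x xor y)
bit-xor true  true  = refl
bit-xor true  false = refl
bit-xor false true  = refl
bit-xor false false = refl

bit≤1 : ∀ x → bit x ≤ 1
bit≤1 true  = ≤-refl
bit≤1 false = z≤n

bit-≟ : ∀ {n} (i j : Fin n) → 1 ∸ ((toℕ i ∸ toℕ j) + (toℕ j ∸ toℕ i)) ≡ bit (does (i Finₚ.≟ j))
bit-≟ i j with i Finₚ.≟ j
... | yes refl rewrite n∸n≡0 (toℕ i) = refl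
... | no i≢j with <-cmp (toℕ i) (toℕ j)
...   | tri< i<j _ _ = m≤n⇒m∸n≡0 (≤-trans (m<n⇒0<n∸m i<j) (m≤n+m _ (toℕ i ∸ toℕ j)))
...   | tri≈ _ i≡j _ = contradiction (toℕ-injective i≡j) i≢j
...   | tri> _ _ j<i = m≤n⇒m∸n≡0 (≤-trans (m<n⇒0<n∸m j<i) (m≤m+n _ (toℕ j ∸ toℕ i)))

region<t : ∀ {t} (k : Fin t) → region k < t
region<t {suc t} zero    = n<1+n t
region<t {suc t} (suc k) = m<n⇒m<1+n (region<t k)

module Expressions (p : Program) (W n : ℕ) (W-large : 4 + 4 * n + 4 * n * n ≤ W) where

  open Machine p W n W-large public
  open Valid public

  address : ℕ → Fin n → Fin n → ℕ
  address k i j = (k * n + toℕ i) * n + toℕ j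

  row<t*n : ∀ {k t} → k < t → (i : Fin n) → k * n + toℕ i < t * n
  row<t*n {k} {t} k<t i = <-≤-trans (+-monoʳ-< (k * n) (toℕ<n i))
    (≤-trans (≤-reflexive (+-comm (k * n) n)) (*-monoˡ-≤ n k<t))

  address<t*n*n : ∀ {k t} → k < t → ∀ i j → address k i j < t * n * n
  address<t*n*n {k} {t} k<t i j = <-≤-trans (+-monoʳ-< ((k * n + toℕ i) * n) (toℕ<n j))
    (≤-trans (≤-reflexive (+-comm _ n)) (*-monoˡ-≤ n (row<t*n k<t i)))

  Env : ∀ {r} → ℕ → Vec ℕ r → Vec (Fin n) r → Registers → Set
  Env s loc ρ r = ∀ v → lookup loc v < s × r (lookup loc v) ≡ toℕ (lookup ρ v)

  env-frame : ∀ {k s s′ r r′} (loc : Vec ℕ k) ρ → s ≤ s′ → Frame s r r′ → Env s loc ρ r → Env s′ loc ρ r′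
  env-frame loc ρ s≤s′ F env v with env v
  ... | lv<s , e = <-≤-trans lv<s s≤s′ , trans (F _ lv<s) e

  env-∷ : ∀ {k s r i} {loc : Vec ℕ k} {ρ} (v : Fin n) → i < s → r i ≡ toℕ v → Env s loc ρ r → Env s (i ∷ loc) (v ∷ ρ) r
  env-∷ v i<s e env zero    = i<s , e
  env-∷ v i<s e env (suc w) = env w

  Tables : ∀ {t} → Vec (Matrix n) t → Memory → Set
  Tables τ m = ∀ k i j → m (address (region k) i j) ≡ bit (lookup τ k i j)

  4n<W : 4 * n < W
  4n<W = ≤-trans (s≤s (≤-trans (m≤n+m (4 * n) 3) (m≤m+n (3 + 4 * n) (4 * n * n)))) W-large

  4nn<W : 4 * n * n < W
  4nn<W = ≤-trans (s≤s (m≤n+m (4 * n * n) (3 + 4 * n))) W-large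

  1<W : 1 < W
  1<W = ≤-trans (s≤s (s≤s z≤n)) 4≤W

  bit<W : ∀ b → bit b < W
  bit<W b = ≤-<-trans (bit≤1 b) 1<W

  addressing : ∀ k li lj s (i j : Fin n) {l c l′ r m T Q} → k < 4 → 0 < s → li < s → lj < s →
    Valid r m → r li ≡ toℕ i → r lj ≡ toℕ j → Code p l (addressCode k li lj s ++ c) l′ →
    (∀ {r′} → Code p (5 + l) c l′ → Valid r′ m → r′ s ≡ address k i j → Frame s r r′ → Exec (5 + l) r′ m T l′ Q) →
    Exec l r m (5 + T) l′ Q
  addressing k li lj s i j {l} {c} {l′} {r} {m} k<4 0<s li<s lj<s V ri rj code cont =
    assign (const s k) s k code V 0<s (<-≤-trans k<4 4≤W) refl λ code₁ V₁ →
    assign (mul s s 0) s (k * n) code₁ V₁ 0<s (≤-<-trans (*-monoˡ-≤ n (<⇒≤ k<4)) 4n<W)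
      (cong (λ v → ⟨ 2 + l , r₁ [ s ↦ v ] , m ⟩) (cong₂ _*_ (updated r s k) (reg0 V₁))) λ code₂ V₂ →
    assign (add s s li) s (k * n + toℕ i) code₂ V₂ 0<s (<-trans (row<t*n k<4 i) 4n<W)
      (cong (λ v → ⟨ 3 + l , r₂ [ s ↦ v ] , m ⟩) (cong₂ _+_ (updated r₁ s (k * n)) (trans (F₂ li li<s) ri))) λ code₃ V₃ →
    assign (mul s s 0) s ((k * n + toℕ i) * n) code₃ V₃ 0<s (≤-<-trans (*-monoˡ-≤ n (<⇒≤ (row<t*n k<4 i))) 4nn<W)
      (cong (λ v → ⟨ 4 + l , r₃ [ s ↦ v ] , m ⟩) (cong₂ _*_ (updated r₂ s (k * n + toℕ i)) (reg0 V₃))) λ code₄ V₄ →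
    assign (add s s lj) s (address k i j) code₄ V₄ 0<s (<-trans (address<t*n*n k<4 i j) 4nn<W)
      (cong (λ v → ⟨ 5 + l , r₄ [ s ↦ v ] , m ⟩) (cong₂ _+_ (updated r₃ s ((k * n + toℕ i) * n)) (trans (F₄ lj lj<s) rj))) λ code₅ V₅ →
    cont code₅ V₅ (updated r₄ s (address k i j)) (frame-set {r′ = r₄} ≤-refl F₄)
    where
    r₁ r₂ r₃ r₄ : Registers
    r₁ = r [ s ↦ k ]
    r₂ = r₁ [ s ↦ k * n ]
    r₃ = r₂ [ s ↦ k * n + toℕ i ]
    r₄ = r₃ [ s ↦ (k * n + toℕ i) * n ]
    F₂ : Frame s r r₂
    F₂ = frame-set {r′ = r₁} ≤-refl (frame-set {r′ = r} ≤-refl frame-refl)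
    F₄ : Frame s r r₄
    F₄ = frame-set {r′ = r₃} ≤-refl (frame-set {r′ = r₂} ≤-refl F₂)

  Result : ℕ → ℕ → Registers → Memory → Post
  Result s v r m r′ m′ = Valid r′ m′ × r′ s ≡ v × Frame s r r′ × m′ ≡ m

  correctᵇ : ∀ {k t} (b : BExp k t) (loc : Vec ℕ k) ρ τ → t ≤ 4 → ∀ s {l l′ r m} → 0 < s →
    Env s loc ρ r → Tables τ m → Valid r m → Code p l (codeᵇ b loc s) l′ →
    Exec l r m (sizeᵇ b) l′ (Result s (bit (⟦ b ⟧ᵇ ρ τ)) r m)
  correctᵇ trueᵇ loc ρ τ t≤4 s {r = r} 0<s env tab V code =
    assign (const s 1) s 1 code V 0<s 1<W refl λ { [] V′ →
      finish (V′ , updated r s 1 , frame-set {r′ = r} ≤-refl frame-refl , refl) }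
  correctᵇ (x andᵇ y) loc ρ τ t≤4 s {l} 0<s env tab V code with splitCode (codeᵇ x loc s) code
  ... | codeˣ , rest with splitCode (codeᵇ y loc (1 + s)) rest
  ...   | codeʸ , rest′ =
    sequence (correctᵇ x loc ρ τ t≤4 s 0<s env tab V codeˣ) λ { {r₁} (V₁ , e₁ , F₁ , refl) →
    sequence (correctᵇ y loc ρ τ t≤4 (1 + s) (s≤s z≤n) (env-frame loc ρ (n≤1+n s) F₁ env) tab V₁ codeʸ)
      λ { {r₂} {m} (V₂ , e₂ , F₂ , refl) →
    assign (mul s s (1 + s)) s (bit (⟦ x ⟧ᵇ ρ τ ∧ ⟦ y ⟧ᵇ ρ τ)) rest′ V₂ 0<s (bit<W (⟦ x ⟧ᵇ ρ τ ∧ ⟦ y ⟧ᵇ ρ τ))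
      (cong (λ v → ⟨ _ , r₂ [ s ↦ v ] , m ⟩)
        (trans (cong₂ _*_ (trans (F₂ s (n<1+n s)) e₁) e₂) (bit-∧ (⟦ x ⟧ᵇ ρ τ) (⟦ y ⟧ᵇ ρ τ)))) λ { [] V₃ →
    finish (V₃ , updated r₂ s _ , frame-set {r′ = r₂} ≤-refl (frame-trans F₁ (frame-weaken (n≤1+n s) F₂)) , refl) } } }
  correctᵇ (x xorᵇ y) loc ρ τ t≤4 s {l} 0<s env tab V code with splitCode (codeᵇ x loc s) code
  ... | codeˣ , rest with splitCode (codeᵇ y loc (1 + s)) rest
  ...   | codeʸ , rest′ =
    sequence (correctᵇ x loc ρ τ t≤4 s 0<s env tab V codeˣ) λ { {r₁} (V₁ , e₁ , F₁ , refl) →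
    sequence (correctᵇ y loc ρ τ t≤4 (1 + s) (s≤s z≤n) (env-frame loc ρ (n≤1+n s) F₁ env) tab V₁ codeʸ)
      λ { {r₂} {m} (V₂ , e₂ , F₂ , refl) →
    let a = bit (⟦ x ⟧ᵇ ρ τ)
        b = bit (⟦ y ⟧ᵇ ρ τ)
        l₀ = length (codeᵇ y loc (1 + s)) + (length (codeᵇ x loc s) + l)
        a₂ = trans (F₂ s (n<1+n s)) e₁
        r₃ = r₂ [ 2 + s ↦ a ∸ b ]
        r₄ = r₃ [ s ↦ b ∸ a ]
        a₃ = trans (not-updated r₂ (2 + s) (a ∸ b) (<⇒≢ (m<n⇒m<1+n (n<1+n s)))) a₂
        b₃ = trans (not-updated r₂ (2 + s) (a ∸ b) (<⇒≢ (n<1+n (1 + s)))) e₂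
        d₄ = trans (not-updated r₃ s (b ∸ a) (λ e → <⇒≢ (m<n⇒m<1+n (n<1+n s)) (sym e))) (updated r₂ (2 + s) (a ∸ b))
    in
    assign (sub (2 + s) s (1 + s)) (2 + s) (a ∸ b) rest′ V₂ (s≤s z≤n) (≤-<-trans (m∸n≤m a b) (bit<W (⟦ x ⟧ᵇ ρ τ)))
      (cong (λ v → ⟨ 1 + l₀ , r₂ [ 2 + s ↦ v ] , m ⟩) (cong₂ _∸_ a₂ e₂)) λ c₃ V₃ →
    assign (sub s (1 + s) s) s (b ∸ a) c₃ V₃ 0<s (≤-<-trans (m∸n≤m b a) (bit<W (⟦ y ⟧ᵇ ρ τ)))
      (cong (λ v → ⟨ 2 + l₀ , r₃ [ s ↦ v ] , m ⟩) (cong₂ _∸_ b₃ a₃)) λ c₄ V₄ →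
    assign (add s s (2 + s)) s (bit (⟦ x ⟧ᵇ ρ τ xor ⟦ y ⟧ᵇ ρ τ)) c₄ V₄ 0<s (bit<W (⟦ x ⟧ᵇ ρ τ xor ⟦ y ⟧ᵇ ρ τ))
      (cong (λ v → ⟨ 3 + l₀ , r₄ [ s ↦ v ] , m ⟩)
        (trans (cong₂ _+_ (updated r₃ s (b ∸ a)) d₄) (bit-xor (⟦ x ⟧ᵇ ρ τ) (⟦ y ⟧ᵇ ρ τ)))) λ { [] V₅ →
    finish (V₅ , updated r₄ s _ ,
      frame-set {r′ = r₄} ≤-refl (frame-set {r′ = r₃} ≤-refl (frame-set {r′ = r₂} (≤-trans (n≤1+n s) (n≤1+n (1 + s)))
        (frame-trans F₁ (frame-weaken (n≤1+n s) F₂)))) , refl) } } }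
  correctᵇ (eqᵇ i j) loc ρ τ t≤4 s {l} {r = r} {m} 0<s env tab V code with env i | env j
  ... | li<s , ri | lj<s , rj =
    assign (sub s li lj) s (u ∸ v) code V 0<s (≤-<-trans (m∸n≤m u v) u<W)
      (cong (λ x → ⟨ 1 + l , r [ s ↦ x ] , m ⟩) (cong₂ _∸_ ri rj)) λ c₁ V₁ →
    assign (sub (1 + s) lj li) (1 + s) (v ∸ u) c₁ V₁ (s≤s z≤n) (≤-<-trans (m∸n≤m v u) v<W)
      (cong (λ x → ⟨ 2 + l , r₁ [ 1 + s ↦ x ] , m ⟩) (cong₂ _∸_ (trans (F₁ lj lj<s) rj) (trans (F₁ li li<s) ri))) λ c₂ V₂ →
    assign (add s s (1 + s)) s ((u ∸ v) + (v ∸ u)) c₂ V₂ 0<s (≤-<-trans bound n<W)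
      (cong (λ x → ⟨ 3 + l , r₂ [ s ↦ x ] , m ⟩)
        (cong₂ _+_ (trans (not-updated r₁ (1 + s) (v ∸ u) (<⇒≢ (n<1+n s))) (updated r s (u ∸ v))) (updated r₁ (1 + s) (v ∸ u)))) λ c₃ V₃ →
    assign (const (1 + s) 1) (1 + s) 1 c₃ V₃ (s≤s z≤n) 1<W refl λ c₄ V₄ →
    assign (sub s (1 + s) s) s (bit (does (lookup ρ i Finₚ.≟ lookup ρ j))) c₄ V₄ 0<s (bit<W _)
      (cong (λ x → ⟨ 5 + l , r₄ [ s ↦ x ] , m ⟩)
        (trans (cong₂ _∸_ (updated r₃ (1 + s) 1)
                          (trans (not-updated r₃ (1 + s) 1 (<⇒≢ (n<1+n s))) (updated r₂ s ((u ∸ v) + (v ∸ u)))))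
               (bit-≟ (lookup ρ i) (lookup ρ j)))) λ { [] V₅ →
    finish (V₅ , updated r₄ s _ ,
      frame-set {r′ = r₄} ≤-refl (frame-set {r′ = r₃} (n≤1+n s) (frame-set {r′ = r₂} ≤-refl
        (frame-set {r′ = r₁} (n≤1+n s) F₁))) , refl) }
    where
    li lj u v : ℕ
    li = lookup loc i
    lj = lookup loc j
    u = toℕ (lookup ρ i)
    v = toℕ (lookup ρ j)
    r₁ r₂ r₃ r₄ : Registers
    r₁ = r [ s ↦ u ∸ v ]
    r₂ = r₁ [ 1 + s ↦ v ∸ u ]
    r₃ = r₂ [ s ↦ (u ∸ v) + (v ∸ u) ]
    r₄ = r₃ [ 1 + s ↦ 1 ]
    F₁ : Frame s r r₁
    F₁ = frame-set {r′ = r} ≤-refl frame-refl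
    u<W : u < W
    u<W = <-trans (toℕ<n (lookup ρ i)) n<W
    v<W : v < W
    v<W = <-trans (toℕ<n (lookup ρ j)) n<W
    bound : (u ∸ v) + (v ∸ u) ≤ n
    bound with ≤-total u v
    ... | inj₁ u≤v rewrite m≤n⇒m∸n≡0 u≤v = ≤-trans (m∸n≤m v u) (<⇒≤ (toℕ<n (lookup ρ j)))
    ... | inj₂ v≤u rewrite m≤n⇒m∸n≡0 v≤u | +-identityʳ (u ∸ v) = ≤-trans (m∸n≤m u v) (<⇒≤ (toℕ<n (lookup ρ i)))
  correctᵇ (getᵇ k i j) loc ρ τ t≤4 s {l} {r = r} {m} 0<s env tab V code with env i | env j
  ... | li<s , ri | lj<s , rj =
    addressing (region k) (lookup loc i) (lookup loc j) s (lookup ρ i) (lookup ρ j)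
      (<-≤-trans (region<t k) t≤4) 0<s li<s lj<s V ri rj code λ {r₁} c₁ V₁ e₁ F₁ →
    assign (load s s) s (bit (lookup τ k (lookup ρ i) (lookup ρ j))) c₁ V₁ 0<s (bit<W (lookup τ k (lookup ρ i) (lookup ρ j)))
      (cong (λ x → ⟨ 6 + l , r₁ [ s ↦ x ] , m ⟩) (trans (cong m e₁) (tab k (lookup ρ i) (lookup ρ j)))) λ { [] V₂ →
    finish (V₂ , updated r₁ s _ , frame-set {r′ = r₁} ≤-refl F₁ , refl) }

-- Numerical expressions

data Fold : Set where
  maxᶠ minᶠ : Fold

-- `closureⁿ` is a let-binding: its second expression is evaluated with one more table, which holds
-- the closure of the matrix given by the first.
data NExp : ℕ → ℕ → Set where
  countⁿ   : ∀ {r t} → BExp (suc r) t → NExp r t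
  foldⁿ    : ∀ {r t} → Fold → NExp (suc r) t → NExp r t
  _⊓ⁿ_     : ∀ {r t} → NExp r t → NExp r t → NExp r t
  closureⁿ : ∀ {r t} → t < 4 → BExp (2 + r) t → NExp r (suc t) → NExp r t

⟦_⟧ᶠ : Fold → ∀ {n} → (Fin n → ℕ) → ℕ
⟦ maxᶠ ⟧ᶠ = maximum
⟦ minᶠ ⟧ᶠ = minimum

-- The variable bound last comes first; in a table the row is bound before the column.
⟦_⟧ⁿ : ∀ {n r t} → NExp r t → Vec (Fin n) r → Vec (Matrix n) t → ℕ
⟦ countⁿ b ⟧ⁿ       ρ τ = count (λ i → ⟦ b ⟧ᵇ (i ∷ ρ) τ)
⟦ foldⁿ o e ⟧ⁿ      ρ τ = ⟦ o ⟧ᶠ (λ i → ⟦ e ⟧ⁿ (i ∷ ρ) τ)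
⟦ e ⊓ⁿ f ⟧ⁿ         ρ τ = ⟦ e ⟧ⁿ ρ τ ⊓ ⟦ f ⟧ⁿ ρ τ
⟦ closureⁿ _ b e ⟧ⁿ ρ τ = ⟦ e ⟧ⁿ ρ (closure (λ i j → ⟦ b ⟧ᵇ (j ∷ i ∷ ρ) τ) ∷ τ)

orᵇ : ∀ {r t} → BExp r t → BExp r t → BExp r t
orᵇ x y = x xorᵇ (y xorᵇ (x andᵇ y))

pivotᵇ : ∀ {r t} → BExp (3 + r) (suc t)
pivotᵇ = orᵇ (getᵇ zero i j) (getᵇ zero i k andᵇ getᵇ zero k j)
  where
  j = zero
  i = suc zero
  k = suc (suc zero)

or-xor : ∀ x y → x xor (y xor (x ∧ y)) ≡ x ∨ y
or-xor = from-yes (∀-Bool? λ x → ∀-Bool? λ y → x xor (y xor (x ∧ y)) ≟ᵇ x ∨ y)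

sweepCode : ∀ {r t} → BExp (2 + r) t → ℕ → Vec ℕ r → ℕ → ℕ → List Instr
sweepCode b k loc s l = forCode s (forCode (1 + s)
  (codeᵇ b (1 + s ∷ s ∷ loc) (2 + s) ++ addressCode k s (1 + s) (3 + s) ++ store (3 + s) (2 + s) ∷ [])
  (3 + l)) l

-- Accumulator in register s, loop counter in 1 + s, new value in 2 + s.
foldCode : List Instr → List Instr → List Instr → ℕ → ℕ → List Instr
foldCode initial B combine s l = initial ++ forCode (1 + s) (B ++ combine) (length initial + l)

-- With truncated subtraction, x + (y ∸ x) is the maximum and x ∸ (x ∸ y) the minimum, so both are
-- free of branches.
initialᶠ combineᶠ : Fold → ℕ → List Instr
initialᶠ maxᶠ s = const s 0 ∷ []
initialᶠ minᶠ s = const s 0 ∷ add s s 0 ∷ []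
combineᶠ maxᶠ s = sub (2 + s) (2 + s) s ∷ add s s (2 + s) ∷ []
combineᶠ minᶠ s = sub (2 + s) s (2 + s) ∷ sub s s (2 + s) ∷ []

codeⁿ : ∀ {r t} → NExp r t → Vec ℕ r → ℕ → ℕ → List Instr
codeⁿ (countⁿ b) loc s l =
  foldCode (const s 0 ∷ []) (codeᵇ b (1 + s ∷ loc) (2 + s)) (add s s (2 + s) ∷ []) s l
codeⁿ (foldⁿ o e) loc s l =
  foldCode (initialᶠ o s) (codeⁿ e (1 + s ∷ loc) (2 + s) (3 + (length (initialᶠ o s) + l))) (combineᶠ o s) s l
codeⁿ (e ⊓ⁿ f) loc s l =
  E ++ codeⁿ f loc (1 + s) (length E + l) ++ sub (1 + s) s (1 + s) ∷ sub s s (1 + s) ∷ []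
  where
  E = codeⁿ e loc s l
codeⁿ (closureⁿ {t = t} _ b e) loc s l =
  fill ++ pivots ++ codeⁿ e loc s (length pivots + (length fill + l))
  where
  fill pivots : List Instr
  fill   = sweepCode b t loc s l
  pivots = forCode s (sweepCode (pivotᵇ {t = t}) t (s ∷ loc) (1 + s) (3 + (length fill + l))) (length fill + l)

-- Per cell, five instructions form the address and one stores the value.
sweepCost : ℕ → ℕ → ℕ
sweepCost n k = loopCost n (loopCost n (k + 6))

costⁿ : ∀ {r t} → ℕ → NExp r t → ℕ
costⁿ n (countⁿ b)               = 2 + loopCost n (sizeᵇ b + 2)
costⁿ n (foldⁿ o e)              = 2 + loopCost n (costⁿ n e + 2)
costⁿ n (e ⊓ⁿ f)                 = costⁿ n e + (costⁿ n f + 2)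
costⁿ n (closureⁿ {r} {t} _ b e) =
  sweepCost n (sizeᵇ b) + (loopCost n (sweepCost n (sizeᵇ (pivotᵇ {r} {t}))) + costⁿ n e)

countTo≤ : ∀ {n} k .(k≤n : k ≤ n) (f : Fin n → Bool) → foldTo _+_ 0 k k≤n (bit ∘ f) ≤ k
countTo≤ zero    _   f = z≤n
countTo≤ (suc k) k<n f = ≤-trans (+-mono-≤ (countTo≤ k _ f) (bit≤1 (f (fromℕ< k<n)))) (≤-reflexive (+-comm k 1))

foldTo≤ : ∀ {n} o z k .(k≤n : k ≤ n) (f : Fin n → ℕ) {N} → (∀ x y → x ≤ N → y ≤ N → o x y ≤ N) → z ≤ N → (∀ i → f i ≤ N) →
          foldTo o z k k≤n f ≤ N
foldTo≤ o z zero    _   f h z≤ f≤ = z≤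
foldTo≤ o z (suc k) k<n f h z≤ f≤ = h _ _ (foldTo≤ o z k _ f h z≤ f≤) (f≤ (fromℕ< k<n))

operation : Fold → ℕ → ℕ → ℕ
operation maxᶠ = _⊔_
operation minᶠ = _⊓_

unit : Fold → ℕ → ℕ
unit maxᶠ n = 0
unit minᶠ n = n

operation≤ : ∀ o {N} x y → x ≤ N → y ≤ N → operation o x y ≤ N
operation≤ maxᶠ x y = ⊔-lub
operation≤ minᶠ x y x≤ y≤ = ≤-trans (m⊓n≤m x y) x≤

unit≤ : ∀ o n → unit o n ≤ n
unit≤ maxᶠ n = z≤n
unit≤ minᶠ n = ≤-refl

value≤ : ∀ {n r t} (e : NExp r t) (ρ : Vec (Fin n) r) τ → ⟦ e ⟧ⁿ ρ τ ≤ n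
value≤ {n} (countⁿ b) ρ τ = countTo≤ n ≤-refl (λ i → ⟦ b ⟧ᵇ (i ∷ ρ) τ)
value≤ {n} (foldⁿ maxᶠ e) ρ τ = foldTo≤ _⊔_ 0 n ≤-refl _ (operation≤ maxᶠ) z≤n (λ i → value≤ e (i ∷ ρ) τ)
value≤ {n} (foldⁿ minᶠ e) ρ τ = foldTo≤ _⊓_ n n ≤-refl _ (operation≤ minᶠ) ≤-refl (λ i → value≤ e (i ∷ ρ) τ)
value≤ (e ⊓ⁿ f) ρ τ = ≤-trans (m⊓n≤m _ _) (value≤ e ρ τ)
value≤ (closureⁿ _ b e) ρ τ = value≤ e ρ _

max-∸ : ∀ x y → x + (y ∸ x) ≡ x ⊔ y
max-∸ x y with ≤-total x y
... | inj₁ x≤y = trans (m+[n∸m]≡n x≤y) (sym (m≤n⇒m⊔n≡n x≤y))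
... | inj₂ y≤x = trans (cong (x +_) (m≤n⇒m∸n≡0 y≤x)) (trans (+-identityʳ x) (sym (m≥n⇒m⊔n≡m y≤x)))

min-∸ : ∀ x y → x ∸ (x ∸ y) ≡ x ⊓ y
min-∸ x y with ≤-total x y
... | inj₁ x≤y = trans (cong (x ∸_) (m≤n⇒m∸n≡0 x≤y)) (sym (m≤n⇒m⊓n≡m x≤y))
... | inj₂ y≤x = trans (m∸[m∸n]≡n y≤x) (sym (m≥n⇒m⊓n≡n y≤x))

-- Correctness of folds and table sweeps

module Correctness (p : Program) (W n : ℕ) (W-large : 4 + 4 * n + 4 * n * n ≤ W) where

  open Expressions p W n W-large

  -- Tables form a stack as well: with `t` of them in scope, code writes only to cells from t n² on.
  Keeps : ℕ → Memory → Memory → Set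
  Keeps t m m′ = ∀ a → a < t * n * n → m′ a ≡ m a

  keeps-trans : ∀ {t m m′ m″} → Keeps t m m′ → Keeps t m′ m″ → Keeps t m m″
  keeps-trans K K′ a a< = trans (K′ a a<) (K a a<)

  keeps-weaken : ∀ {t m m′} → Keeps (suc t) m m′ → Keeps t m m′
  keeps-weaken {t} K a a< = K a (<-≤-trans a< (*-monoˡ-≤ n (*-monoˡ-≤ n (n≤1+n t))))

  tables-keep : ∀ {t m m′} (τ : Vec (Matrix n) t) → Keeps t m m′ → Tables τ m → Tables τ m′
  tables-keep τ K tab k i j = trans (K _ (address<t*n*n (region<t k) i j)) (tab k i j)

  Outcome : ℕ → ℕ → ℕ → Registers → Memory → Post
  Outcome t s v r m r′ m′ = Valid r′ m′ × r′ s ≡ v × Frame s r r′ × Keeps t m m′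

  module _ {t s z : ℕ} (_∙_ : ℕ → ℕ → ℕ) (f : Fin n → ℕ) (0<s : 0 < s) {T : ℕ}
    (initial B combine : List Instr) {l l′ : ℕ} {r₀ : Registers} {m₀ : Memory}
    (run-initial : ∀ {r m l l′} → Valid r m → Code p l initial l′ → Exec l r m 2 l′ (Result s z r m))
    (run-body : ∀ i {r m l₁} → Valid r m → r (1 + s) ≡ toℕ i → Frame s r₀ r → Keeps t m₀ m →
      Code p (3 + (length initial + l)) B l₁ →
      Exec (3 + (length initial + l)) r m T l₁ (Outcome t (2 + s) (f i) r m))
    (run-combine : ∀ {r m l l′} k .(k<n : k < n) → Valid r m → r s ≡ foldTo _∙_ z k (<⇒≤ k<n) f → r (2 + s) ≡ f (fromℕ< k<n) →
      Code p l combine l′ → Exec l r m 2 l′ (λ r′ m′ → Valid r′ m′ × r′ s ≡ foldTo _∙_ z (suc k) k<n f ×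
        Frame s r r′ × r′ (1 + s) ≡ r (1 + s) × m′ ≡ m))
    where

    fold-correct : Valid r₀ m₀ → Code p l (foldCode initial B combine s l) l′ →
                   Exec l r₀ m₀ (2 + loopCost n (T + 2)) l′ (Outcome t s (foldTo _∙_ z n ≤-refl f) r₀ m₀)
    fold-correct V₀ code with splitCode initial code
    ... | code₀ , code₁@(_ ∷ _ ∷ _ ∷ code₂) with splitCode (B ++ combine) code₂
    ...   | code₃ , _ with splitCode B code₃
    ...     | codeB , codeC =
      sequence (run-initial V₀ code₀) λ { {r₁} {m₁} (V₁ , e₁ , F₁ , refl) →
      after (λ (V , I) → let (e , F , K) = I ≤-refl in V , e , F , K)
        (loop (s≤s z≤n) (B ++ combine) Invariant (λ k {r} {r′} → stable k {r} {r′}) body code₁ V₁ λ _ → e₁ , F₁ , λ _ _ → refl) }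
      where
      Invariant : ℕ → Post
      Invariant k r m = (k≤n : k ≤ n) → r s ≡ foldTo _∙_ z k k≤n f × Frame s r₀ r × Keeps t m₀ m

      stable : ∀ k {r r′ m} → Frame (1 + s) r r′ → Invariant k r m → Invariant k r′ m
      stable k F I k≤n with I k≤n
      ... | e , F′ , K = trans (F s (n<1+n s)) e , frame-trans F′ (frame-weaken (n≤1+n s) F) , K

      body : ∀ k → k < n → ∀ {r m} → Valid r m → r (1 + s) ≡ k → Invariant k r m →
             Exec (3 + (length initial + l)) r m (T + 2) (length (B ++ combine) + (3 + (length initial + l)))
               (λ r′ m′ → Valid r′ m′ × r′ (1 + s) ≡ k × Invariant (suc k) r′ m′)
      body k k<n V rk I with I (<⇒≤ k<n)
      ... | e , F , K =
        sequence (run-body (fromℕ< k<n) V (trans rk (sym (toℕ-fromℕ< k<n))) F K codeB) λ { {r₂} {m₂} (V₂ , e₂ , F₂ , K₂) →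
        after (λ { (V₃ , e₃ , F₃ , c₃ , refl) →
            V₃ , trans c₃ (trans (F₂ (1 + s) (n<1+n (1 + s))) rk) , λ _ → e₃ ,
            frame-trans F (frame-trans (frame-weaken (≤-trans (n≤1+n s) (n≤1+n (1 + s))) F₂) F₃) , keeps-trans {t} K K₂ })
          (run-combine k k<n V₂ (trans (F₂ s (m<n⇒m<1+n (n<1+n s))) e) e₂ codeC) }

  position : Fin n → Fin n → ℕ
  position i j = toℕ i * n + toℕ j

  address-position : ∀ t i j → address t i j ≡ t * n * n + position i j
  address-position t i j = trans (cong (_+ toℕ j) (*-distribʳ-+ n (t * n) (toℕ i))) (+-assoc (t * n * n) (toℕ i * n) (toℕ j))

  position-injective : ∀ i j i′ j′ → position i j ≡ position i′ j′ → i ≡ i′ × j ≡ j′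
  position-injective i j i′ j′ e = Finₚ.combine-injective i j i′ j′ (toℕ-injective
    (trans (to-combine i j) (trans e (sym (to-combine i′ j′)))))
    where
    to-combine : ∀ i j → toℕ (combine {n} {n} i j) ≡ position i j
    to-combine i j = trans (Finₚ.toℕ-combine i j) (cong (_+ toℕ j) (*-comm n (toℕ i)))

  table-store : ∀ k li lj s v (i j : Fin n) x {l l′ r m} → k < 4 → 0 < s → li < s → lj < s → v < s →
    Valid r m → r li ≡ toℕ i → r lj ≡ toℕ j → r v ≡ bit x → Code p l (addressCode k li lj s ++ store s v ∷ []) l′ →
    Exec l r m 6 l′ (λ r′ m′ → Valid r′ m′ × Frame s r r′ × m′ ≡ m [ address k i j ↦ bit x ])
  table-store k li lj s v i j x {l} {m = m} k<4 0<s li<s lj<s v<s V ri rj rv code =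
    addressing k li lj s i j k<4 0<s li<s lj<s V ri rj code λ { {r₁} (f ∷ []) V₁ e₁ F₁ →
    perform (store s v) f V₁ (cong₂ (λ a y → ⟨ 6 + l , r₁ , m [ a ↦ y ] ⟩) e₁ (trans (F₁ v v<s) rv))
      (finish (valid-store V₁ (bit<W x) , F₁ , refl)) }

  -- Row-major filling of the table in region t; the cells before position θ are done.
  module _ {k t t′ s : ℕ} (b : BExp (2 + k) t′) (loc : Vec ℕ k) (ρ : Vec (Fin n) k) (t<4 : t < 4) (t′≤4 : t′ ≤ 4) (0<s : 0 < s)
    (new : Matrix n) (old : Fin n → Fin n → ℕ) {r₀ : Registers} {m₀ : Memory} (env : Env s loc ρ r₀) where

    Mixture : ℕ → Memory → Set
    Mixture θ m = Keeps t m₀ m × (∀ i j → (position i j < θ → m (address t i j) ≡ bit (new i j)) ×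
                                          (θ ≤ position i j → m (address t i j) ≡ old i j))

    mixture-at : ∀ {θ θ′ m} → θ ≡ θ′ → Mixture θ m → Mixture θ′ m
    mixture-at refl M = M

    mixture-store : ∀ {m} i j → Mixture (position i j) m → Mixture (suc (position i j)) (m [ address t i j ↦ bit (new i j) ])
    mixture-store {m} i j (K , cells) = (λ a a< → trans (not-updated m (address t i j) _ (<⇒≢ (<-≤-trans a< beyond))) (K a a<)) , cells′
      where
      beyond : t * n * n ≤ address t i j
      beyond = subst (t * n * n ≤_) (sym (address-position t i j)) (m≤m+n _ _)
      elsewhere : ∀ {i′ j′} → position i′ j′ ≢ position i j → address t i′ j′ ≢ address t i j
      elsewhere {i′} {j′} ≢ e = ≢ (+-cancelˡ-≡ (t * n * n) _ _
        (trans (sym (address-position t i′ j′)) (trans e (address-position t i j))))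
      cells′ : ∀ i′ j′ → (position i′ j′ < suc (position i j) → (m [ address t i j ↦ bit (new i j) ]) (address t i′ j′) ≡ bit (new i′ j′)) ×
                         (suc (position i j) ≤ position i′ j′ → (m [ address t i j ↦ bit (new i j) ]) (address t i′ j′) ≡ old i′ j′)
      cells′ i′ j′ = done′ , todo
        where
        done′ : position i′ j′ < suc (position i j) → _
        done′ (s≤s ≤p) with m≤n⇒m<n∨m≡n ≤p
        ... | inj₁ <p = trans (not-updated m _ _ (elsewhere {i′} {j′} (<⇒≢ <p))) (proj₁ (cells i′ j′) <p)
        ... | inj₂ ≡p with position-injective i′ j′ i j ≡p
        ...   | refl , refl = updated m (address t i j) (bit (new i j))
        todo : suc (position i j) ≤ position i′ j′ → _
        todo p< = trans (not-updated m _ _ (elsewhere {i′} {j′} (λ e → <⇒≢ p< (sym e)))) (proj₂ (cells i′ j′) (<⇒≤ p<))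

    -- The value of a cell is required in the memory in which all earlier cells are already
    -- overwritten. So the expression may read the very table that is being filled, as the pivots of
    -- the closure do.
    sweep-correct :
      (∀ i j {m} → Mixture (position i j) m → ∃[ τ ] (Tables τ m × ⟦ b ⟧ᵇ (j ∷ i ∷ ρ) τ ≡ new i j)) →
      ∀ {l l′} → Valid r₀ m₀ → Mixture 0 m₀ → Code p l (sweepCode b t loc s l) l′ →
      Exec l r₀ m₀ (sweepCost n (sizeᵇ b)) l′ (λ r′ m′ → Valid r′ m′ × Frame s r₀ r′ × Mixture (n * n) m′)
    sweep-correct cell {l} V₀ mix₀ code@(_ ∷ _ ∷ _ ∷ rest) with splitCode (forCode (1 + s) inner (3 + l)) rest
      where
      inner = codeᵇ b (1 + s ∷ s ∷ loc) (2 + s) ++ addressCode t s (1 + s) (3 + s) ++ store (3 + s) (2 + s) ∷ []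
    ... | code₁@(_ ∷ _ ∷ _ ∷ rest₁) , _
      with splitCode (codeᵇ b (1 + s ∷ s ∷ loc) (2 + s) ++ addressCode t s (1 + s) (3 + s) ++ store (3 + s) (2 + s) ∷ []) rest₁
    ...   | code₂ , _ with splitCode (codeᵇ b (1 + s ∷ s ∷ loc) (2 + s)) code₂
    ...     | codeB , codeA =
      after (λ (V , I) → V , I ≤-refl)
        (loop 0<s (forCode (1 + s) inner (3 + l)) Rows (λ k {r} {r′} → rows-stable k {r} {r′}) row code V₀ λ _ → frame-refl , mix₀)
      where
      inner : List Instr
      inner = codeᵇ b (1 + s ∷ s ∷ loc) (2 + s) ++ addressCode t s (1 + s) (3 + s) ++ store (3 + s) (2 + s) ∷ []

      Rows : ℕ → Post
      Rows k r m = k ≤ n → Frame s r₀ r × Mixture (k * n) m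

      rows-stable : ∀ k {r r′ m} → Frame s r r′ → Rows k r m → Rows k r′ m
      rows-stable k F I k≤n with I k≤n
      ... | F′ , M = frame-trans F′ F , M

      row : ∀ k → k < n → ∀ {r m} → Valid r m → r s ≡ k → Rows k r m →
            Exec (3 + l) r m (loopCost n (sizeᵇ b + 6)) (length (forCode (1 + s) inner (3 + l)) + (3 + l))
              (λ r′ m′ → Valid r′ m′ × r′ s ≡ k × Rows (suc k) r′ m′)
      row k k<n {r₁} {m₁} V₁ rk I with I (<⇒≤ k<n)
      ... | F₁ , M₁ =
        after (λ (V , I) → let (F , M) = I ≤-refl in
                V , trans (F s (n<1+n s)) rk , λ _ → frame-trans F₁ (frame-weaken (n≤1+n s) F) ,
                mixture-at (+-comm (k * n) n) M)
          (loop (s≤s z≤n) inner Cells (λ k {r} {r′} → cells-stable k {r} {r′}) cell-step code₁ V₁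
            λ _ → frame-refl , mixture-at (sym (+-identityʳ (k * n))) M₁)
        where
        i : Fin n
        i = fromℕ< k<n
        i≡k : toℕ i ≡ k
        i≡k = toℕ-fromℕ< k<n

        Cells : ℕ → Post
        Cells k′ r m = k′ ≤ n → Frame (1 + s) r₁ r × Mixture (k * n + k′) m

        cells-stable : ∀ k′ {r r′ m} → Frame (1 + s) r r′ → Cells k′ r m → Cells k′ r′ m
        cells-stable k′ F I k′≤n with I k′≤n
        ... | F′ , M = frame-trans F′ F , M

        cell-step : ∀ k′ → k′ < n → ∀ {r m} → Valid r m → r (1 + s) ≡ k′ → Cells k′ r m →
              Exec (3 + (3 + l)) r m (sizeᵇ b + 6) (length inner + (3 + (3 + l)))
                (λ r′ m′ → Valid r′ m′ × r′ (1 + s) ≡ k′ × Cells (suc k′) r′ m′)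
        cell-step k′ k′<n {r₂} {m₂} V₂ rk′ I′ with I′ (<⇒≤ k′<n)
        ... | F₂ , M₂ with cell i (fromℕ< k′<n) (mixture-at
                             (sym (cong₂ (λ x y → x * n + y) (toℕ-fromℕ< k<n) (toℕ-fromℕ< k′<n))) M₂)
        ...   | τ , tab , value-eq =
          sequence (correctᵇ b (1 + s ∷ s ∷ loc) (j ∷ i ∷ ρ) τ t′≤4 (2 + s) (s≤s z≤n)
            (env-∷ {r = r₂} j (n<1+n (1 + s)) (trans rk′ (sym j≡k′))
              (env-∷ {r = r₂} i (m<n⇒m<1+n (n<1+n s)) (trans (F₂ s (n<1+n s)) (trans rk (sym i≡k)))
                (env-frame loc ρ (≤-trans (n≤1+n s) (n≤1+n (1 + s))) (frame-trans F₁ (frame-weaken (n≤1+n s) F₂)) env)))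
            tab V₂ codeB) λ { {r₃} (V₃ , e₃ , F₃ , refl) →
          after (λ { (V₄ , F₄ , refl) → V₄ ,
              trans (F₄ (1 + s) (m<n⇒m<1+n (n<1+n (1 + s)))) (trans (F₃ (1 + s) (n<1+n (1 + s))) rk′) , λ _ →
              frame-trans F₂ (frame-trans (frame-weaken (n≤1+n (1 + s)) F₃) (frame-weaken (≤-trans (n≤1+n (1 + s)) (n≤1+n (2 + s))) F₄)) ,
              mixture-at
                (trans (cong₂ (λ x y → suc (x * n + y)) i≡k j≡k′) (sym (+-suc (k * n) k′)))
                (mixture-store i j (mixture-at (sym (cong₂ (λ x y → x * n + y) i≡k j≡k′)) M₂)) })
            (table-store t s (1 + s) (3 + s) (2 + s) i j (new i j) t<4 (s≤s z≤n)
              (m<n⇒m<1+n (m<n⇒m<1+n (n<1+n s))) (m<n⇒m<1+n (n<1+n (1 + s))) (n<1+n (2 + s)) V₃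
              (trans (F₃ s (m<n⇒m<1+n (n<1+n s))) (trans (F₂ s (n<1+n s)) (trans rk (sym i≡k))))
              (trans (F₃ (1 + s) (n<1+n (1 + s))) (trans rk′ (sym j≡k′)))
              (trans e₃ (cong bit value-eq)) codeA) }
          where
          j : Fin n
          j = fromℕ< k′<n
          j≡k′ : toℕ j ≡ k′
          j≡k′ = toℕ-fromℕ< k′<n

-- Correctness of compiled expressions

module Compilation (p : Program) (W n : ℕ) (W-large : 4 + 4 * n + 4 * n * n ≤ W) where

  open Expressions p W n W-large
  open Correctness p W n W-large

  position<n*n : ∀ i j → position i j < n * n
  position<n*n i j = <-≤-trans (+-monoʳ-< (toℕ i * n) (toℕ<n j))
    (≤-trans (≤-reflexive (+-comm (toℕ i * n) n)) (*-monoˡ-≤ n (toℕ<n i)))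

  initial-correct : ∀ o s {r m l l′} → 0 < s → Valid r m → Code p l (initialᶠ o s) l′ →
                    Exec l r m 2 l′ (Result s (unit o n) r m)
  initial-correct maxᶠ s {r} 0<s V code = assign (const s 0) s 0 code V 0<s (<-trans (s≤s z≤n) 1<W) refl λ { [] V′ →
    relax z≤n (finish (V′ , updated r s 0 , frame-set {r′ = r} ≤-refl frame-refl , refl)) }
  initial-correct minᶠ s {r} {m} {l} 0<s V code = assign (const s 0) s 0 code V 0<s (<-trans (s≤s z≤n) 1<W) refl λ code₁ V₁ →
    assign (add s s 0) s n code₁ V₁ 0<s n<W
      (cong (λ v → ⟨ 2 + l , (r [ s ↦ 0 ]) [ s ↦ v ] , m ⟩) (cong₂ _+_ (updated r s 0) (reg0 V₁))) λ { [] V₂ →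
    finish (V₂ , updated (r [ s ↦ 0 ]) s n ,
      frame-set {r′ = r [ s ↦ 0 ]} ≤-refl (frame-set {r′ = r} ≤-refl frame-refl) , refl) }

  Combined : ℕ → ℕ → Registers → Memory → Post
  Combined s v r m r′ m′ = Valid r′ m′ × r′ s ≡ v × Frame s r r′ × r′ (1 + s) ≡ r (1 + s) × m′ ≡ m

  s≢2+s : ∀ {s} → s ≢ 2 + s
  s≢2+s {s} = <⇒≢ (m<n⇒m<1+n (n<1+n s))

  1+s≢s : ∀ {s} → 1 + s ≢ s
  1+s≢s {s} e = <⇒≢ (n<1+n s) (sym e)

  sum-correct : ∀ s {r m l l′ x y} → 0 < s → Valid r m → r s ≡ x → r (2 + s) ≡ y → x + y < W →
                Code p l (add s s (2 + s) ∷ []) l′ → Exec l r m 2 l′ (Combined s (x + y) r m)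
  sum-correct s {r} {m} {l} {x = x} {y} 0<s V rx ry <W code =
    assign (add s s (2 + s)) s (x + y) code V 0<s <W (cong (λ v → ⟨ 1 + l , r [ s ↦ v ] , m ⟩) (cong₂ _+_ rx ry)) λ { [] V′ →
    relax z≤n (finish (V′ , updated r s (x + y) , frame-set {r′ = r} ≤-refl frame-refl ,
      not-updated r s (x + y) 1+s≢s , refl)) }

  combine-correct : ∀ o s {r m l l′ x y} → 0 < s → Valid r m → r s ≡ x → r (2 + s) ≡ y → x < W → y < W →
                    Code p l (combineᶠ o s) l′ → Exec l r m 2 l′ (Combined s (operation o x y) r m)
  combine-correct maxᶠ s {r} {m} {l} {x = x} {y} 0<s V rx ry x<W y<W code =
    assign (sub (2 + s) (2 + s) s) (2 + s) (y ∸ x) code V (s≤s z≤n) (≤-<-trans (m∸n≤m y x) y<W)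
      (cong (λ v → ⟨ 1 + l , r [ 2 + s ↦ v ] , m ⟩) (cong₂ _∸_ ry rx)) λ code₁ V₁ →
    assign (add s s (2 + s)) s (x ⊔ y) code₁ V₁ 0<s (⊔-lub-< x<W y<W)
      (cong (λ v → ⟨ 2 + l , r₁ [ s ↦ v ] , m ⟩)
        (trans (cong₂ _+_ (trans (not-updated r (2 + s) (y ∸ x) s≢2+s) rx) (updated r (2 + s) (y ∸ x))) (max-∸ x y))) λ { [] V₂ →
    finish (V₂ , updated r₁ s (x ⊔ y) , frame-set {r′ = r₁} ≤-refl (frame-set {r′ = r} (≤-trans (n≤1+n s) (n≤1+n (1 + s))) frame-refl) ,
      trans (not-updated r₁ s (x ⊔ y) 1+s≢s) (not-updated r (2 + s) (y ∸ x) (<⇒≢ (n<1+n (1 + s)))) , refl) }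
    where
    r₁ : Registers
    r₁ = r [ 2 + s ↦ y ∸ x ]
    ⊔-lub-< : ∀ {a b c} → a < c → b < c → a ⊔ b < c
    ⊔-lub-< {a} {b} a< b< with ⊔-sel a b
    ... | inj₁ e = subst (_< _) (sym e) a<
    ... | inj₂ e = subst (_< _) (sym e) b<
  combine-correct minᶠ s {r} {m} {l} {x = x} {y} 0<s V rx ry x<W y<W code =
    assign (sub (2 + s) s (2 + s)) (2 + s) (x ∸ y) code V (s≤s z≤n) (≤-<-trans (m∸n≤m x y) x<W)
      (cong (λ v → ⟨ 1 + l , r [ 2 + s ↦ v ] , m ⟩) (cong₂ _∸_ rx ry)) λ code₁ V₁ →
    assign (sub s s (2 + s)) s (x ⊓ y) code₁ V₁ 0<s (≤-<-trans (m⊓n≤m x y) x<W)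
      (cong (λ v → ⟨ 2 + l , r₁ [ s ↦ v ] , m ⟩)
        (trans (cong₂ _∸_ (trans (not-updated r (2 + s) (x ∸ y) s≢2+s) rx) (updated r (2 + s) (x ∸ y))) (min-∸ x y))) λ { [] V₂ →
    finish (V₂ , updated r₁ s (x ⊓ y) , frame-set {r′ = r₁} ≤-refl (frame-set {r′ = r} (≤-trans (n≤1+n s) (n≤1+n (1 + s))) frame-refl) ,
      trans (not-updated r₁ s (x ⊓ y) 1+s≢s) (not-updated r (2 + s) (x ∸ y) (<⇒≢ (n<1+n (1 + s)))) , refl) }
    where
    r₁ : Registers
    r₁ = r [ 2 + s ↦ x ∸ y ]

  Pivoted : ℕ → (s : ℕ) → Matrix n → Registers → Memory → ℕ → Post
  Pivoted t s M r₀ m₀ k r m = (k≤n : k ≤ n) → Frame s r₀ r × Keeps t m₀ m ×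
    (∀ i j → m (address t i j) ≡ bit (closureTo k k≤n M i j))

  -- The pivot works in place: row and column `κ` are equal before and after it, so it is immaterial
  -- which of their cells are overwritten, and the cell being computed still has its old value.
  pivot-correct : ∀ {c t s} (loc : Vec ℕ c) ρ (τ : Vec (Matrix n) t) M {r₀ m₀} → t < 4 → 0 < s → Env s loc ρ r₀ → Tables τ m₀ →
    ∀ k → k < n → ∀ {l l′ r m} → Valid r m → r s ≡ k → Pivoted t s M r₀ m₀ k r m →
    Code p l (sweepCode (pivotᵇ {c} {t}) t (s ∷ loc) (1 + s) l) l′ →
    Exec l r m (sweepCost n (sizeᵇ (pivotᵇ {c} {t}))) l′
      (λ r′ m′ → Valid r′ m′ × r′ s ≡ k × Pivoted t s M r₀ m₀ (suc k) r′ m′)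
  pivot-correct {c} {t} {s} loc ρ τ M {r₀} {m₀} t<4 0<s env tab k k<n {r = r₁} {m₁} V rk I code with I (<⇒≤ k<n)
  ... | F , K , cells =
    after (λ { (V′ , F′ , K′ , cells′) → V′ , trans (F′ s (n<1+n s)) rk , λ _ →
        frame-trans F (frame-weaken (n≤1+n s) F′) , keeps-trans {t} K K′ ,
        λ i j → proj₁ (cells′ i j) (position<n*n i j) })
      (sweep-correct (pivotᵇ {c} {t}) (s ∷ loc) (κ ∷ ρ) t<4 t<4 (s≤s z≤n) new (λ i j → bit (old i j))
        (env-∷ {r = r₁} κ (n<1+n s) (trans rk (sym (toℕ-fromℕ< k<n))) (env-frame loc ρ (n≤1+n s) F env))
        cell V ((λ _ _ → refl) , λ i j → (λ ()) , λ _ → cells i j) code)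
    where
    κ : Fin n
    κ = fromℕ< k<n
    old new : Matrix n
    old = closureTo k (<⇒≤ k<n) M
    new = closureTo (suc k) k<n M

    cell : ∀ i j {m} → _ → ∃[ τ′ ] (Tables τ′ m × ⟦ pivotᵇ {c} {t} ⟧ᵇ (j ∷ i ∷ κ ∷ ρ) τ′ ≡ new i j)
    cell i j {m} (K₂ , cells₂) = mixed ∷ τ , tables , value
      where
      mixed : Matrix n
      mixed i′ j′ = if position i′ j′ <ᵇ position i j then new i′ j′ else old i′ j′

      tables : Tables (mixed ∷ τ) m
      tables zero i′ j′ with <-≤-connex (position i′ j′) (position i j)
      ... | inj₁ p< rewrite <ᵇ-true p< = proj₁ (cells₂ i′ j′) p<
      ... | inj₂ ≤p rewrite <ᵇ-false ≤p = proj₂ (cells₂ i′ j′) ≤p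
      tables (suc q) i′ j′ = tables-keep τ (keeps-trans {t} K K₂) tab q i′ j′

      mixed-old : ∀ i′ j′ → new i′ j′ ≡ old i′ j′ → mixed i′ j′ ≡ old i′ j′
      mixed-old i′ j′ e with position i′ j′ <ᵇ position i j
      ... | true  = e
      ... | false = refl

      current-old : mixed i j ≡ old i j
      current-old rewrite <ᵇ-false (≤-refl {position i j}) = refl

      value : ⟦ pivotᵇ {c} {t} ⟧ᵇ (j ∷ i ∷ κ ∷ ρ) (mixed ∷ τ) ≡ new i j
      value = trans (or-xor (mixed i j) (mixed i κ ∧ mixed κ j)) (cong₂ _∨_ current-old
        (cong₂ _∧_ (mixed-old i κ (pivotAt-column κ old i)) (mixed-old κ j (pivotAt-row κ old j))))

  correctⁿ : ∀ {k t} (e : NExp k t) (loc : Vec ℕ k) ρ τ → t ≤ 4 → ∀ s {l l′ r m} → 0 < s →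
    Env s loc ρ r → Tables τ m → Valid r m → Code p l (codeⁿ e loc s l) l′ →
    Exec l r m (costⁿ n e) l′ (Outcome t s (⟦ e ⟧ⁿ ρ τ) r m)
  correctⁿ {t = t} (countⁿ b) loc ρ τ t≤4 s {l} {r = r₀} {m₀} 0<s env tab V code =
    fold-correct {t} {s} {0} _+_ (bit ∘ f) 0<s (const s 0 ∷ []) (codeᵇ b (1 + s ∷ loc) (2 + s)) (add s s (2 + s) ∷ []) {r₀ = r₀} {m₀}
      (initial-correct maxᶠ s 0<s)
      (λ i {r} {m} V₁ ri F K codeB → after (λ { (V₂ , e₂ , F₂ , refl) → V₂ , e₂ , F₂ , λ _ _ → refl })
        (correctᵇ b (1 + s ∷ loc) (i ∷ ρ) τ t≤4 (2 + s) (s≤s z≤n)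
          (env-∷ {r = r} i (n<1+n (1 + s)) ri (env-frame loc ρ (≤-trans (n≤1+n s) (n≤1+n (1 + s))) F env))
          (tables-keep τ K tab) V₁ codeB))
      (λ k k<n V₁ ex ey → sum-correct s 0<s V₁ ex ey (<-≤-trans (s≤s (≤-trans (countTo≤ (suc k) k<n f) (recompute (suc k ≤? n) k<n))) n<W))
      V code
    where
    f : Fin n → Bool
    f i = ⟦ b ⟧ᵇ (i ∷ ρ) τ
  correctⁿ {t = t} (foldⁿ o e) loc ρ τ t≤4 s {l} {r = r₀} {m₀} 0<s env tab V code =
    after (λ { (V′ , eq , F , K) → V′ , trans eq (fold-value o) , F , K })
      (fold-correct {t} {s} {unit o n} (operation o) f 0<s (initialᶠ o s)
        (codeⁿ e (1 + s ∷ loc) (2 + s) (3 + (length (initialᶠ o s) + l))) (combineᶠ o s) {r₀ = r₀} {m₀}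
        (initial-correct o s 0<s)
        (λ i {r} V₁ ri F K codeB → correctⁿ e (1 + s ∷ loc) (i ∷ ρ) τ t≤4 (2 + s) (s≤s z≤n)
          (env-∷ {r = r} i (n<1+n (1 + s)) ri (env-frame loc ρ (≤-trans (n≤1+n s) (n≤1+n (1 + s))) F env))
          (tables-keep τ K tab) V₁ codeB)
        (λ k k<n V₁ ex ey → combine-correct o s 0<s V₁ ex ey
          (≤-<-trans (foldTo≤ (operation o) (unit o n) k _ f (operation≤ o) (unit≤ o n) (λ i → value≤ e (i ∷ ρ) τ)) n<W)
          (≤-<-trans (value≤ e (_ ∷ ρ) τ) n<W))
        V code)
    where
    f : Fin n → ℕ
    f i = ⟦ e ⟧ⁿ (i ∷ ρ) τ
    fold-value : ∀ o → foldTo (operation o) (unit o n) n ≤-refl f ≡ ⟦ o ⟧ᶠ f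
    fold-value maxᶠ = refl
    fold-value minᶠ = refl
  correctⁿ {t = t} (e ⊓ⁿ f) loc ρ τ t≤4 s {l} {m = m₀} 0<s env tab V code with splitCode (codeⁿ e loc s l) code
  ... | codeE , rest with splitCode (codeⁿ f loc (1 + s) (length (codeⁿ e loc s l) + l)) rest
  ...   | codeF , rest′ =
    sequence (correctⁿ e loc ρ τ t≤4 s 0<s env tab V codeE) λ {r₁} (V₁ , e₁ , F₁ , K₁) →
    sequence (correctⁿ f loc ρ τ t≤4 (1 + s) (s≤s z≤n) (env-frame loc ρ (n≤1+n s) F₁ env) (tables-keep τ K₁ tab) V₁ codeF)
      λ {r₂} {m₂} (V₂ , e₂ , F₂ , K₂) →
    let x = ⟦ e ⟧ⁿ ρ τ
        y = ⟦ f ⟧ⁿ ρ τ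
        l₀ = length (codeⁿ f loc (1 + s) (length (codeⁿ e loc s l) + l)) + (length (codeⁿ e loc s l) + l)
        r₃ = r₂ [ 1 + s ↦ x ∸ y ]
        x₂ = trans (F₂ s (n<1+n s)) e₁
    in
    assign (sub (1 + s) s (1 + s)) (1 + s) (x ∸ y) rest′ V₂ (s≤s z≤n) (≤-<-trans (≤-trans (m∸n≤m x y) (value≤ e ρ τ)) n<W)
      (cong (λ v → ⟨ 1 + l₀ , r₂ [ 1 + s ↦ v ] , m₂ ⟩) (cong₂ _∸_ x₂ e₂)) λ c₃ V₃ →
    assign (sub s s (1 + s)) s (x ⊓ y) c₃ V₃ 0<s (≤-<-trans (≤-trans (m⊓n≤m x y) (value≤ e ρ τ)) n<W)
      (cong (λ v → ⟨ 2 + l₀ , r₃ [ s ↦ v ] , m₂ ⟩)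
        (trans (cong₂ _∸_ (trans (not-updated r₂ (1 + s) (x ∸ y) (<⇒≢ (n<1+n s))) x₂) (updated r₂ (1 + s) (x ∸ y))) (min-∸ x y)))
      λ { [] V₄ →
    finish (V₄ , updated r₃ s (x ⊓ y) ,
      frame-set {r′ = r₃} ≤-refl (frame-set {r′ = r₂} (n≤1+n s) (frame-trans F₁ (frame-weaken (n≤1+n s) F₂))) ,
      keeps-trans {t} K₁ K₂) }
  correctⁿ (closureⁿ {c} {t} t<4 b e) loc ρ τ t≤4 s {l} {r = r₀} {m₀} 0<s env tab V code
    with splitCode (sweepCode b t loc s l) code
  ... | code₁ , rest with splitCode (forCode s (sweepCode (pivotᵇ {t = t}) t (s ∷ loc) (1 + s) (3 + (length (sweepCode b t loc s l) + l)))
                                      (length (sweepCode b t loc s l) + l)) rest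
  ...   | code₂@(_ ∷ _ ∷ _ ∷ inner) , code₃ with splitCode (sweepCode (pivotᵇ {t = t}) t (s ∷ loc) (1 + s) (3 + (length (sweepCode b t loc s l) + l))) inner
  ...     | codeP , _ =
    sequence (sweep-correct b loc ρ t<4 t≤4 0<s M (λ i j → m₀ (address t i j)) {r₀} {m₀} env
        (λ i j (K , _) → τ , tables-keep τ K tab , refl) V ((λ _ _ → refl) , λ i j → (λ ()) , λ _ → refl) code₁)
      λ {r₁} {m₁} (V₁ , F₁ , K₁ , cells₁) →
    sequence (loop 0<s (sweepCode (pivotᵇ {t = t}) t (s ∷ loc) (1 + s) (3 + (length (sweepCode b t loc s l) + l)))
        (Pivoted t s M r₀ m₀)
        (λ k F I k≤n → let (F′ , K , cells) = I k≤n in frame-trans F′ F , K , cells)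
        (λ k k<n V₂ rk I → pivot-correct loc ρ τ M t<4 0<s env tab k k<n V₂ rk I codeP)
        code₂ V₁ λ _ → F₁ , K₁ , λ i j → proj₁ (cells₁ i j) (position<n*n i j))
      λ {r₂} {m₂} (V₂ , I₂) → let (F₂ , K₂ , cells₂) = I₂ ≤-refl in
    after (λ (V₃ , e₃ , F₃ , K₃) → V₃ , e₃ , frame-trans F₂ F₃ , keeps-trans {t} K₂ (keeps-weaken {t} K₃))
      (correctⁿ e loc ρ (closure M ∷ τ) t<4 s 0<s (env-frame loc ρ ≤-refl F₂ env)
        (λ { zero i j → cells₂ i j ; (suc q) i j → tables-keep τ K₂ tab q i j }) V₂ code₃)
    where
    M : Matrix n
    M i j = ⟦ b ⟧ᵇ (j ∷ i ∷ ρ) τ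

-- Running times

-- Powers of `suc n` are at least 1, so they absorb constants and lower powers even for `n` = 0.
record PolyBound (d : ℕ) (f : ℕ → ℕ) : Set where
  constructor _,_
  field
    factor : ℕ
    bound  : ∀ n → f n ≤ factor * suc n ^ d

1≤power : ∀ n d → 1 ≤ suc n ^ d
1≤power n d = m^n>0 (suc n) d

poly-const : ∀ d k → PolyBound d (λ _ → k)
poly-const d k = k , λ n → ≤-trans (≤-reflexive (sym (*-identityʳ k))) (*-monoʳ-≤ k (1≤power n d))

poly-+ : ∀ {d f g} → PolyBound d f → PolyBound d g → PolyBound d (λ n → f n + g n)
poly-+ {d} (C , f≤) (D , g≤) = C + D , λ n →
  ≤-trans (+-mono-≤ (f≤ n) (g≤ n)) (≤-reflexive (sym (*-distribʳ-+ (suc n ^ d) C D)))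

poly-weaken : ∀ {d d′ f} → d ≤ d′ → PolyBound d f → PolyBound d′ f
poly-weaken d≤d′ (C , f≤) = C , λ n → ≤-trans (f≤ n) (*-monoʳ-≤ C (^-monoʳ-≤ (suc n) d≤d′))

poly-n* : ∀ {d f} → PolyBound d f → PolyBound (suc d) (λ n → n * f n)
poly-n* {d} {f} (C , f≤) = C , λ n → begin
  n * f n                   ≤⟨ *-mono-≤ (n≤1+n n) (f≤ n) ⟩
  suc n * (C * suc n ^ d)   ≡⟨ swap (suc n) C (suc n ^ d) ⟩
  C * (suc n * suc n ^ d)   ∎
  where
  open ≤-Reasoning
  swap : ∀ x c y → x * (c * y) ≡ c * (x * y)
  swap = ℕ-Solver.solve-∀

poly-loop : ∀ {d f} → PolyBound d f → PolyBound (suc d) (λ n → loopCost n (f n))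
poly-loop {d} {f} f≤ = poly-+ {suc d} {λ _ → 1} (poly-const (suc d) 1)
  (poly-+ {suc d} {λ n → n * (4 + f n)} (poly-n* {d} {λ n → 4 + f n} (poly-+ {d} {λ _ → 4} (poly-const d 4) f≤)) (poly-const (suc d) 2))

poly-sweep : ∀ k → PolyBound 2 (λ n → sweepCost n k)
poly-sweep k = poly-loop {1} {λ n → loopCost n (k + 6)} (poly-loop {0} {λ _ → k + 6} (poly-const 0 (k + 6)))

degree : ∀ {r t} → NExp r t → ℕ
degree (countⁿ b)       = 1
degree (foldⁿ o e)      = suc (degree e)
degree (e ⊓ⁿ f)         = degree e ⊔ degree f
degree (closureⁿ _ b e) = 3 ⊔ degree e

cost-bound : ∀ {r t} (e : NExp r t) → PolyBound (degree e) (λ n → costⁿ n e)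
cost-bound (countⁿ b)  = poly-+ {1} {λ _ → 2} (poly-const 1 2) (poly-loop {0} {λ _ → sizeᵇ b + 2} (poly-const 0 (sizeᵇ b + 2)))
cost-bound (foldⁿ o e) = poly-+ {d} {λ _ → 2} (poly-const d 2)
  (poly-loop {degree e} {λ n → costⁿ n e + 2} (poly-+ {degree e} {λ n → costⁿ n e} (cost-bound e) (poly-const (degree e) 2)))
  where
  d = suc (degree e)
cost-bound (e ⊓ⁿ f) = poly-+ {d} {λ n → costⁿ n e} (poly-weaken (m≤m⊔n (degree e) (degree f)) (cost-bound e))
  (poly-+ {d} {λ n → costⁿ n f} (poly-weaken (m≤n⊔m (degree e) (degree f)) (cost-bound f)) (poly-const d 2))
  where
  d = degree e ⊔ degree f
cost-bound (closureⁿ {r} {t} _ b e) = poly-+ {d} {λ n → sweepCost n (sizeᵇ b)}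
  (poly-weaken (≤-trans (n≤1+n 2) (m≤m⊔n 3 (degree e))) (poly-sweep (sizeᵇ b)))
  (poly-+ {d} {λ n → loopCost n (sweepCost n (sizeᵇ (pivotᵇ {r} {t})))}
    (poly-weaken (m≤m⊔n 3 (degree e)) (poly-loop {2} {λ n → sweepCost n (sizeᵇ (pivotᵇ {r} {t}))} (poly-sweep (sizeᵇ (pivotᵇ {r} {t})))))
    (poly-weaken (m≤n⊔m 3 (degree e)) (cost-bound e)))
  where
  d = 3 ⊔ degree e

poly-∈𝒪 : ∀ {d f} → PolyBound d f → f ∈𝒪 (λ n → n ^ d)
-- From `n` = 1 on, `suc n` is at most 2n, which costs the factor 2^d.
poly-∈𝒪 {d} {f} (C , f≤) = C * 2 ^ d , 1 , λ n 1≤n → begin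
  f n                    ≤⟨ f≤ n ⟩
  C * suc n ^ d          ≤⟨ *-monoʳ-≤ C (^-monoˡ-≤ d (double 1≤n)) ⟩
  C * (2 * n) ^ d        ≡⟨ cong (C *_) (^-distribʳ-* d 2 n) ⟩
  C * (2 ^ d * n ^ d)    ≡⟨ *-assoc C (2 ^ d) (n ^ d) ⟨
  C * 2 ^ d * n ^ d      ∎
  where
  open ≤-Reasoning
  double : ∀ {n} → 1 ≤ n → suc n ≤ 2 * n
  double {n} 1≤n = ≤-trans (+-monoˡ-≤ n 1≤n) (≤-reflexive (cong (n +_) (sym (+-identityʳ n))))
  ^-distribʳ-* : ∀ d x y → (x * y) ^ d ≡ x ^ d * y ^ d
  ^-distribʳ-* zero    x y = refl
  ^-distribʳ-* (suc d) x y = trans (cong (x * y *_) (^-distribʳ-* d x y)) (exchange x y (x ^ d) (y ^ d))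
    where
    exchange : ∀ a b c d → a * b * (c * d) ≡ a * c * (b * d)
    exchange = ℕ-Solver.solve-∀

-- Programs computing a function of the graph

-- Register 0 has to keep `n` during the computation, so the result is formed in register 1 and
-- moved to the output register at the end.
programOf : NExp 0 1 → Program
programOf e = codeⁿ e [] 1 0 ++ const 2 0 ∷ add 0 1 2 ∷ []

timeOf : NExp 0 1 → ℕ → ℕ
timeOf e n = costⁿ n e + 2

word-large : ∀ n → 4 + 4 * n + 4 * n * n ≤ (2 + n) ^ 4
word-large n = begin
  -- The slack completes the left side to 4(n + 2)², and 4 is at most (n + 2)².
  4 + 4 * n + 4 * n * n                        ≤⟨ m≤m+n _ (12 + 12 * n) ⟩
  4 + 4 * n + 4 * n * n + (12 + 12 * n)        ≡⟨ quadruple n ⟩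
  (2 + n) * (2 + n) * (2 * 2)                  ≤⟨ *-monoʳ-≤ ((2 + n) * (2 + n)) (*-mono-≤ (m≤m+n 2 n) (m≤m+n 2 n)) ⟩
  (2 + n) * (2 + n) * ((2 + n) * (2 + n))      ≡⟨ fourth (2 + n) ⟩
  (2 + n) ^ 4                                  ∎
  where
  open ≤-Reasoning
  quadruple : ∀ n → 4 + 4 * n + 4 * n * n + (12 + 12 * n) ≡ (2 + n) * (2 + n) * (2 * 2)
  quadruple = ℕ-Solver.solve-∀
  fourth : ∀ x → x * x * (x * x) ≡ x * (x * (x * (x * 1)))
  fourth = ℕ-Solver.solve-∀

adjacencyMatrix-entry : ∀ {n} (G : Graph n) i j → adjacencyMatrix G (toℕ i * n + toℕ j) ≡ bit (adj G i j)
adjacencyMatrix-entry {n} G i j with toℕ i * n + toℕ j <? n * n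
... | yes p = cong (λ q → bit (uncurry (adj G) q)) (trans (cong (remQuot n) (toℕ-injective
      (trans (toℕ-fromℕ< p) (trans (cong (_+ toℕ j) (*-comm (toℕ i) n)) (sym (toℕ-combine i j))))))
      (remQuot-combine i j))
... | no ¬p = contradiction (<-≤-trans (+-monoʳ-< (toℕ i * n) (toℕ<n j))
      (≤-trans (≤-reflexive (+-comm (toℕ i * n) n)) (*-monoˡ-≤ n (toℕ<n i)))) ¬p

adjacencyMatrix≤1 : ∀ {n} (G : Graph n) a → adjacencyMatrix G a ≤ 1
adjacencyMatrix≤1 {n} G a with a <? n * n
... | yes p = bit≤1 _
... | no  _ = z≤n

program-correct : ∀ (e : NExp 0 1) {n} (G : Graph n) → ∃[ t ] ∃[ c ]
  (t ≤ timeOf e n × Run (programOf e) ((2 + n) ^ 4) t (input G) c × output c ≡ ⟦ e ⟧ⁿ [] (adj G ∷ []))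
program-correct e {n} G with splitCode (codeⁿ e [] 1 0) (wholeCode (programOf e))
... | code , (f₁ ∷ f₂ ∷ rest) = finalise
  (correctⁿ e [] [] (adj G ∷ []) (s≤s z≤n) 1 (s≤s z≤n) (λ ()) (λ { zero i j → adjacencyMatrix-entry G i j }) V₀ code)
  where
  W : ℕ
  W = (2 + n) ^ 4
  open Expressions (programOf e) W n (word-large n)
  open Correctness (programOf e) W n (word-large n)
  open Compilation (programOf e) W n (word-large n)

  V₀ : Valid ((λ _ → 0) [ 0 ↦ n ]) (adjacencyMatrix G)
  V₀ = valid initial< (λ a → ≤-<-trans (adjacencyMatrix≤1 G a) 1<W) refl
    where
    initial< : ∀ k → ((λ _ → 0) [ 0 ↦ n ]) k < W
    initial< zero    = n<W
    initial< (suc k) = <-trans (s≤s z≤n) 1<W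

  finalise : ∀ {r m} → Exec 0 r m (costⁿ n e) (length (codeⁿ e [] 1 0) + 0) (Outcome 1 1 (⟦ e ⟧ⁿ [] (adj G ∷ [])) r m) →
    ∃[ t ] ∃[ c ] (t ≤ timeOf e n × Run (programOf e) W t ⟨ 0 , r , m ⟩ c × output c ≡ ⟦ e ⟧ⁿ [] (adj G ∷ []))
  finalise (executed {time} {r₁} {m₁} t≤ s (V₁ , e₁ , _ , _)) =
    time + 2 , ⟨ 2 + l , r₃ , m₁ ⟩ , +-monoˡ-≤ 2 t≤ ,
    steps-run (steps-++ s (next (regs<W V₁ , mem<W V₁) f₁ (next (regs<W V₂ , mem<W V₂) f₂ stop)))
      (fits₃ , mem<W V₁) end ,
    trans (cong₂ _+_ (not-updated r₁ 2 0 (λ ())) (updated r₁ 2 0)) (trans (+-identityʳ (r₁ 1)) e₁)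
    where
    l : ℕ
    l = length (codeⁿ e [] 1 0) + 0
    r₂ r₃ : Registers
    r₂ = r₁ [ 2 ↦ 0 ]
    r₃ = r₂ [ 0 ↦ r₂ 1 + r₂ 2 ]
    V₂ : Valid r₂ m₁
    V₂ = valid-set V₁ (s≤s z≤n) (<-trans (s≤s z≤n) 1<W)
    fits₃ : ∀ k → r₃ k < W
    fits₃ zero    = subst (_< W) (sym (+-identityʳ (r₁ 1))) (regs<W V₁ 1)
    fits₃ (suc k) = regs<W V₂ (suc k)
    end : fetch (programOf e) (2 + l) ≡ nothing
    end = trans (cong (fetch (programOf e)) (sym (endCode [] rest))) (fetch-end (programOf e))

-- The algorithm

if-xor : ∀ c x y → y xor (c ∧ (x xor y)) ≡ (if c then x else y)
if-xor = from-yes (∀-Bool? λ c → ∀-Bool? λ x → ∀-Bool? λ y → y xor (c ∧ (x xor y)) ≟ᵇ (if c then x else y))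

closureTo-cong : ∀ {n} k .(k≤n : k ≤ n) {M N : Matrix n} → (∀ i j → M i j ≡ N i j) →
                 ∀ i j → closureTo k k≤n M i j ≡ closureTo k k≤n N i j
closureTo-cong zero    _   e i j = e i j
closureTo-cong (suc k) k<n e i j = cong₂ _∨_ (closureTo-cong k _ e i j)
  (cong₂ _∧_ (closureTo-cong k _ e i _) (closureTo-cong k _ e _ j))

foldTo-cong : ∀ {n} o z k .(k≤n : k ≤ n) {f g : Fin n → ℕ} → (∀ i → f i ≡ g i) →
              foldTo o z k k≤n f ≡ foldTo o z k k≤n g
foldTo-cong o z zero    _   e = refl
foldTo-cong o z (suc k) k<n e = cong₂ o (foldTo-cong o z k _ e) (e _)

largest : ∀ {n} → Matrix n → ℕ
largest M = maximum λ v → count (reachable M v)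

largestⁿ : ∀ {r t} → t < 4 → BExp (2 + r) t → NExp r t
largestⁿ t<4 b = closureⁿ t<4 b (foldⁿ maxᶠ (countⁿ (orᵇ (getᵇ zero i j) (eqᵇ i j))))
  where
  j = zero
  i = suc zero

largest-value : ∀ {n r t} (t<4 : t < 4) (b : BExp (2 + r) t) (ρ : Vec (Fin n) r) τ M →
  (∀ i j → ⟦ b ⟧ᵇ (j ∷ i ∷ ρ) τ ≡ M i j) → ⟦ largestⁿ t<4 b ⟧ⁿ ρ τ ≡ largest M
largest-value {n} t<4 b ρ τ M e = foldTo-cong _⊔_ 0 n ≤-refl λ i → foldTo-cong _+_ 0 n ≤-refl λ j → cong bit
  (trans (or-xor (closure (λ i j → ⟦ b ⟧ᵇ (j ∷ i ∷ ρ) τ) i j) _)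
         (cong (_∨ does (i Finₚ.≟ j)) (closureTo-cong n ≤-refl e i j)))

-- Derived graphs are macros in the indices, expanded wherever an entry is needed; each entry takes
-- constant time and occupies no table.
MatrixExp : ℕ → ℕ → Set
MatrixExp r t = Fin r → Fin r → BExp r t

toggledᵇ : ∀ {r t} → MatrixExp r t → (Fin r → BExp r t) → MatrixExp r t
toggledᵇ g f u v = (trueᵇ xorᵇ eqᵇ u v) andᵇ (g u v xorᵇ (f u andᵇ f v))

majorityᵇ : ∀ {r t} → MatrixExp r t → (a b c : Fin r) → Fin r → BExp r t
majorityᵇ g a b c z = (g z a andᵇ g z b) xorᵇ ((g z b andᵇ g z c) xorᵇ (g z a andᵇ g z c))

arcᵇ : ∀ {r t} → MatrixExp r t → (a b : Fin r) → MatrixExp r t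
arcᵇ g a b z w = g z w xorᵇ (g z b andᵇ g a w)

-- Table 0 holds the closure of the arcs.
sideᵇ : ∀ {r t} → (a x : Fin r) → Fin r → BExp r (suc t)
sideᵇ a x z = orᵇ (orᵇ (getᵇ zero x z) (eqᵇ x z)) (eqᵇ a z)

cutVectorᵇ : ∀ {r t} → MatrixExp r t → (a b : Fin r) → (Fin r → BExp r t) → Fin r → BExp r t
cutVectorᵇ g a b U z = g z a xorᵇ (U z andᵇ (g z b xorᵇ g z a))

module _ where
  private
    -- Variables, from the innermost binder: column, row, and the three chosen vertices.
    j i c b a : Fin 5
    j = zero
    i = suc zero
    c = suc (suc zero)
    b = suc (suc (suc zero))
    a = suc (suc (suc (suc zero)))

    localComplementᵇ : MatrixExp 5 1
    localComplementᵇ = toggledᵇ (getᵇ zero) (getᵇ zero a)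

  cliqueᵇ starᵇ arcsᵇ : BExp 5 1
  cliqueᵇ = toggledᵇ (getᵇ zero) (majorityᵇ (getᵇ zero) a b c) i j
  starᵇ   = toggledᵇ localComplementᵇ (majorityᵇ localComplementᵇ a b c) i j
  arcsᵇ   = arcᵇ (getᵇ zero) a b i j

  separationᵇ : BExp 5 2
  separationᵇ = toggledᵇ (getᵇ (suc zero)) (cutVectorᵇ (getᵇ (suc zero)) a b (sideᵇ a c)) i j

1<4 : 1 < 4
1<4 = s≤s (s≤s z≤n)

2<4 : 2 < 4
2<4 = s≤s (s≤s (s≤s z≤n))

-- The closure of the arcs depends on `a` and `b` only; recomputing it for every third vertex stays
-- within the cubic cost of a triple.
tripleⁿ : NExp 3 1
tripleⁿ = largestⁿ 1<4 cliqueᵇ ⊓ⁿ (largestⁿ 1<4 starᵇ ⊓ⁿ closureⁿ 1<4 arcsᵇ (largestⁿ 2<4 separationᵇ))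

integrityⁿ : NExp 0 1
integrityⁿ = largestⁿ 1<4 (getᵇ zero (suc zero) zero) ⊓ⁿ
  foldⁿ minᶠ (foldⁿ minᶠ (foldⁿ minᶠ tripleⁿ))

triple : ∀ {n} → Graph n → (a b c : Fin n) → ℕ
triple G a b c = largest (adj (toggle G (majorityVector (adj G) a b c))) ⊓
  (largest (adj (toggle H′ (majorityVector (adj H′) a b c))) ⊓
   largest (adj (toggle G (cutVector (adj G) a b (side (adj G) a b c)))))
  where
  H′ = localComplement G a

integrity : ∀ {n} → Graph n → ℕ
integrity G = largest (adj G) ⊓ minimum λ a → minimum λ b → minimum λ c → triple G a b c

toggled-cong : ∀ {n} {M : Matrix n} {f f′ : Fin n → Bool} → (∀ z → f z ≡ f′ z) →
               ∀ i j → toggledMatrix M f i j ≡ toggledMatrix M f′ i j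
toggled-cong {M = M} e i j = cong (λ x → not (does (i Finₚ.≟ j)) ∧ (M i j xor x)) (cong₂ _∧_ (e i) (e j))

integrity-value : ∀ {n} (G : Graph n) → ⟦ integrityⁿ ⟧ⁿ [] (adj G ∷ []) ≡ integrity G
integrity-value {n} G = cong₂ _⊓_ (largest-value 1<4 (getᵇ zero (suc zero) zero) [] τ M λ _ _ → refl)
  (min-cong λ a → min-cong λ b → min-cong λ c →
    cong₂ _⊓_ (largest-value 1<4 cliqueᵇ (c ∷ b ∷ a ∷ []) τ (adj (toggle G (majorityVector M a b c))) λ _ _ → refl)
      (cong₂ _⊓_
        (largest-value 1<4 starᵇ (c ∷ b ∷ a ∷ []) τ
          (adj (toggle (localComplement G a) (majorityVector (adj (localComplement G a)) a b c))) λ _ _ → refl)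
        (largest-value 2<4 separationᵇ (c ∷ b ∷ a ∷ []) (closure (arc M a b) ∷ τ)
          (toggledMatrix M (cutVector M a b (side M a b c))) (separation-value a b c))))
  where
  M : Matrix n
  M = adj G
  τ : Vec (Matrix n) 1
  τ = M ∷ []
  min-cong : ∀ {f g : Fin n → ℕ} → (∀ i → f i ≡ g i) → minimum f ≡ minimum g
  min-cong = foldTo-cong _⊓_ n n ≤-refl
  separation-value : ∀ a b c i j → ⟦ separationᵇ ⟧ᵇ (j ∷ i ∷ c ∷ b ∷ a ∷ []) (closure (arc M a b) ∷ τ) ≡
                     toggledMatrix M (cutVector M a b (side M a b c)) i j
  separation-value a b c = toggled-cong {M = M} λ z →
    trans (if-xor _ (M z b) (M z a)) (cong (λ u → if u then M z b else M z a)
      (trans (or-xor _ (does (a Finₚ.≟ z))) (cong (_∨ does (a Finₚ.≟ z)) (or-xor (closure (arc M a b) c z) _))))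

-- Components and reachability

reach-star : ∀ {n} (G : Graph n) v w → reachable (adj G) v w ≡ true → Star (Edge G) v w
reach-star G v w = reachable-sound (adj G) (Star (Edge G) v)
  (λ z w vz zw → vz ◅◅ (Equivalence.from Boolₚ.T-≡ zw ◅ ε)) v w ε

star-reach : ∀ {n} (G : Graph n) u {v w} → reachable (adj G) u v ≡ true → Star (Edge G) v w → reachable (adj G) u w ≡ true
star-reach G u uv ε             = uv
star-reach G u {v} uv (vx ◅ xw) = star-reach G u (reachable-step (adj G) u v _ uv (T⇒≡true vx)) xw

count-lookup : ∀ {n} (C : Subset n) → count (lookup C) ≡ ∣ C ∣
count-lookup C = trans (count≡∣tabulate∣ (lookup C)) (cong ∣_∣ (tabulate∘lookup C))

reachable-component : ∀ {n} (G : Graph n) v → IsComponent G (tabulate (reachable (adj G) v))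
reachable-component G v = v , λ w → mk⇔
  (λ w∈ → reach-star G v w (trans (sym (lookup∘tabulate (reachable (adj G) v) w)) ([]=⇒lookup w∈)))
  (λ s → lookup⇒[]= w _ (trans (lookup∘tabulate (reachable (adj G) v) w)
    (star-reach G v (reachable-refl (adj G) v) s)))

component-size : ∀ {n} {G : Graph n} {s} → (∀ C → IsComponent G C → ∣ C ∣ ≤ s) → ∀ v → count (reachable (adj G) v) ≤ s
component-size {G = G} bounded v = ≤-trans (≤-reflexive (count≡∣tabulate∣ (reachable (adj G) v)))
  (bounded _ (reachable-component G v))

largest-maxComponentSize : ∀ {n} (G : Graph n) → MaxComponentSize G (largest (adj G))
largest-maxComponentSize {n} G = upper , λ s bounded → maximum-least _ (component-size {G = G} bounded)
  where
  upper : ∀ C → IsComponent G C → ∣ C ∣ ≤ largest (adj G)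
  upper C (v , iff) = ≤-trans (≤-reflexive (sym (count-lookup C)))
    (≤-trans (count-mono (lookup C) (reachable (adj G) v) λ w w∈ →
        star-reach G v (reachable-refl (adj G) v) (Equivalence.to (iff w) (lookup⇒[]= w C w∈)))
      (maximum-upper (λ v → count (reachable (adj G) v)) v))

small-largest : ∀ {n} (K : Graph n) {s} → Small K s → largest (adj K) ≤ s
small-largest K {s} small = maximum-least _ bound
  where
  bound : ∀ v → count (reachable (adj K) v) ≤ s
  bound v with small v
  ... | U , Uv , U≤s , closed = ≤-trans
    (count-mono (reachable (adj K) v) U λ w → reachable-sound (adj K) (λ z → U z ≡ true) closed v w Uv) U≤s

-- The minimum over the candidates is the integrity

module _ {n : ℕ} (G : Graph n) where

  integrity≤triple : ∀ a b c → integrity G ≤ triple G a b c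
  integrity≤triple a b c = ≤-trans (m⊓n≤n (largest (adj G)) _) (≤-trans (minimum-lower _ a)
    (≤-trans (minimum-lower _ b) (minimum-lower (triple G a b) c)))

  integrity-lower : ∀ {K} → Candidate G K → integrity G ≤ largest (adj K)
  integrity-lower unchanged          = m⊓n≤m (largest (adj G)) _
  integrity-lower (clique a b c)     = ≤-trans (integrity≤triple a b c) (m⊓n≤m _ _)
  integrity-lower (star a b c)       = ≤-trans (integrity≤triple a b c)
    (≤-trans (m⊓n≤n (largest (adj (toggle G (majorityVector (adj G) a b c)))) _) (m⊓n≤m _ _))
  integrity-lower (separation a b c) = ≤-trans (integrity≤triple a b c)
    (≤-trans (m⊓n≤n (largest (adj (toggle G (majorityVector (adj G) a b c)))) _) (m⊓n≤n _ _))

  Attained : ℕ → Set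
  Attained v = ∃[ K ] (Candidate G K × largest (adj K) ≡ v)

  attained-⊓ : ∀ (P : ℕ → Set) x y → P x → P y → P (x ⊓ y)
  attained-⊓ P x y Px Py with ⊓-sel x y
  ... | inj₁ e = subst P (sym e) Px
  ... | inj₂ e = subst P (sym e) Py

  triple-attained : ∀ a b c → Attained (triple G a b c)
  triple-attained a b c = attained-⊓ Attained _ _ (_ , clique a b c , refl)
    (attained-⊓ Attained _ _ (_ , star a b c , refl) (_ , separation a b c , refl))

  largest≤n : largest (adj G) ≤ n
  largest≤n = maximum-least _ λ v → countTo≤ n ≤-refl (reachable (adj G) v)

  -- The minimum over no triples is n.
  integrity-attained : Attained (integrity G)
  integrity-attained = capped (minimum-attained _ Capped (inj₁ refl) λ a → minimum-attained _ Capped (inj₁ refl) λ b →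
    minimum-attained _ Capped (inj₁ refl) λ c → inj₂ (triple-attained a b c))
    where
    Capped : ℕ → Set
    Capped v = v ≡ n ⊎ Attained v
    capped : ∀ {v} → Capped v → Attained (largest (adj G) ⊓ v)
    capped (inj₁ refl) = G , unchanged , sym (m≤n⇒m⊓n≡m largest≤n)
    capped (inj₂ att)  = attained-⊓ Attained _ _ (G , unchanged , refl) att

  integrity-correct : IsAncillaIntegrity 1 G (integrity G)
  integrity-correct = attained integrity-attained , lower
    where
    attained : Attained (integrity G) → ∃[ G′ ] (Distance≤ 1 G G′ × MaxComponentSize G′ (integrity G))
    attained (K , cand , e) = K , candidate-distance cand , subst (MaxComponentSize K) e (largest-maxComponentSize K)

    lower : ∀ s → ∃[ G′ ] (Distance≤ 1 G G′ × MaxComponentSize G′ s) → integrity G ≤ s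
    lower s (G′ , dist , bounded , _) = conclude (good-candidate _≟ˢ_ G label
        (distance-good _≟ˢ_ {G} {G′} dist label same-label) classes)
      where
      M : Matrix n
      M = adj G′

      -- The classes are the components of `G′`, each named by its vertex set so that equality of
      -- labels is decidable.
      label : Fin n → Subset n
      label v = tabulate (reachable M v)

      _≟ˢ_ : DecidableEquality (Subset n)
      _≟ˢ_ = ≡-dec _≟ᵇ_

      follow : ∀ u v → adj G′ u v ≡ true → ∀ w → reachable M u w ≡ true → reachable M v w ≡ true
      follow u v uv w = reachable-sound M (λ z → reachable M v z ≡ true)
        (λ z x vz zx → reachable-step M v z x vz zx) u w
        (reachable-step M v v u (reachable-refl M v) (trans (symmetric G′ v u) uv))

      same-label : ∀ u v → adj G′ u v ≡ true → label u ≡ label v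
      same-label u v uv = tabulate-cong λ w → iff (follow u v uv w) (follow v u (trans (symmetric G′ v u) uv) w)
        where
        iff : ∀ {x y : Bool} → (x ≡ true → y ≡ true) → (y ≡ true → x ≡ true) → x ≡ y
        iff {true}          f g = sym (f refl)
        iff {false} {true}  f g = g refl
        iff {false} {false} f g = refl

      classes : ClassesBounded _≟ˢ_ label s
      classes v = ≤-trans (count-mono _ (reachable M v) λ z e →
          trans (sym (lookup∘tabulate (reachable M v) z)) (trans (cong (λ C → lookup C z) (sym (does-true (label z ≟ˢ label v) e)))
            (trans (lookup∘tabulate (reachable M z) z) (reachable-refl M z))))
        (component-size {G = G′} bounded v)

      conclude : GoodCandidate G s → integrity G ≤ s
      conclude (K , cand , small) = ≤-trans (integrity-lower cand) (small-largest K small)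

theorem1p5 : ∃[ algorithm ] ∃[ time ]
    (time ∈𝒪 (λ n → n ^ 6) × ComputesInTime algorithm (IsAncillaIntegrity 1) time)
theorem1p5 = programOf integrityⁿ , timeOf integrityⁿ ,
  -- Three nested minima contribute degree 3, and the closures inside them another 3.
  poly-∈𝒪 {6} (poly-+ {6} {λ n → costⁿ n integrityⁿ} (cost-bound integrityⁿ) (poly-const 6 2)) ,
  4 , λ n G → let (t , c , t≤ , run , out) = program-correct integrityⁿ G in
    t , c , t≤ , run , subst (IsAncillaIntegrity 1 G) (sym (trans out (integrity-value G))) (integrity-correct G)
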